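{- The following four minimization problems are pairwise equivalent under cost-preserving reductions: (1) \textsc{Nearest Codeword}, (2) \textsc{Odd Set}, (3) $\mathrm{MinCSP}(B_2)$, and (4) $\mathrm{MinCSP}(B_3)$, where $B_2=\{\mathrm{EVEN}^4,\{1\},\{0\}\}$ and $B_3=\{\mathrm{EVEN}^4,\{(0,1),(1,0)\}\}$.
   Context: $\mathrm{EVEN}^4=\{a\in\{0,1\}^4:\sum_i a_i\text{ is even}\}$. For a finite set $\Gamma$ of Boolean relations, an instance of $\mathrm{MinCSP}(\Gamma)$ consists of variables $V$ and constraints $\mathcal{C}$ (pairs $\langle s,R\rangle$ with $R\in\Gamma$ and $s$ a tuple of variables of the arity of $R$); a feasible solution is a set $W\subseteq\mathcal{C}$ such that some assignment $V\to\{0,1\}$ satisfies every constraint in $\mathcal{C}\setminus W$; its cost is $|W|$, to be minimized. \textsc{Nearest Codeword}: given an $m\times n$ matrix $A$ over $\mathrm{GF}(2)$ and $b\in\mathrm{GF}(2)^m$, find $x\in\mathrm{GF}(2)^n$ minimizing the Hamming distance between $Ax$ and $b$ (the cost). \textsc{Odd Set}: given a set system $\{S_1,\dots,S_m\}$ over a universe $U$, a feasible solution is $T\subseteq U$ with $|S_i\cap T|$ odd for every $i$; its cost is $|T|$, to be minimized. A cost-preserving reduction from minimization problem $P$ to $Q$ is a pair of polynomial-time functions $F,G$ such that for every feasible instance $I$ of $P$ (one having a feasible solution), $F(I)$ is a feasible instance of $Q$ with the same optimum cost as $I$, and for every feasible solution $S'$ of $F(I)$, $G(I,S')$ is a feasible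 solution of $I$ of cost at most the cost of $S'$. -}

module Defs where

open import Data.Bool using (Bool; true; false; _∧_; _xor_; if_then_else_)
open import Data.Bool.Properties using (_≟_)
open import Data.Fin using (Fin; toℕ)
open import Data.Fin.Subset using (Subset; _∩_; ∣_∣; _∉_)
open import Data.List using (List; []; _∷_; length; lookup; replicate)
import Data.List as List
open import Data.List.Relation.Unary.Unique.Propositional using (Unique)
open import Data.Nat using (ℕ; suc; _+_; _*_; _^_; _≤_)
open import Data.Nat.Divisibility using (_∣_; _∤_)
open import Data.Product using (Σ; ∃-syntax; _×_; _,_)
open import Data.Sum using (_⊎_; inj₁; inj₂)
open import Data.Unit using (⊤; tt)
open import Data.Vec using (Vec; []; _∷_; map; zip; zipWith; foldr′; sum; count; toList)
import Data.Vec as Vec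
open import Level using (0ℓ)
open import Relation.Binary.PropositionalEquality using (_≡_)
open import Relation.Nullary.Decidable using (¬?)
open import Relation.Unary using (Pred; ｛_｝; _∪_)

-- The machine model for polynomial time is a Turing-complete first-order language with
-- unbounded loops over finite data.  Every primitive step is charged the
-- full size of the datum it acts on.  Running time is thus polynomially
-- related to Turing machine time, and since a run of cost t has output of
-- size at most 2t, repeated copying cannot build large data cheaply.

infixr 6 _⊕_
infixr 7 _⊗_

data Ty : Set where
  𝟙       : Ty
  _⊕_ _⊗_ : Ty → Ty → Ty
  list    : Ty → Ty

⟦_⟧ : Ty → Set
⟦ 𝟙 ⟧      = ⊤
⟦ A ⊕ B ⟧  = ⟦ A ⟧ ⊎ ⟦ B ⟧
⟦ A ⊗ B ⟧  = ⟦ A ⟧ × ⟦ B ⟧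
⟦ list A ⟧ = List ⟦ A ⟧

size     : (A : Ty) → ⟦ A ⟧ → ℕ
sizeList : (A : Ty) → List ⟦ A ⟧ → ℕ

size 𝟙        tt       = 1
size (A ⊕ B)  (inj₁ x) = suc (size A x)
size (A ⊕ B)  (inj₂ y) = suc (size B y)
size (A ⊗ B)  (x , y)  = suc (size A x + size B y)
size (list A) xs       = sizeList A xs

sizeList A []       = 1
sizeList A (x ∷ xs) = suc (size A x + sizeList A xs)

data Prim : Ty → Ty → Set where
  skip   : ∀ {A} → Prim A A
  drop   : ∀ {A} → Prim A 𝟙
  fst    : ∀ {A B} → Prim (A ⊗ B) A
  snd    : ∀ {A B} → Prim (A ⊗ B) B
  inl    : ∀ {A B} → Prim A (A ⊕ B)
  inr    : ∀ {A B} → Prim B (A ⊕ B)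
  distr  : ∀ {A B C} → Prim ((A ⊕ B) ⊗ C) ((A ⊗ C) ⊕ (B ⊗ C))
  nil    : ∀ {A} → Prim 𝟙 (list A)
  cons   : ∀ {A} → Prim (A ⊗ list A) (list A)
  uncons : ∀ {A} → Prim (list A) (𝟙 ⊕ (A ⊗ list A))

apply : ∀ {A B} → Prim A B → ⟦ A ⟧ → ⟦ B ⟧
apply skip   x            = x
apply drop   _            = tt
apply fst    (x , _)      = x
apply snd    (_ , y)      = y
apply inl    x            = inj₁ x
apply inr    y            = inj₂ y
apply distr  (inj₁ x , z) = inj₁ (x , z)
apply distr  (inj₂ y , z) = inj₂ (y , z)
apply nil    _            = []
apply cons   (x , xs)     = x ∷ xs
apply uncons []           = inj₁ tt
apply uncons (x ∷ xs)     = inj₂ (x , xs)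

infixr 5 _⨾_

-- `loop p` reruns p as long as it answers on the left.
data Prog : Ty → Ty → Set where
  prim   : ∀ {A B} → Prim A B → Prog A B
  _⨾_    : ∀ {A B C} → Prog A B → Prog B C → Prog A C
  fork   : ∀ {A B C} → Prog A B → Prog A C → Prog A (B ⊗ C)
  branch : ∀ {A B C} → Prog A C → Prog B C → Prog (A ⊕ B) C
  loop   : ∀ {A B} → Prog A (A ⊕ B) → Prog A B

infix 4 _⊢_⇓_[_]

-- p ⊢ x ⇓ y [ t ]: on input x the program p halts with output y at cost t.
data _⊢_⇓_[_] : ∀ {A B} → Prog A B → ⟦ A ⟧ → ⟦ B ⟧ → ℕ → Set where
  run-prim : ∀ {A B} {p : Prim A B} {x} →
    prim p ⊢ x ⇓ apply p x [ size A x ]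
  run-⨾ : ∀ {A B C} {p : Prog A B} {q : Prog B C} {x y z t u} →
    p ⊢ x ⇓ y [ t ] → q ⊢ y ⇓ z [ u ] → p ⨾ q ⊢ x ⇓ z [ t + u ]
  run-fork : ∀ {A B C} {p : Prog A B} {q : Prog A C} {x y z t u} →
    p ⊢ x ⇓ y [ t ] → q ⊢ x ⇓ z [ u ] →
    fork p q ⊢ x ⇓ (y , z) [ size A x + t + u ]
  run-inl : ∀ {A B C} {p : Prog A C} {q : Prog B C} {x z t} →
    p ⊢ x ⇓ z [ t ] → branch p q ⊢ inj₁ x ⇓ z [ size (A ⊕ B) (inj₁ x) + t ]
  run-inr : ∀ {A B C} {p : Prog A C} {q : Prog B C} {y z t} →
    q ⊢ y ⇓ z [ t ] → branch p q ⊢ inj₂ y ⇓ z [ size (A ⊕ B) (inj₂ y) + t ]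
  run-again : ∀ {A B} {p : Prog A (A ⊕ B)} {x x′ y t u} →
    p ⊢ x ⇓ inj₁ x′ [ t ] → loop p ⊢ x′ ⇓ y [ u ] → loop p ⊢ x ⇓ y [ t + u ]
  run-done : ∀ {A B} {p : Prog A (A ⊕ B)} {x y t} →
    p ⊢ x ⇓ inj₂ y [ t ] → loop p ⊢ x ⇓ y [ t ]

-- X is the set of inputs, `input` and `output` are the encodings of an
-- input and of the value of the function there.  As sizes are positive,
-- c * n ^ k is the general form of a polynomial bound.
PolyTime : {X : Set} {A B : Ty} → (X → ⟦ A ⟧) → (X → ⟦ B ⟧) → Set
PolyTime {X} {A} {B} input output =
  Σ (Prog A B) λ p → ∃[ c ] ∃[ k ] ((x : X) →
    ∃[ t ] (p ⊢ input x ⇓ output x [ t ]) × t ≤ c * size A (input x) ^ k)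

record MinProblem : Set₁ where
  field
    Instance       : Set
    Solution       : Instance → Set
    Feasible       : (I : Instance) → Solution I → Set
    cost           : (I : Instance) → Solution I → ℕ
    instanceTy     : Ty
    solutionTy     : Ty
    encodeInstance : Instance → ⟦ instanceTy ⟧
    encodeSolution : (I : Instance) → Solution I → ⟦ solutionTy ⟧

  FeasibleInstance : Instance → Set
  FeasibleInstance I = ∃[ S ] Feasible I S

  IsOptimum : Instance → ℕ → Set
  IsOptimum I c = (∃[ S ] Feasible I S × cost I S ≡ c)
                × (∀ S → Feasible I S → c ≤ cost I S)

open MinProblem

infix 4 _≤ᶜᵖ_ _≈ᶜᵖ_

record _≤ᶜᵖ_ (P Q : MinProblem) : Set where
  field
    F : Instance P → Instance Q
    G : (I : Instance P) → Solution Q (F I) → Solution P I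

    F-polyTime : PolyTime (encodeInstance P) (λ I → encodeInstance Q (F I))
    G-polyTime : PolyTime {X = Σ (Instance P) λ I → Solution Q (F I)}
      {A = instanceTy P ⊗ solutionTy Q} {B = solutionTy P}
      (λ (I , S′) → encodeInstance P I , encodeSolution Q (F I) S′)
      (λ (I , S′) → encodeSolution P I (G I S′))

    F-feasible : ∀ I → FeasibleInstance P I → FeasibleInstance Q (F I)
    F-optimum  : ∀ I → FeasibleInstance P I →
      ∃[ c ] IsOptimum P I c × IsOptimum Q (F I) c
    G-feasible : ∀ I → FeasibleInstance P I → ∀ S′ → Feasible Q (F I) S′ →
      Feasible P I (G I S′)
    G-cost     : ∀ I → FeasibleInstance P I → ∀ S′ → Feasible Q (F I) S′ →
      cost P I (G I S′) ≤ cost Q (F I) S′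

_≈ᶜᵖ_ : MinProblem → MinProblem → Set
P ≈ᶜᵖ Q = (P ≤ᶜᵖ Q) × (Q ≤ᶜᵖ P)

-- Numbers and indices are written in unary.  They are all bounded by the
-- number of variables or elements or by |Γ|, so this changes sizes only
-- polynomially.

bitTy numTy : Ty
bitTy = 𝟙 ⊕ 𝟙
numTy = list 𝟙

encodeBit : Bool → ⟦ bitTy ⟧
encodeBit false = inj₁ tt
encodeBit true  = inj₂ tt

encodeℕ : ℕ → ⟦ numTy ⟧
encodeℕ n = replicate n tt

encodeFin : ∀ {n} → Fin n → ⟦ numTy ⟧
encodeFin i = encodeℕ (toℕ i)

encodeBits : ∀ {n} → Vec Bool n → ⟦ list bitTy ⟧
encodeBits v = toList (map encodeBit v)

encodeRows : ∀ {m n} → Vec (Vec Bool n) m → ⟦ list (list bitTy) ⟧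
encodeRows A = toList (map encodeBits A)

-- GF(2) is Bool with _xor_ as addition and _∧_ as product.

Matrix : ℕ → ℕ → Set
Matrix m n = Vec (Vec Bool n) m

_·_ : ∀ {n} → Vec Bool n → Vec Bool n → Bool
u · v = foldr′ _xor_ false (zipWith _∧_ u v)

_*ᵥ_ : ∀ {m n} → Matrix m n → Vec Bool n → Vec Bool m
A *ᵥ x = map (_· x) A

hamming : ∀ {m} → Vec Bool m → Vec Bool m → ℕ
hamming u v = count (λ (a , b) → ¬? (a ≟ b)) (zip u v)

record NCInstance : Set where
  field
    m n : ℕ
    A   : Matrix m n
    b   : Vec Bool m

NearestCodeword : MinProblem
NearestCodeword = record
  { Instance       = NCInstance
  ; Solution       = λ I → Vec Bool (n I)
  ; Feasible       = λ _ _ → ⊤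
  ; cost           = λ I x → hamming (A I *ᵥ x) (b I)
  ; instanceTy     = numTy ⊗ list (list bitTy) ⊗ list bitTy
  ; solutionTy     = list bitTy
  ; encodeInstance = λ I → encodeℕ (n I) , encodeRows (A I) , encodeBits (b I)
  ; encodeSolution = λ _ → encodeBits
  }
  where open NCInstance

-- The universe U is Fin n.
record OddSetInstance : Set where
  field
    n m : ℕ
    S   : Vec (Subset n) m

OddSet : MinProblem
OddSet = record
  { Instance       = OddSetInstance
  ; Solution       = λ I → Subset (n I)
  ; Feasible       = λ I T → (i : Fin (m I)) → 2 ∤ ∣ Vec.lookup (S I) i ∩ T ∣
  ; cost           = λ _ T → ∣ T ∣
  ; instanceTy     = numTy ⊗ list (list bitTy)
  ; solutionTy     = list bitTy
  ; encodeInstance = λ I → encodeℕ (n I) , encodeRows (S I)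
  ; encodeSolution = λ _ → encodeBits
  }
  where open OddSetInstance

record BoolRel : Set₁ where
  constructor rel
  field
    arity : ℕ
    holds : Pred (Vec Bool arity) 0ℓ

open BoolRel

-- A finite set Γ of relations is given by a repetition-free list, and the
-- constraint ⟨ s , R ⟩ refers to R ∈ Γ by its position in that list.
record Constraint (Γ : List BoolRel) (n : ℕ) : Set where
  constructor constraint
  field
    R : Fin (length Γ)
    s : Vec (Fin n) (arity (lookup Γ R))

Satisfies : ∀ {Γ n} → (Fin n → Bool) → Constraint Γ n → Set
Satisfies {Γ} σ c = holds (lookup Γ (Constraint.R c)) (map σ (Constraint.s c))

-- The constraints form a set, hence a list without repetitions.
record CSPInstance (Γ : List BoolRel) : Set where
  field
    n      : ℕ
    𝒞      : List (Constraint Γ n)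
    unique : Unique 𝒞

encodeConstraint : ∀ {Γ n} → Constraint Γ n → ⟦ numTy ⊗ list numTy ⟧
encodeConstraint c =
  encodeFin (Constraint.R c) , toList (map encodeFin (Constraint.s c))

MinCSP : List BoolRel → MinProblem
MinCSP Γ = record
  { Instance       = CSPInstance Γ
  ; Solution       = λ I → Subset (length (𝒞 I))
  ; Feasible       = λ I W → ∃[ σ ]
      ((i : Fin (length (𝒞 I))) → i ∉ W → Satisfies σ (lookup (𝒞 I) i))
  ; cost           = λ _ W → ∣ W ∣
  ; instanceTy     = numTy ⊗ list (numTy ⊗ list numTy)
  ; solutionTy     = list bitTy
  ; encodeInstance = λ I → encodeℕ (n I) , List.map encodeConstraint (𝒞 I)
  ; encodeSolution = λ _ → encodeBits
  }
  where open CSPInstance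

bit : Bool → ℕ
bit a = if a then 1 else 0

EVEN⁴ : BoolRel
EVEN⁴ = rel 4 λ a → 2 ∣ sum (map bit a)

B₂ B₃ : List BoolRel
B₂ = EVEN⁴ ∷ rel 1 ｛ true ∷ [] ｝ ∷ rel 1 ｛ false ∷ [] ｝ ∷ []
B₃ = EVEN⁴ ∷ rel 2 (｛ false ∷ true ∷ [] ｝ ∪ ｛ true ∷ false ∷ [] ｝) ∷ []

{-# OPTIONS --safe #-}

-- All four problems are linked to the problem MinLin of deleting as few linear equations
-- over GF(2) as possible such that the others become solvable, by the two cycles
--   Nearest Codeword → MinLin → Odd Set → Nearest Codeword,
--   MinLin → MinCSP B₂ → MinCSP B₃ → MinLin.
-- Nearest Codeword → MinLin is the identity on instances; Gaussian elimination on the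
-- equations that were kept turns a set of deleted equations into a vector.  Eliminating x
-- from Ax + b = y leaves equations for the error vector y alone, and adding one of them with
-- constant 1 to those with constant 0 makes every constant 1: this is Odd Set.  Conversely
-- elimination parametrises the solutions T of an Odd Set instance as T = Ax + b, and |T| is
-- the distance of Ax and b.  A linear equation becomes a chain of EVEN⁴ constraints on
-- partial sums; as the new variables are private to the equation, deleting any constraint of
-- the chain costs as much as deleting the equation, so no constraint has to be weighted.
-- Optima exist because Nearest Codeword has finitely many solutions, all of them feasible,
-- and because an optimum of the target of a reduction is one of its source.
module Submission where

open import Defs
open import Data.Bool
  using (Bool; true; false; _∧_; _∨_; _xor_; not; if_then_else_; f≤t; b≤b)
  renaming (_≤_ to _≤ᵇ_)
open import Data.Bool.ListAction using (or)
open import Data.Bool.Properties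
  using (xor-same; xor-identityʳ; xor-assoc; xor-comm; ∧-identityʳ; ∨-assoc; ∨-identityʳ;
         not-involutive)
open import Data.Bool.Solver using (module xor-∧-Solver)
open import Data.Empty using (⊥-elim)
open import Data.Fin using (Fin; zero; suc; toℕ; inject₁; fromℕ; fromℕ<)
open import Data.Fin.Properties
  using (toℕ<n; toℕ-inject₁; toℕ-fromℕ; toℕ-fromℕ<; inject₁-injective; fromℕ≢inject₁)
open import Data.Fin.Subset using (Subset; ∣_∣; _∩_; _∉_)
open import Data.Fin.Subset.Properties using (drop-there)
open import Data.List as List
  using (List; []; _∷_; _++_; _ʳ++_; applyUpTo; concat; foldl; foldr; length; lookup; map;
         replicate; reverse; take; upTo; zip; zipWith)
open import Data.List.Properties
  using (++-assoc; ++-identityʳ; ++-ʳ++; drop-drop; length-++; length-applyUpTo; length-map;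
         length-replicate; length-reverse; length-take; length-upTo; length-zipWith; map-++; map-cong;
         map-id; map-replicate; map-upTo; map-∘; reverse-++; reverse-involutive; take++drop≡id;
         take-map; unfold-reverse; ʳ++-defn)
open import Data.List.Relation.Binary.Pointwise using (Pointwise; []; _∷_)
open import Data.List.Relation.Unary.All as All using (All; []; _∷_)
import Data.List.Relation.Unary.All.Properties as All
open import Data.List.Relation.Unary.AllPairs using (AllPairs; []; _∷_)
open import Data.List.Relation.Unary.Unique.Propositional using (Unique)
import Data.List.Relation.Unary.Unique.Propositional.Properties as Unique
open import Data.Nat hiding (_≤ᵇ_)
open import Data.Nat.Divisibility using (_∣_; _∤_; divides; ∣m∣n⇒∣m+n; ∣-refl; _∣0)
open import Data.Nat.Properties
open import Data.Nat.Tactic.RingSolver using (solve-∀)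
open import Data.Product using (Σ; ∃-syntax; _×_; _,_; proj₁; proj₂)
open import Data.Sum using (_⊎_; inj₁; inj₂; [_,_])
open import Data.Unit using (⊤; tt)
open import Data.Vec as Vec using (Vec; []; _∷_; toList; fromList; here; there)
open import Data.Vec.Properties
  using (∷-injective; length-toList; toList-cast; toList-map)
  renaming (map-cong to vmap-cong; map-∘ to vmap-∘)
open import Function using (_∘_; id)
open import Relation.Binary.PropositionalEquality hiding ([_])

open BoolRel
open MinProblem

-- Polynomial-time programs

-- `PolyTime` asks for a program in the machine language for both maps of every reduction, and this
-- shapes the development. Programs only see first-order data, so each construction is carried out
-- on lists and natural numbers; the vectors, `Fin` indices and proofs demanded by the problems are
-- put back afterwards, by equalities of encodings. No reduction is programmed by hand: a function
-- assembled from a few combinators comes with its program and its polynomial. All iteration goes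
-- through one left fold, whose state may grow at each step only by an amount independent of the
-- state itself. Elimination fits this scheme because its steps merely move and shorten rows.
--
-- A solution of `MinLin` is a set of equations because such sets pass between equations and
-- constraints without any computation on assignments. The price is paid once, on the way back to
-- Nearest Codeword, where a vector has to be recovered by elimination.

infixl 6 _+ₚ_
infixl 7 _*ₚ_

data Poly : Set where
  var       : Poly
  con       : ℕ → Poly
  _+ₚ_ _*ₚ_ : Poly → Poly → Poly

eval : Poly → ℕ → ℕ
eval var      n = n
eval (con c)  n = c
eval (p +ₚ q) n = eval p n + eval q n
eval (p *ₚ q) n = eval p n * eval q n

eval-mono : ∀ p {m n} → m ≤ n → eval p m ≤ eval p n
eval-mono var      m≤n = m≤n
eval-mono (con c)  m≤n = ≤-refl
eval-mono (p +ₚ q) m≤n = +-mono-≤ (eval-mono p m≤n) (eval-mono q m≤n)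
eval-mono (p *ₚ q) m≤n = *-mono-≤ (eval-mono p m≤n) (eval-mono q m≤n)

infixr 8 _∘ₚ_

_∘ₚ_ : Poly → Poly → Poly
var      ∘ₚ r = r
con c    ∘ₚ r = con c
(p +ₚ q) ∘ₚ r = p ∘ₚ r +ₚ q ∘ₚ r
(p *ₚ q) ∘ₚ r = (p ∘ₚ r) *ₚ (q ∘ₚ r)

eval-∘ₚ : ∀ p r n → eval (p ∘ₚ r) n ≡ eval p (eval r n)
eval-∘ₚ var      r n = refl
eval-∘ₚ (con c)  r n = refl
eval-∘ₚ (p +ₚ q) r n = cong₂ _+_ (eval-∘ₚ p r n) (eval-∘ₚ q r n)
eval-∘ₚ (p *ₚ q) r n = cong₂ _*_ (eval-∘ₚ p r n) (eval-∘ₚ q r n)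

_^ₚ_ : Poly → ℕ → Poly
p ^ₚ zero  = con 1
p ^ₚ suc k = p *ₚ (p ^ₚ k)

eval-^ₚ : ∀ p k n → eval (p ^ₚ k) n ≡ eval p n ^ k
eval-^ₚ p zero    n = refl
eval-^ₚ p (suc k) n = cong (eval p n *_) (eval-^ₚ p k n)

-- Only an upper bound on the degree: adding on sums avoids a maximum, and a larger exponent does no
-- harm at positive arguments.
degree : Poly → ℕ
degree var      = 1
degree (con c)  = 0
degree (p +ₚ q) = degree p + degree q
degree (p *ₚ q) = degree p + degree q

coefficient : Poly → ℕ
coefficient var      = 1
coefficient (con c)  = c
coefficient (p +ₚ q) = coefficient p + coefficient q
coefficient (p *ₚ q) = coefficient p * coefficient q

-- Restricted to positive arguments, since at 0 a monomial of positive degree loses the constant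
-- term. Sizes of data are always positive.
eval-≤-monomial : ∀ p n → eval p (suc n) ≤ coefficient p * suc n ^ degree p
eval-≤-monomial var      n = ≤-reflexive (sym (trans (*-identityˡ _) (*-identityʳ _)))
eval-≤-monomial (con c)  n = ≤-reflexive (sym (*-identityʳ c))
eval-≤-monomial (p +ₚ q) n = begin
  eval p N + eval q N                  ≤⟨ +-mono-≤ (eval-≤-monomial p n) (eval-≤-monomial q n) ⟩
  c * N ^ i + d * N ^ j                ≤⟨ +-mono-≤ (*-monoʳ-≤ c (^-monoʳ-≤ N (m≤m+n i j)))
                                                    (*-monoʳ-≤ d (^-monoʳ-≤ N (m≤n+m j i))) ⟩
  c * N ^ (i + j) + d * N ^ (i + j)    ≡⟨ *-distribʳ-+ (N ^ (i + j)) c d ⟨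
  (c + d) * N ^ (i + j)                ∎
  where
  open ≤-Reasoning
  N = suc n ; c = coefficient p ; d = coefficient q ; i = degree p ; j = degree q
eval-≤-monomial (p *ₚ q) n = begin
  eval p N * eval q N          ≤⟨ *-mono-≤ (eval-≤-monomial p n) (eval-≤-monomial q n) ⟩
  (c * N ^ i) * (d * N ^ j)    ≡⟨ *-interchange c (N ^ i) d (N ^ j) ⟩
  (c * d) * (N ^ i * N ^ j)    ≡⟨ cong (c * d *_) (^-distribˡ-+-* N i j) ⟨
  (c * d) * N ^ (i + j)        ∎
  where
  open ≤-Reasoning
  N = suc n ; c = coefficient p ; d = coefficient q ; i = degree p ; j = degree q
  *-interchange : ∀ a b c d → (a * b) * (c * d) ≡ (a * c) * (b * d)
  *-interchange = solve-∀

size>0 : ∀ A x → 1 ≤ size A x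
sizeList>0 : ∀ A xs → 1 ≤ sizeList A xs
size>0 𝟙        x        = s≤s z≤n
size>0 (A ⊕ B)  (inj₁ x) = s≤s z≤n
size>0 (A ⊕ B)  (inj₂ x) = s≤s z≤n
size>0 (A ⊗ B)  x        = s≤s z≤n
size>0 (list A) xs       = sizeList>0 A xs
sizeList>0 A []       = s≤s z≤n
sizeList>0 A (x ∷ xs) = s≤s z≤n

double : ∀ n → n + n ≡ 2 * n
double n = cong (n +_) (sym (+-identityʳ n))

n≤2n : ∀ n → n ≤ 2 * n
n≤2n n = m≤n*m n 2

suc≤2* : ∀ {n} → 1 ≤ n → suc n ≤ 2 * n
suc≤2* {n} p = ≤-trans (+-monoˡ-≤ n p) (≤-reflexive (double n))

apply-size : ∀ {A B} (p : Prim A B) x → size B (apply p x) ≤ 2 * size A x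
apply-size {A} skip x = n≤2n _
apply-size {A} drop x = ≤-trans (size>0 A x) (n≤2n _)
apply-size {A ⊗ B} fst (x , y) = ≤-trans (≤-trans (m≤m+n _ _) (n≤1+n _)) (n≤2n _)
apply-size {A ⊗ B} snd (x , y) = ≤-trans (≤-trans (m≤n+m (size B y) (size A x)) (n≤1+n _)) (n≤2n _)
apply-size {A} inl x = suc≤2* (size>0 A x)
apply-size {A} inr x = suc≤2* (size>0 A x)
apply-size distr (inj₁ x , z) = n≤2n _
apply-size distr (inj₂ y , z) = n≤2n _
apply-size nil x = s≤s z≤n
apply-size cons (x , xs) = n≤2n _
apply-size uncons [] = ≤-refl
apply-size {list A} uncons (x ∷ xs) = suc≤2* (s≤s z≤n)

-- Needed for composition: the second program is bounded in the size of the intermediate value, and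
-- that size is bounded here by the cost of producing the value.
output-size : ∀ {A B} {p : Prog A B} {x y t} → p ⊢ x ⇓ y [ t ] → size B y ≤ 2 * t
output-size (run-prim {p = p} {x}) = apply-size p x
output-size {B = B} {y = y} (run-⨾ {t = t} {u = u} r s) =
  ≤-trans (output-size s) (*-monoʳ-≤ 2 (m≤n+m u t))
output-size {A} {y = y , z} (run-fork {B = B} {C = C} {x = x} {t = t} {u = u} r s) = begin
  suc (size B y + size C z)          ≤⟨ s≤s (+-mono-≤ (output-size r) (output-size s)) ⟩
  suc (2 * t + 2 * u)                ≡⟨ cong suc (*-distribˡ-+ 2 t u) ⟨
  1 + 2 * (t + u)                    ≤⟨ +-monoˡ-≤ _ (≤-trans (size>0 A x) (n≤2n _)) ⟩
  2 * size A x + 2 * (t + u)         ≡⟨ *-distribˡ-+ 2 (size A x) (t + u) ⟨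
  2 * (size A x + (t + u))           ≡⟨ cong (2 *_) (+-assoc (size A x) t u) ⟨
  2 * (size A x + t + u)             ∎
  where open ≤-Reasoning
output-size (run-inl {A} {x = x} {t = t} r) = ≤-trans (output-size r) (*-monoʳ-≤ 2 (m≤n+m t (suc (size A x))))
output-size (run-inr {B = B} {y = y} {t = t} r) = ≤-trans (output-size r) (*-monoʳ-≤ 2 (m≤n+m t (suc (size B y))))
output-size (run-again {t = t} {u = u} r s) = ≤-trans (output-size s) (*-monoʳ-≤ 2 (m≤n+m u t))
output-size (run-done r) = ≤-trans (n≤1+n _) (output-size r)

-- `PolyTime` with a syntactic polynomial in place of `c * n ^ k`, because syntactic polynomials
-- compose without normalisation. The index set `X` need not be the type of the encoded data, so one
-- program can be viewed over different index sets.
record Computes {X : Set} {A B : Ty} (input : X → ⟦ A ⟧) (output : X → ⟦ B ⟧) : Set where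
  field
    prog  : Prog A B
    bound : Poly
    runs  : ∀ x → ∃[ t ] (prog ⊢ input x ⇓ output x [ t ]) × t ≤ eval bound (size A (input x))

  output≤ : ∀ x → size B (output x) ≤ 2 * eval bound (size A (input x))
  output≤ x = let t , r , t≤ = runs x in ≤-trans (output-size r) (*-monoʳ-≤ 2 t≤)

open Computes

toPolyTime : ∀ {X A B} {i : X → ⟦ A ⟧} {o : X → ⟦ B ⟧} → Computes i o → PolyTime i o
toPolyTime {A = A} {i = i} P = prog P , coefficient (bound P) , degree (bound P) , λ x →
  let t , r , t≤ = runs P x in t , r , ≤-trans t≤ (monomial (size>0 A (i x)))
  where
  monomial : ∀ {n} → 1 ≤ n → eval (bound P) n ≤ coefficient (bound P) * n ^ degree (bound P)
  monomial (s≤s {n = n} _) = eval-≤-monomial (bound P) n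

fromPolyTime : ∀ {X A B} {i : X → ⟦ A ⟧} {o : X → ⟦ B ⟧} → PolyTime i o → Computes i o
fromPolyTime (p , c , k , runs) = record
  { prog = p ; bound = con c *ₚ (var ^ₚ k)
  ; runs = λ x → let t , r , t≤ = runs x in
      t , r , ≤-trans t≤ (≤-reflexive (cong (c *_) (sym (eval-^ₚ var k _)))) }

module _ {X : Set} {A B : Ty} where

  primC : {i : X → ⟦ A ⟧} (p : Prim A B) → Computes i (apply p ∘ i)
  primC p = record { prog = prim p ; bound = var ; runs = λ x → _ , run-prim , ≤-refl }

  extC : {i i′ : X → ⟦ A ⟧} {o o′ : X → ⟦ B ⟧} →
    (∀ x → i x ≡ i′ x) → (∀ x → o x ≡ o′ x) → Computes i o → Computes i′ o′
  extC {i} {i′} i≗ o≗ P = record { prog = prog P ; bound = bound P ; runs = λ x →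
    subst₂ (λ y z → ∃[ t ] (prog P ⊢ y ⇓ z [ t ]) × t ≤ eval (bound P) (size A y))
      (i≗ x) (o≗ x) (runs P x) }

  reindexC : ∀ {Y : Set} {i : X → ⟦ A ⟧} {o : X → ⟦ B ⟧} (h : Y → X) →
    Computes i o → Computes (i ∘ h) (o ∘ h)
  reindexC h P = record { prog = prog P ; bound = bound P ; runs = λ y → runs P (h y) }

  infixr 5 _⨾ᶜ_

  _⨾ᶜ_ : ∀ {C} {i : X → ⟦ A ⟧} {o : X → ⟦ B ⟧} {o′ : X → ⟦ C ⟧} →
    Computes i o → Computes o o′ → Computes i o′
  _⨾ᶜ_ {i = i} {o} P Q = record
    { prog = prog P ⨾ prog Q
    ; bound = bound P +ₚ bound Q ∘ₚ (con 2 *ₚ bound P)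
    ; runs = λ x → let t , r , t≤ = runs P x
                       u , s , u≤ = runs Q x in
        t + u , run-⨾ r s , +-mono-≤ t≤ (≤-trans u≤
          (≤-trans (eval-mono (bound Q) (output≤ P x))
                   (≤-reflexive (sym (eval-∘ₚ (bound Q) (con 2 *ₚ bound P) _))))) }

  forkC : ∀ {C} {i : X → ⟦ A ⟧} {o : X → ⟦ B ⟧} {o′ : X → ⟦ C ⟧} →
    Computes i o → Computes i o′ → Computes i (λ x → o x , o′ x)
  forkC P Q = record
    { prog = fork (prog P) (prog Q)
    ; bound = var +ₚ bound P +ₚ bound Q
    ; runs = λ x → let t , r , t≤ = runs P x
                       u , s , u≤ = runs Q x in
        _ , run-fork r s , +-mono-≤ (+-monoʳ-≤ _ t≤) u≤ }

-- The two sides have separate index sets, since what is known about the input differs between the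
-- branches: an empty list on one side, a head and a tail on the other.
branchC : ∀ {X Y A B C} {i : X → ⟦ A ⟧} {j : Y → ⟦ B ⟧} {o : X → ⟦ C ⟧} {o′ : Y → ⟦ C ⟧} →
  Computes i o → Computes j o′ →
  Computes {X ⊎ Y} {A ⊕ B} [ inj₁ ∘ i , inj₂ ∘ j ] [ o , o′ ]
branchC P Q = record
  { prog = branch (prog P) (prog Q)
  ; bound = var +ₚ (bound P +ₚ bound Q)
  ; runs = λ { (inj₁ x) → let t , r , t≤ = runs P x in
                 _ , run-inl r , +-monoʳ-≤ _ (≤-trans t≤ (≤-trans (eval-mono (bound P) (n≤1+n _)) (m≤m+n _ _)))
             ; (inj₂ y) → let t , r , t≤ = runs Q y in
                 _ , run-inr r , +-monoʳ-≤ _ (≤-trans t≤ (≤-trans (eval-mono (bound Q) (n≤1+n _)) (m≤n+m _ _))) } }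

-- Polynomial-time functions on coded types

infixr 7 _⊠_

-- Codes have two readings: `El` gives ordinary Agda types, in which functions are written, and
-- `enc` maps their elements to machine data, in agreement with the encodings of the problems.
data Code : Set where
  unit bool nat : Code
  _⊠_           : Code → Code → Code
  seq           : Code → Code

El : Code → Set
El unit    = ⊤
El bool    = Bool
El nat     = ℕ
El (a ⊠ b) = El a × El b
El (seq a) = List (El a)

ty : Code → Ty
ty unit    = 𝟙
ty bool    = bitTy
ty nat     = numTy
ty (a ⊠ b) = ty a ⊗ ty b
ty (seq a) = list (ty a)

enc : ∀ a → El a → ⟦ ty a ⟧
enc unit    x       = x
enc bool    x       = encodeBit x
enc nat     x       = encodeℕ x
enc (a ⊠ b) (x , y) = enc a x , enc b y
enc (seq a) xs      = List.map (enc a) xs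

sz : ∀ a → El a → ℕ
sz a x = size (ty a) (enc a x)

record FP {a b : Code} (f : El a → El b) : Set where
  constructor fp
  field computes : Computes (enc a) (enc b ∘ f)

  size-bound : Poly
  size-bound = con 2 *ₚ bound computes

  output-bounded : ∀ x → sz b (f x) ≤ eval size-bound (sz a x)
  output-bounded = output≤ computes

open FP

infixr 9 _∘F_

_∘F_ : ∀ {a b c} {g : El b → El c} {f : El a → El b} → FP {b} {c} g → FP {a} {b} f → FP {a} {c} (g ∘ f)
_∘F_ {f = f} (fp Q) (fp P) = fp (P ⨾ᶜ reindexC f Q)

ext : ∀ {a b} {f g : El a → El b} → (∀ x → f x ≡ g x) → FP {a} {b} f → FP {a} {b} g
ext {b = b} f≗g (fp P) = fp (extC (λ _ → refl) (cong (enc b) ∘ f≗g) P)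

module _ {a : Code} where

  idF : FP {a} {a} id
  idF = fp (primC skip)

  ttF : FP {a} {unit} (λ _ → tt)
  ttF = fp (primC drop)

  ⟨_,_⟩F : ∀ {b c} {f : El a → El b} {g : El a → El c} →
    FP {a} {b} f → FP {a} {c} g → FP {a} {b ⊠ c} (λ x → f x , g x)
  ⟨ fp P , fp Q ⟩F = fp (forkC P Q)

  fstF : ∀ {b} → FP {a ⊠ b} {a} proj₁
  fstF = fp (primC fst)

  sndF : ∀ {b} → FP {b ⊠ a} {a} proj₂
  sndF = fp (primC snd)

  zeroF : FP {a} {nat} (λ _ → 0)
  zeroF = fp (primC drop ⨾ᶜ primC nil)

  falseF : FP {a} {bool} (λ _ → false)
  falseF = fp (primC drop ⨾ᶜ primC inl)

  trueF : FP {a} {bool} (λ _ → true)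
  trueF = fp (primC drop ⨾ᶜ primC inr)

  sucF : ∀ {f} → FP {a} {nat} f → FP {a} {nat} (suc ∘ f)
  sucF (fp P) = fp (forkC (primC drop) P ⨾ᶜ primC cons)

  []F : ∀ {b} → FP {a} {seq b} (λ _ → [])
  []F = fp (primC drop ⨾ᶜ primC nil)

  infixr 5 _∷F_

  _∷F_ : ∀ {b} {f : El a → El b} {fs} → FP {a} {b} f → FP {a} {seq b} fs → FP {a} {seq b} (λ x → f x ∷ fs x)
  fp P ∷F fp Q = fp (forkC P Q ⨾ᶜ primC cons)

  -- A branch of a program sees only the payload of the sum. Therefore the condition is paired with
  -- the whole input, and `distr` moves the input into the branch; `split` is the same decision on
  -- the semantic side.
  ifF : ∀ {b c f g} → FP {a} {bool} c → FP {a} {b} f → FP {a} {b} g →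
    FP {a} {b} (λ x → if c x then f x else g x)
  ifF {b} {c} {f} {g} (fp C) (fp P) (fp Q) = fp (forkC C (primC skip) ⨾ᶜ primC distr ⨾ᶜ
    extC shape-in shape-out (reindexC split (branchC (primC snd ⨾ᶜ Q) (primC snd ⨾ᶜ P))))
    where
    choose : Bool → El a → El a ⊎ El a
    choose false = inj₁
    choose true  = inj₂
    split : El a → El a ⊎ El a
    split x = choose (c x) x
    i = λ x → tt , enc a x
    shape-in : ∀ x → [ inj₁ ∘ i , inj₂ ∘ i ] (split x) ≡ apply distr (enc bool (c x) , enc a x)
    shape-in x with c x
    ... | false = refl
    ... | true  = refl
    shape-out : ∀ x → [ enc b ∘ g , enc b ∘ f ] (split x) ≡ enc b (if c x then f x else g x)
    shape-out x with c x
    ... | false = refl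
    ... | true  = refl

caseList : {A B : Set} → List A → B → (A → List A → B) → B
caseList []       n c = n
caseList (x ∷ xs) n c = c x xs

caseF : ∀ {a b d} {f : El a → List (El b)} {g : El a → El d} {h : El (a ⊠ b ⊠ seq b) → El d} →
  FP {a} {seq b} f → FP {a} {d} g → FP {a ⊠ b ⊠ seq b} {d} h →
  FP {a} {d} (λ x → caseList (f x) (g x) (λ y ys → h (x , y , ys)))
caseF {a} {b} {d} {f} {g} {h} (fp L) (fp N) (fp C) = fp (
  forkC (L ⨾ᶜ primC uncons) (primC skip) ⨾ᶜ primC distr ⨾ᶜ
  extC shape-in shape-out (reindexC split
    (branchC {X = El a} (primC snd ⨾ᶜ N)
      (extC (λ _ → refl) (λ _ → refl) (forkC (primC snd) (primC fst) ⨾ᶜ C)))))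
  where
  i = λ x → tt , enc a x
  j : El (a ⊠ b ⊠ seq b) → ⟦ (ty b ⊗ list (ty b)) ⊗ ty a ⟧
  j (x , y , ys) = (enc b y , enc (seq b) ys) , enc a x
  split : El a → El a ⊎ El (a ⊠ b ⊠ seq b)
  split x = caseList (f x) (inj₁ x) (λ y ys → inj₂ (x , y , ys))
  shape-in : ∀ x → [ inj₁ ∘ i , inj₂ ∘ j ] (split x) ≡ apply distr (apply uncons (enc (seq b) (f x)) , enc a x)
  shape-in x with f x
  ... | []     = refl
  ... | y ∷ ys = refl
  shape-out : ∀ x → [ enc d ∘ g , enc d ∘ h ] (split x) ≡ enc d (caseList (f x) (g x) (λ y ys → h (x , y , ys)))
  shape-out x with f x
  ... | []     = refl
  ... | y ∷ ys = refl

length≤sz : ∀ a xs → length xs ≤ sz (seq a) xs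
length≤sz a []       = z≤n
length≤sz a (x ∷ xs) = s≤s (≤-trans (length≤sz a xs) (m≤n+m _ _))

module Fold {a b d : Code} {step : El ((a ⊠ d) ⊠ b) → El d}
  (S : FP {(a ⊠ d) ⊠ b} {d} step) where

  State : Code
  State = a ⊠ d ⊠ seq b

  folded : El State → El d
  folded (x , s , ys) = foldl (λ s y → step ((x , s) , y)) s ys

  next : El State → ⟦ ty State ⊕ ty d ⟧
  next (x , s , [])     = inj₂ (enc d s)
  next (x , s , y ∷ ys) = inj₁ (enc State (x , step ((x , s) , y) , ys))

  abstract
    bodyC : Computes (enc State) next
    bodyC = forkC (primC snd ⨾ᶜ primC snd ⨾ᶜ primC uncons) (primC skip) ⨾ᶜ primC distr ⨾ᶜ
      extC shape-in shape-out (reindexC split (branchC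
        (extC (λ _ → refl) (λ _ → refl) (primC snd ⨾ᶜ primC snd ⨾ᶜ primC fst ⨾ᶜ primC inr))
        (forkC (primC snd ⨾ᶜ primC fst)
          (forkC (forkC (forkC (primC snd ⨾ᶜ primC fst) (primC snd ⨾ᶜ primC snd ⨾ᶜ primC fst)) (primC fst ⨾ᶜ primC fst)
                   ⨾ᶜ extC (λ _ → refl) (λ _ → refl) 
                     (reindexC {Y = El a × El d × El b × List (El b)} (λ (x , s , y , ys) → (x , s) , y) (computes S)))
                 (primC fst ⨾ᶜ primC snd))
          ⨾ᶜ primC inl)))
      where
      i : El a × El d → ⟦ 𝟙 ⊗ ty State ⟧
      i (x , s) = tt , enc State (x , s , [])
      j : El a × El d × El b × List (El b) → ⟦ (ty b ⊗ list (ty b)) ⊗ ty State ⟧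
      j (x , s , y , ys) = (enc b y , enc (seq b) ys) , enc State (x , s , y ∷ ys)
      o : El a × El d × El b × List (El b) → ⟦ ty State ⊕ ty d ⟧
      o (x , s , y , ys) = inj₁ (enc State (x , step ((x , s) , y) , ys))
      split : El State → (El a × El d) ⊎ (El a × El d × El b × List (El b))
      split (x , s , [])     = inj₁ (x , s)
      split (x , s , y ∷ ys) = inj₂ (x , s , y , ys)
      shape-in : ∀ w → [ inj₁ ∘ i , inj₂ ∘ j ] (split w) ≡
        apply distr (apply uncons (enc (seq b) (proj₂ (proj₂ w))) , enc State w)
      shape-in (x , s , [])     = refl
      shape-in (x , s , y ∷ ys) = refl
      shape-out : ∀ w → [ (λ (x , s) → inj₂ (enc d s)) , o ] (split w) ≡ next w
      shape-out (x , s , [])     = refl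
      shape-out (x , s , y ∷ ys) = refl

  -- A round costs as much as its current state is large, so the bound `K` must hold for all
  -- intermediate accumulators, that is, after every prefix of the list. There is one round per item
  -- and a last one that finds the list empty.
  loop-runs : ∀ x K s ys → (∀ k → sz d (folded (x , s , take k ys)) ≤ K) →
    ∃[ t ] (loop (prog bodyC) ⊢ enc State (x , s , ys) ⇓ enc d (folded (x , s , ys)) [ t ])
         × t ≤ suc (length ys) * eval (bound bodyC) (suc (sz a x + suc (K + sz (seq b) ys)))
  loop-runs x K s [] small =
    let t , r , t≤ = runs bodyC (x , s , []) in
    t , run-done r , ≤-trans t≤ (≤-trans
      (eval-mono (bound bodyC) (s≤s (+-monoʳ-≤ (sz a x) (s≤s (+-monoˡ-≤ 1 (small 0))))))
      (m≤m+n _ _))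
  loop-runs x K s (y ∷ ys) small =
    let t , r , t≤ = runs bodyC (x , s , y ∷ ys)
        u , q , u≤ = loop-runs x K (step ((x , s) , y)) ys (small ∘ suc)
    in t + u , run-again r q , +-mono-≤
      (≤-trans t≤ (eval-mono (bound bodyC)
        (s≤s (+-monoʳ-≤ (sz a x) (s≤s (+-monoˡ-≤ (sz (seq b) (y ∷ ys)) (small 0)))))))
      (≤-trans u≤ (*-monoʳ-≤ (suc (length ys)) (eval-mono (bound bodyC)
        (s≤s (+-monoʳ-≤ (sz a x) (s≤s (+-monoʳ-≤ K (≤-trans (m≤n+m _ (sz b y)) (n≤1+n _)))))))))

  folded-size : ∀ x s ys m D → (∀ s y → sz b y ≤ m → sz d (step ((x , s) , y)) ≤ sz d s + D) →
    sz (seq b) ys ≤ m → ∀ k → sz d (folded (x , s , take k ys)) ≤ sz d s + length ys * D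
  folded-size x s ys       m D grow ≤m zero    = m≤m+n _ _
  folded-size x s []       m D grow ≤m (suc k) = m≤m+n _ _
  folded-size x s (y ∷ ys) m D grow ≤m (suc k) = begin
    sz d (folded (x , step ((x , s) , y) , take k ys))  ≤⟨ folded-size x _ ys m D grow (≤-trans (m≤n+m _ _) (<⇒≤ ≤m)) k ⟩
    sz d (step ((x , s) , y)) + length ys * D           ≤⟨ +-monoˡ-≤ _ (grow s y (≤-trans (m≤m+n _ _) (<⇒≤ ≤m))) ⟩
    sz d s + D + length ys * D                          ≡⟨ +-assoc (sz d s) D _ ⟩
    sz d s + (D + length ys * D)                        ∎
    where open ≤-Reasoning

  -- A step may only add a polynomial in the sizes of the environment and the item; otherwise
  -- the state could double at every step.
  foldF : ∀ {init : El a → El d} {xs : El a → List (El b)} →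
    FP {a} {d} init → FP {a} {seq b} xs → (q : Poly) →
    (∀ x s y → sz d (step ((x , s) , y)) ≤ sz d s + eval q (sz a x + sz b y)) →
    FP {a} {d} (λ x → foldl (λ s y → step ((x , s) , y)) (init x) (xs x))
  foldF {init} {xs} (fp I) (fp L) q grow = fp (forkC (primC skip) (forkC I L) ⨾ᶜ record
    { prog = loop (prog bodyC)
    -- A state consists of the environment, an accumulator of size at most `Kₚ`, the remaining list,
    -- and 2 for the pairings. `Kₚ` allows at most n steps that each add q(2n): one n for the
    -- environment and one for the item.
    ; bound = (con 1 +ₚ var) *ₚ bound bodyC ∘ₚ (con 2 +ₚ var +ₚ Kₚ +ₚ var)
    ; runs = λ x →
        let n = sz State (x , init x , xs x)
            D = eval q (n + n)
            K = n + n * D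
            xs≤ : sz (seq b) (xs x) ≤ n
            xs≤ = ≤-trans (m≤n+m _ (sz d (init x))) (≤-trans (n≤1+n _) (≤-trans (m≤n+m _ (sz a x)) (n≤1+n _)))
            init≤ : sz d (init x) ≤ n
            init≤ = ≤-trans (m≤m+n _ (sz (seq b) (xs x))) (≤-trans (n≤1+n _) (≤-trans (m≤n+m _ (sz a x)) (n≤1+n _)))
            x≤ : sz a x ≤ n
            x≤ = ≤-trans (m≤m+n _ _) (n≤1+n _)
            small : ∀ k → sz d (folded (x , init x , take k (xs x))) ≤ K
            small k = ≤-trans
              (folded-size x (init x) (xs x) n D
                (λ s y y≤ → ≤-trans (grow x s y) (+-monoʳ-≤ _ (eval-mono q (+-mono-≤ x≤ y≤)))) xs≤ k)
              (+-mono-≤ init≤ (*-monoˡ-≤ D (≤-trans (length≤sz b (xs x)) xs≤)))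
            t , r , t≤ = loop-runs x K (init x) (xs x) small
        in t , r , (begin
          t
            ≤⟨ t≤ ⟩
          suc (length (xs x)) * eval (bound bodyC) (suc (sz a x + suc (K + sz (seq b) (xs x))))
            ≤⟨ *-mono-≤ (s≤s (≤-trans (length≤sz b (xs x)) xs≤))
                        (eval-mono (bound bodyC) (s≤s (≤-trans (≤-reflexive (+-suc _ _))
                          (s≤s (≤-trans (+-mono-≤ x≤ (+-monoʳ-≤ K xs≤)) (≤-reflexive (sym (+-assoc n K n)))))))) ⟩
          suc n * eval (bound bodyC) (suc (suc (n + K + n)))
            ≡⟨ cong (λ w → suc n * eval (bound bodyC) (suc (suc (n + (n + n * w) + n)))) (eval-∘ₚ q (var +ₚ var) n) ⟨
          suc n * eval (bound bodyC) (eval (con 2 +ₚ var +ₚ Kₚ +ₚ var) n)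
            ≡⟨ cong (suc n *_) (eval-∘ₚ (bound bodyC) (con 2 +ₚ var +ₚ Kₚ +ₚ var) n) ⟨
          suc n * eval (bound bodyC ∘ₚ (con 2 +ₚ var +ₚ Kₚ +ₚ var)) n
            ∎)
    })
    where
    open ≤-Reasoning
    Kₚ = var +ₚ var *ₚ q ∘ₚ (var +ₚ var)

open Fold using (foldF)

-- Polynomial-time functions on lists and numbers

≤-by : ∀ {a b} k → a + k ≡ b → a ≤ b
≤-by {a} k eq = subst (a ≤_) eq (m≤m+n a k)

sz-bool : ∀ b → sz bool b ≡ 2
sz-bool false = refl
sz-bool true  = refl

sz-nat : ∀ n → sz nat n ≡ 1 + n * 2
sz-nat zero    = refl
sz-nat (suc n) = cong (2 +_) (sz-nat n)

sz-nat-+ : ∀ m n → sz nat (m + n) ≤ sz nat m + sz nat n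
sz-nat-+ zero    n = n≤1+n _
sz-nat-+ (suc m) n = s≤s (s≤s (sz-nat-+ m n))

replicate-length : ∀ (ts : List ⊤) → replicate (length ts) tt ≡ ts
replicate-length []       = refl
replicate-length (_ ∷ ts) = cong (tt ∷_) (replicate-length ts)

module _ {a : Code} where

  -- Numbers are unary, so the encoding of a number already is a list of units over which a counting
  -- loop can fold.
  ticksF : ∀ {f} → FP {a} {nat} f → FP {a} {seq unit} (λ x → replicate (f x) tt)
  ticksF (fp P) = fp (P ⨾ᶜ extC (λ _ → refl) (λ _ → sym (map-id _)) (primC skip))

  ʳ++F : ∀ {b} {f g : El a → List (El b)} → FP {a} {seq b} f → FP {a} {seq b} g →
    FP {a} {seq b} (λ x → f x ʳ++ g x)
  ʳ++F {b} P Q = foldF (sndF ∷F sndF ∘F fstF) Q P (con 1 +ₚ var) λ x s y →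
    ≤-by (sz a x) (arith (sz a x) (sz (seq b) s) (sz b y))
    where
    arith : ∀ x s y → suc (y + s) + x ≡ s + suc (x + y)
    arith = solve-∀

  reverseF : ∀ {b} {f : El a → List (El b)} → FP {a} {seq b} f → FP {a} {seq b} (λ x → reverse (f x))
  reverseF {b} P = ʳ++F {b} P []F

  ++F : ∀ {b} {f g : El a → List (El b)} → FP {a} {seq b} f → FP {a} {seq b} g →
    FP {a} {seq b} (λ x → f x ++ g x)
  ++F {b} {f} {g} P Q = ext (λ x → trans (ʳ++-defn (reverse (f x))) (cong (_++ g x) (reverse-involutive (f x))))
    (ʳ++F {b} (reverseF P) Q)

foldl-∷ : ∀ {A B : Set} (f : A → B) s xs → foldl (λ s x → f x ∷ s) s xs ≡ map f xs ʳ++ s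
foldl-∷ f s []       = refl
foldl-∷ f s (x ∷ xs) = foldl-∷ f (f x ∷ s) xs

-- A left fold produces the results in reverse order, hence the final `reverse`. Each step adds one
-- output of `f`, whose size depends on the environment and the item only, as `foldF` requires.
mapF : ∀ {a b d} {f : El (a ⊠ b) → El d} {xs : El a → List (El b)} →
  FP {a ⊠ b} {d} f → FP {a} {seq b} xs → FP {a} {seq d} (λ x → map (λ y → f (x , y)) (xs x))
mapF {a} {b} {d} {f} {xs} P Q =
  ext (λ x → trans (cong reverse (foldl-∷ (λ y → f (x , y)) [] (xs x))) (reverse-involutive _))
    (reverseF {b = d} (foldF {d = seq d} (P ∘F ⟨ fstF ∘F fstF , sndF ⟩F ∷F sndF ∘F fstF) []F Q
      (con 1 +ₚ size-bound P ∘ₚ (con 1 +ₚ var))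
      λ x s y → begin
        suc (sz d (f (x , y)) + sz (seq d) s)
          ≤⟨ s≤s (+-monoˡ-≤ _ (output-bounded P (x , y))) ⟩
        suc (eval (size-bound P) (suc (sz a x + sz b y)) + sz (seq d) s)
          ≡⟨ cong suc (+-comm _ (sz (seq d) s)) ⟩
        suc (sz (seq d) s + eval (size-bound P) (suc (sz a x + sz b y)))
          ≡⟨ +-suc (sz (seq d) s) _ ⟨
        sz (seq d) s + suc (eval (size-bound P) (suc (sz a x + sz b y)))
          ≡⟨ cong (λ w → sz (seq d) s + suc w) (eval-∘ₚ (size-bound P) (con 1 +ₚ var) _) ⟨
        sz (seq d) s + eval (con 1 +ₚ size-bound P ∘ₚ (con 1 +ₚ var)) (sz a x + sz b y)
          ∎))
  where open ≤-Reasoning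

-- The fold runs over the first list and carries the unread rest of the second one in its state.
zipStep : {A B : Set} → List B × List (A × B) → A → List B × List (A × B)
zipStep (ys , acc) x = caseList ys ([] , acc) (λ y ys′ → ys′ , (x , y) ∷ acc)

foldl-zipStep : ∀ {A B : Set} (xs : List A) (ys : List B) acc →
  proj₂ (foldl zipStep (ys , acc) xs) ≡ zip xs ys ʳ++ acc
foldl-zipStep []       ys       acc = refl
foldl-zipStep (x ∷ xs) []       acc = done xs
  where
  done : ∀ xs → proj₂ (foldl zipStep ([] , acc) xs) ≡ acc
  done []       = refl
  done (x ∷ xs) = done xs
foldl-zipStep (x ∷ xs) (y ∷ ys) acc = foldl-zipStep xs ys ((x , y) ∷ acc)

mapProj₂-zip : ∀ {B : Set} n (xs : List B) → map proj₂ (zip (replicate n tt) xs) ≡ take n xs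
mapProj₂-zip zero    xs       = refl
mapProj₂-zip (suc n) []       = refl
mapProj₂-zip (suc n) (x ∷ xs) = cong (x ∷_) (mapProj₂-zip n xs)

tail : {A : Set} → List A → List A
tail xs = caseList xs [] (λ _ ys → ys)

foldl-tail : ∀ {A : Set} n (xs : List A) → foldl (λ s _ → tail s) xs (replicate n tt) ≡ List.drop n xs
foldl-tail zero    xs       = refl
foldl-tail (suc n) (x ∷ xs) = foldl-tail n xs
foldl-tail (suc n) []       = done n
  where
  done : ∀ n → foldl (λ s _ → tail s) [] (replicate n tt) ≡ []
  done zero    = refl
  done (suc n) = done n

foldl-suc : ∀ m n → foldl (λ s _ → suc s) n (replicate m tt) ≡ m + n
foldl-suc zero    n = refl
foldl-suc (suc m) n = trans (foldl-suc m (suc n)) (+-suc m n)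

foldl-+ : ∀ m n k → foldl (λ s _ → n + s) k (replicate m tt) ≡ m * n + k
foldl-+ zero    n k = refl
foldl-+ (suc m) n k = trans (foldl-+ m n (n + k)) (lem (m * n) n k)
  where
  lem : ∀ x n k → x + (n + k) ≡ n + x + k
  lem = solve-∀

isZero : ℕ → Bool
isZero n = n ≡ᵇ 0

foldl-pred : ∀ m n → foldl (λ s _ → pred s) m (replicate n tt) ≡ m ∸ n
foldl-pred m zero    = refl
foldl-pred m (suc n) = trans (foldl-pred (pred m) n) (pred-∸ m n)
  where
  pred-∸ : ∀ m n → pred m ∸ n ≡ m ∸ suc n
  pred-∸ zero    n = 0∸n≡0 n
  pred-∸ (suc m) n = refl

module _ {a : Code} where

  zipF : ∀ {b d} {f : El a → List (El b)} {g : El a → List (El d)} → FP {a} {seq b} f → FP {a} {seq d} g →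
    FP {a} {seq (b ⊠ d)} (λ x → zip (f x) (g x))
  zipF {b} {d} {f} {g} P Q = ext (λ x → trans (cong reverse (foldl-zipStep (f x) (g x) [])) (reverse-involutive _))
    (reverseF (sndF ∘F foldF {step = λ ((x , s) , y) → zipStep s y} stepF ⟨ Q , []F ⟩F P (con 4 +ₚ var) grow))
    where
    stepF : FP {(a ⊠ seq d ⊠ seq (b ⊠ d)) ⊠ b} {seq d ⊠ seq (b ⊠ d)} (λ ((x , s) , y) → zipStep s y)
    stepF = caseF (fstF ∘F sndF ∘F fstF)
      ⟨ []F , sndF ∘F sndF ∘F fstF ⟩F
      ⟨ sndF ∘F sndF , ⟨ sndF ∘F fstF , fstF ∘F sndF ⟩F ∷F sndF ∘F sndF ∘F fstF ∘F fstF ⟩F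
    arith : ∀ x y s acc z → suc (s + suc (suc (y + z) + acc)) + (3 + x) ≡ suc (suc (z + s) + acc) + (4 + (x + y))
    arith = solve-∀
    grow : ∀ x s y → sz (seq d ⊠ seq (b ⊠ d)) (zipStep s y) ≤ sz (seq d ⊠ seq (b ⊠ d)) s + (4 + (sz a x + sz b y))
    grow x ([] , acc)     y = m≤m+n _ _
    grow x (z ∷ zs , acc) y = ≤-by (3 + sz a x) (arith (sz a x) (sz b y) (sz (seq d) zs) (sz (seq (b ⊠ d)) acc) (sz d z))

  lengthF : ∀ {b} {f : El a → List (El b)} → FP {a} {seq b} f → FP {a} {nat} (length ∘ f)
  lengthF {b} {f} P = fp (extC (λ _ → refl) (λ x → trans (map-id (map (λ _ → tt) (f x)))
      (trans (sym (replicate-length _)) (cong (λ n → replicate n tt) (length-map _ (f x)))))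
    (computes (mapF {d = unit} ttF P) ⨾ᶜ primC skip))

  -- Zipping with n units cuts a list after n entries.
  takeF : ∀ {b} {n : El a → ℕ} {f : El a → List (El b)} → FP {a} {nat} n → FP {a} {seq b} f →
    FP {a} {seq b} (λ x → take (n x) (f x))
  takeF {b} {n} {f} N P = ext (λ x → mapProj₂-zip (n x) (f x)) (mapF (sndF ∘F sndF) (zipF {d = b} (ticksF N) P))

  replicateF : ∀ {b} {n : El a → ℕ} {f : El a → El b} → FP {a} {nat} n → FP {a} {b} f →
    FP {a} {seq b} (λ x → replicate (n x) (f x))
  replicateF {b} {n} {f} N P = ext (λ x → map-replicate (λ _ → f x) (n x) tt) (mapF (P ∘F fstF) (ticksF N))

  tailF : ∀ {b} {f : El a → List (El b)} → FP {a} {seq b} f → FP {a} {seq b} (λ x → tail (f x))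
  tailF P = caseF P []F (sndF ∘F sndF)

module _ {a : Code} where

  sz-tail : ∀ (xs : List (El a)) → sz (seq a) (tail xs) ≤ sz (seq a) xs
  sz-tail []       = ≤-refl
  sz-tail (x ∷ xs) = ≤-trans (m≤n+m _ (sz a x)) (n≤1+n _)

module _ {a : Code} where

  listDropF : ∀ {b} {n : El a → ℕ} {f : El a → List (El b)} → FP {a} {nat} n → FP {a} {seq b} f →
    FP {a} {seq b} (λ x → List.drop (n x) (f x))
  listDropF {b} {n} {f} N P = ext (λ x → foldl-tail (n x) (f x))
    (foldF {step = λ ((x , s) , y) → tail s} (tailF {b = b} (sndF ∘F fstF)) P (ticksF N) (con 0)
      λ x s y → ≤-trans (sz-tail s) (m≤m+n _ 0))

  xorF : ∀ {f g} → FP {a} {bool} f → FP {a} {bool} g → FP {a} {bool} (λ x → f x xor g x)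
  xorF {f} {g} P Q = ext (λ x → xor-if (f x) (g x)) (ifF P (ifF Q falseF trueF) Q)
    where
    xor-if : ∀ x y → (if x then (if y then false else true) else y) ≡ x xor y
    xor-if false y     = refl
    xor-if true  false = refl
    xor-if true  true  = refl

  ∧F : ∀ {f g} → FP {a} {bool} f → FP {a} {bool} g → FP {a} {bool} (λ x → f x ∧ g x)
  ∧F {f} {g} P Q = ext (λ x → ∧-if (f x) (g x)) (ifF P Q falseF)
    where
    ∧-if : ∀ x y → (if x then y else false) ≡ x ∧ y
    ∧-if false y = refl
    ∧-if true  y = refl

  grow-bool : ∀ {b} {step : El ((a ⊠ bool) ⊠ b) → Bool} x s y →
    sz bool (step ((x , s) , y)) ≤ sz bool s + 0
  grow-bool {step = step} x s y =
    ≤-reflexive (trans (sz-bool (step ((x , s) , y))) (trans (sym (sz-bool s)) (sym (+-identityʳ _))))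

xorAll : List Bool → Bool
xorAll = foldr _xor_ false

foldl-xor : ∀ s xs → foldl _xor_ s xs ≡ s xor xorAll xs
foldl-xor s []       = sym (xor-identityʳ s)
foldl-xor s (x ∷ xs) = trans (foldl-xor (s xor x) xs) (xor-assoc s x (xorAll xs))

foldl-∨ : ∀ s xs → foldl _∨_ s xs ≡ s ∨ or xs
foldl-∨ s []       = sym (∨-identityʳ s)
foldl-∨ s (x ∷ xs) = trans (foldl-∨ (s ∨ x) xs) (∨-assoc s x (or xs))

module _ {a : Code} where

  xorAllF : ∀ {f} → FP {a} {seq bool} f → FP {a} {bool} (xorAll ∘ f)
  xorAllF {f} P = ext (λ x → foldl-xor false (f x))
    (foldF {d = bool} stepF falseF P (con 0) (grow-bool {b = bool} {step = λ ((x , s) , y) → s xor y}))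
    where
    stepF : FP {(a ⊠ bool) ⊠ bool} {bool} (λ ((x , s) , y) → s xor y)
    stepF = xorF (sndF ∘F fstF) sndF

  orF : ∀ {f} → FP {a} {seq bool} f → FP {a} {bool} (or ∘ f)
  orF {f} P = ext (λ x → foldl-∨ false (f x))
    (foldF {d = bool} stepF falseF P (con 0) (grow-bool {b = bool} {step = λ ((x , s) , y) → s ∨ y}))
    where
    ∨-if : ∀ x y → (if x then true else y) ≡ x ∨ y
    ∨-if false y = refl
    ∨-if true  y = refl
    stepF : FP {(a ⊠ bool) ⊠ bool} {bool} (λ ((x , s) , y) → s ∨ y)
    stepF = ext (λ ((x , s) , y) → ∨-if s y) (ifF {b = bool} (sndF ∘F fstF) trueF sndF)

  addF : ∀ {f g} → FP {a} {nat} f → FP {a} {nat} g → FP {a} {nat} (λ x → f x + g x)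
  addF {f} {g} P Q = ext (λ x → foldl-suc (f x) (g x))
    (foldF {d = nat} (sucF (sndF ∘F fstF)) Q (ticksF P) (con 2) λ x s y → ≤-reflexive (+-comm 2 _))

module _ {a : Code} where

  -- Repeated addition. The summand is recomputed from the environment at every step, so its size is
  -- an admissible growth.
  mulF : ∀ {f g} → FP {a} {nat} f → FP {a} {nat} g → FP {a} {nat} (λ x → f x * g x)
  mulF {f} {g} P Q = ext (λ x → trans (foldl-+ (f x) (g x) 0) (+-identityʳ _))
    (foldF {d = nat} (addF (Q ∘F fstF ∘F fstF) (sndF ∘F fstF)) zeroF (ticksF P) (size-bound Q) λ x s y →
      ≤-trans (sz-nat-+ (g x) s) (≤-trans (+-monoˡ-≤ _ (output-bounded Q x)) (≤-trans (≤-reflexive (+-comm _ (sz nat s)))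
        (+-monoʳ-≤ (sz nat s) (eval-mono (size-bound Q) (m≤m+n _ _))))))

  predF : ∀ {f} → FP {a} {nat} f → FP {a} {nat} (λ x → pred (f x))
  predF {f} P = ext (λ x → pred-case (f x)) (caseF (ticksF P) zeroF (lengthF {b = unit} (sndF ∘F sndF)))
    where
    pred-case : ∀ n → caseList (replicate n tt) 0 (λ _ ts → length ts) ≡ pred n
    pred-case zero    = refl
    pred-case (suc n) = length-replicate n

  isZeroF : ∀ {f} → FP {a} {nat} f → FP {a} {bool} (λ x → isZero (f x))
  isZeroF {f} P = ext (λ x → lem (f x)) (caseF {d = bool} (ticksF P) trueF falseF)
    where
    lem : ∀ n → caseList (replicate n tt) true (λ _ _ → false) ≡ isZero n
    lem zero    = refl
    lem (suc n) = refl

module _ {a : Code} where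

  monusF : ∀ {f g} → FP {a} {nat} f → FP {a} {nat} g → FP {a} {nat} (λ x → f x ∸ g x)
  monusF {f} {g} P Q = ext (λ x → foldl-pred (f x) (g x))
    (foldF {d = nat} (predF (sndF ∘F fstF)) P (ticksF Q) (con 0) λ x s y → sz-pred s)
    where
    sz-pred : ∀ n → sz nat (pred n) ≤ sz nat n + 0
    sz-pred zero    = ≤-refl
    sz-pred (suc n) = ≤-trans (≤-trans (n≤1+n _) (n≤1+n _)) (m≤m+n _ 0)

  eqF : ∀ {f g} → FP {a} {nat} f → FP {a} {nat} g → FP {a} {bool} (λ x → f x ≡ᵇ g x)
  eqF {f} {g} P Q = ext (λ x → lem (f x) (g x)) (isZeroF (addF (monusF P Q) (monusF Q P)))
    where
    lem : ∀ m n → isZero ((m ∸ n) + (n ∸ m)) ≡ (m ≡ᵇ n)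
    lem zero    zero    = refl
    lem zero    (suc n) = refl
    lem (suc m) zero    = refl
    lem (suc m) (suc n) = lem m n

-- The list 0, ..., n - 1 is built from its end, and the length of the part already present
-- determines the next entry. Invariant: with k rounds to go, the entries from k on are present.
foldl-countdown : ∀ n k → k ≤ n →
  foldl (λ s _ → (n ∸ suc (length s)) ∷ s) (applyUpTo (k +_) (n ∸ k)) (replicate k tt) ≡ upTo n
foldl-countdown n zero    _   = refl
foldl-countdown n (suc k) k<n = trans
  (cong (λ s → foldl (λ s _ → (n ∸ suc (length s)) ∷ s) s (replicate k tt))
    (trans (cong₂ _∷_ first (applyUpTo-cong (n ∸ suc k) (λ i → sym (+-suc k i)))) (sym (cong (applyUpTo (k +_)) ∸-step))))
  (foldl-countdown n k (<⇒≤ k<n))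
  where
  applyUpTo-cong : ∀ {f g : ℕ → ℕ} m → (∀ i → f i ≡ g i) → applyUpTo f m ≡ applyUpTo g m
  applyUpTo-cong zero    f≗g = refl
  applyUpTo-cong (suc m) f≗g = cong₂ _∷_ (f≗g 0) (applyUpTo-cong m (f≗g ∘ suc))
  ∸-step : n ∸ k ≡ suc (n ∸ suc k)
  ∸-step = trans (cong (_∸ suc k) {x = suc n} refl) (+-∸-assoc 1 k<n)
  first : n ∸ suc (length (applyUpTo (suc k +_) (n ∸ suc k))) ≡ k + 0
  first = trans (cong (λ l → n ∸ suc l) (length-applyUpTo (suc k +_) (n ∸ suc k)))
    (trans (cong (n ∸_) (sym ∸-step)) (trans (m∸[m∸n]≡n (<⇒≤ k<n)) (sym (+-identityʳ k))))

indexed : {A : Set} → List A → List (ℕ × A)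
indexed xs = zip (upTo (length xs)) xs

foldl-ʳ++ : ∀ {A : Set} (s : List A) xss → foldl (λ s xs → xs ʳ++ s) s xss ≡ concat xss ʳ++ s
foldl-ʳ++ s []         = refl
foldl-ʳ++ s (xs ∷ xss) = trans (foldl-ʳ++ (xs ʳ++ s) xss) (sym (++-ʳ++ xs))

sz-ʳ++ : ∀ a xs ys → sz (seq a) (xs ʳ++ ys) ≤ sz (seq a) xs + sz (seq a) ys
sz-ʳ++ a []       ys = n≤1+n _
sz-ʳ++ a (x ∷ xs) ys = ≤-trans (sz-ʳ++ a xs (x ∷ ys)) (≤-reflexive (arith (sz a x) (sz (seq a) xs) (sz (seq a) ys)))
  where
  arith : ∀ x xs ys → xs + suc (x + ys) ≡ suc (x + xs) + ys
  arith = solve-∀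

module _ {a : Code} where

  upToF : ∀ {f} → FP {a} {nat} f → FP {a} {seq nat} (λ x → upTo (f x))
  upToF {f} P = ext (λ x → trans (cong (λ l → foldl (λ s _ → (f x ∸ suc (length s)) ∷ s) (applyUpTo (f x +_) l) (replicate (f x) tt))
                                     (sym (n∸n≡0 (f x))))
                             (foldl-countdown (f x) (f x) ≤-refl))
    (foldF {d = seq nat} {step = λ ((x , s) , _) → (f x ∸ suc (length s)) ∷ s}
      (monusF (P ∘F fstF ∘F fstF) (sucF (lengthF (sndF ∘F fstF))) ∷F sndF ∘F fstF) []F (ticksF P)
      (con 1 +ₚ size-bound P) λ x s y → begin
        suc (sz nat (f x ∸ suc (length s)) + sz (seq nat) s)
          ≤⟨ s≤s (+-monoˡ-≤ _ (sz-∸ (f x) (suc (length s)))) ⟩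
        suc (sz nat (f x) + sz (seq nat) s)
          ≤⟨ s≤s (+-monoˡ-≤ _ (≤-trans (output-bounded P x) (eval-mono (size-bound P) (m≤m+n (sz a x) 1)))) ⟩
        suc (eval (size-bound P) (sz a x + 1) + sz (seq nat) s)
          ≡⟨ +-comm (suc (eval (size-bound P) (sz a x + 1))) _ ⟩
        sz (seq nat) s + suc (eval (size-bound P) (sz a x + 1))
          ∎)
    where
    open ≤-Reasoning
    sz-∸ : ∀ m n → sz nat (m ∸ n) ≤ sz nat m
    sz-∸ m n = subst₂ _≤_ (sym (sz-nat (m ∸ n))) (sym (sz-nat m)) (s≤s (*-monoˡ-≤ 2 (m∸n≤m m n)))

  indexedF : ∀ {b} {f : El a → List (El b)} → FP {a} {seq b} f → FP {a} {seq (nat ⊠ b)} (λ x → indexed (f x))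
  indexedF {b} P = zipF {d = b} (upToF (lengthF {b = b} P)) P

  concatF : ∀ {b} {f : El a → List (List (El b))} → FP {a} {seq (seq b)} f → FP {a} {seq b} (λ x → concat (f x))
  concatF {b} {f} P = ext (λ x → trans (cong reverse (foldl-ʳ++ [] (f x))) (reverse-involutive _))
    (reverseF (foldF {d = seq b} {step = λ ((x , s) , y) → y ʳ++ s} (ʳ++F {b = b} sndF (sndF ∘F fstF)) []F P var
      λ x s y → ≤-trans (sz-ʳ++ b y s) (≤-trans (≤-reflexive (+-comm (sz (seq b) y) _))
        (+-monoʳ-≤ (sz (seq b) s) (m≤n+m _ (sz a x))))))

dot : List Bool → List Bool → Bool
dot []      _       = false
dot (_ ∷ _) []      = false
dot (a ∷ u) (b ∷ v) = (a ∧ b) xor dot u v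

module _ {a : Code} where

  dotF : ∀ {f g} → FP {a} {seq bool} f → FP {a} {seq bool} g → FP {a} {bool} (λ x → dot (f x) (g x))
  dotF {f} {g} P Q = ext (λ x → lem (f x) (g x))
    (xorAllF (mapF {f = λ (_ , b , c) → b ∧ c} (∧F (fstF ∘F sndF) (sndF ∘F sndF)) (zipF {d = bool} P Q)))
    where
    lem : ∀ u v → xorAll (map (λ (b , c) → b ∧ c) (zip u v)) ≡ dot u v
    lem []      v       = refl
    lem (a ∷ u) []      = refl
    lem (a ∷ u) (b ∷ v) = cong ((a ∧ b) xor_) (lem u v)

  zipXorF : ∀ {f g} → FP {a} {seq bool} f → FP {a} {seq bool} g → FP {a} {seq bool} (λ x → List.zipWith _xor_ (f x) (g x))
  zipXorF {f} {g} P Q = ext (λ x → lem (f x) (g x))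
    (mapF {f = λ (_ , b , c) → b xor c} (xorF (fstF ∘F sndF) (sndF ∘F sndF)) (zipF {d = bool} P Q))
    where
    lem : ∀ u v → map (λ (b , c) → b xor c) (zip u v) ≡ List.zipWith _xor_ u v
    lem []      v       = refl
    lem (a ∷ u) []      = refl
    lem (a ∷ u) (b ∷ v) = cong ((a xor b) ∷_) (lem u v)

-- Reductions

≤ᶜᵖ-trans : ∀ {P Q R} → P ≤ᶜᵖ Q → Q ≤ᶜᵖ R → P ≤ᶜᵖ R
≤ᶜᵖ-trans {P} {Q} {R} α β = record
  { F = λ I → F β (F α I)
  ; G = λ I S → G α I (G β (F α I) S)
  ; F-polyTime = toPolyTime (FC ⨾ᶜ reindexC (F α) (fromPolyTime (F-polyTime β)))
  ; G-polyTime = toPolyTime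
      -- The second reduction maps solutions back relative to `F α I`, which is not part of the
      -- input and has to be computed again.
      (forkC (primC fst) (forkC (primC fst ⨾ᶜ reindexC proj₁ FC) (primC snd)
               ⨾ᶜ reindexC (λ (I , S) → F α I , S) (fromPolyTime (G-polyTime β)))
        ⨾ᶜ reindexC {Y = Σ (Instance P) λ I → Solution R (F β (F α I))}
             (λ (I , S) → I , G β (F α I) S) (fromPolyTime (G-polyTime α)))
  ; F-feasible = λ I f → F-feasible β (F α I) (F-feasible α I f)
  ; F-optimum = λ I f →
      let c , cP , (S , fS , S≡c) , c≤ = F-optimum α I f
          d , ((T , fT , T≡d) , d≤) , dR = F-optimum β (F α I) (F-feasible α I f)
          -- Both reductions supply an optimum of the middle instance; the two agree because optima
          -- are unique.
          c≡d = ≤-antisym (subst (c ≤_) T≡d (c≤ T fT)) (subst (d ≤_) S≡c (d≤ S fS))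
      in d , subst (IsOptimum P I) c≡d cP , dR
  ; G-feasible = λ I f S fS → G-feasible α I f _ (G-feasible β (F α I) (F-feasible α I f) S fS)
  ; G-cost = λ I f S fS → let f′ = F-feasible α I f in
      ≤-trans (G-cost α I f _ (G-feasible β (F α I) f′ S fS)) (G-cost β (F α I) f′ S fS)
  }
  where
  open _≤ᶜᵖ_
  FC = fromPolyTime (F-polyTime α)

HasOptima : MinProblem → Set
HasOptima P = ∀ I → FeasibleInstance P I → ∃[ c ] IsOptimum P I c

-- `forth` bounds the optimum of `F I` by that of `I`, and `back` gives the converse. `forth` need
-- not be computable in polynomial time. What separates this from a reduction is the existence of an
-- optimum, which has to be exhibited.
record Simulation (P Q : MinProblem) : Set where
  field
    F : Instance P → Instance Q
    G : (I : Instance P) → Solution Q (F I) → Solution P I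
    F-computes : Computes (encodeInstance P) (λ I → encodeInstance Q (F I))
    G-computes : Computes {X = Σ (Instance P) λ I → Solution Q (F I)}
      {A = instanceTy P ⊗ solutionTy Q} {B = solutionTy P}
      (λ (I , S′) → encodeInstance P I , encodeSolution Q (F I) S′)
      (λ (I , S′) → encodeSolution P I (G I S′))
    forth : ∀ I S → Feasible P I S → ∃[ S′ ] Feasible Q (F I) S′ × cost Q (F I) S′ ≤ cost P I S
    back  : ∀ I → FeasibleInstance P I → ∀ S′ → Feasible Q (F I) S′ →
      Feasible P I (G I S′) × cost P I (G I S′) ≤ cost Q (F I) S′

  optimum-pullback : ∀ I → FeasibleInstance P I → ∀ {c} → IsOptimum Q (F I) c → IsOptimum P I c
  optimum-pullback I f {c} ((S′ , fS′ , S′≡c) , c≤) =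
    (G I S′ , fGS′ , ≤-antisym (subst (cost P I (G I S′) ≤_) S′≡c GS′≤) (c≤cost (G I S′) fGS′)) , c≤cost
    where
    fGS′ = proj₁ (back I f S′ fS′)
    GS′≤ = proj₂ (back I f S′ fS′)
    c≤cost : ∀ S → Feasible P I S → c ≤ cost P I S
    c≤cost S fS = let T , fT , T≤ = forth I S fS in ≤-trans (c≤ T fT) T≤

  F-feasible′ : ∀ I → FeasibleInstance P I → FeasibleInstance Q (F I)
  F-feasible′ I (S , fS) = let T , fT , _ = forth I S fS in T , fT

  hasOptima : HasOptima Q → HasOptima P
  hasOptima opt I f = let c , o = opt (F I) (F-feasible′ I f) in c , optimum-pullback I f o

  reduction : HasOptima Q → P ≤ᶜᵖ Q
  reduction opt = record
    { F = F ; G = G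
    ; F-polyTime = toPolyTime F-computes
    ; G-polyTime = toPolyTime G-computes
    ; F-feasible = F-feasible′
    ; F-optimum = λ I f → let c , o = opt (F I) (F-feasible′ I f) in c , optimum-pullback I f o , o
    ; G-feasible = λ I f S fS → proj₁ (back I f S fS)
    ; G-cost = λ I f S fS → proj₂ (back I f S fS)
    }

-- Linear equations over GF(2)

enc-bits : ∀ {n} (v : Vec Bool n) → enc (seq bool) (toList v) ≡ encodeBits v
enc-bits v = sym (toList-map encodeBit v)

toRows : ∀ {m n} → Vec (Vec Bool n) m → List (List Bool)
toRows A = map toList (toList A)

enc-rows : ∀ {m n} (A : Vec (Vec Bool n) m) → enc (seq (seq bool)) (toRows A) ≡ encodeRows A
enc-rows []      = refl
enc-rows (v ∷ A) = cong₂ _∷_ (enc-bits v) (enc-rows A)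

trues : List Bool → ℕ
trues []          = 0
trues (false ∷ w) = trues w
trues (true  ∷ w) = suc (trues w)

∣∣-trues : ∀ {n} (W : Subset n) → ∣ W ∣ ≡ trues (toList W)
∣∣-trues []          = refl
∣∣-trues (false ∷ W) = ∣∣-trues W
∣∣-trues (true  ∷ W) = cong suc (∣∣-trues W)

infix 4 _≼_

-- Compares a vector of violation flags with the characteristic vector of a deletion set: whatever
-- is violated must be deleted, while more may be deleted.
_≼_ : List Bool → List Bool → Set
_≼_ = Pointwise _≤ᵇ_

≼-refl : ∀ {u} → u ≼ u
≼-refl {[]}    = []
≼-refl {a ∷ u} = b≤b ∷ ≼-refl

≼-reflexive : ∀ {u v} → u ≡ v → u ≼ v
≼-reflexive refl = ≼-refl

≤ᵇ-false : ∀ {a} → a ≤ᵇ false → a ≡ false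
≤ᵇ-false b≤b = refl

≤ᵇ-true : ∀ b → b ≤ᵇ true
≤ᵇ-true false = f≤t
≤ᵇ-true true  = b≤b

≤ᵇ-trans : ∀ {a b c} → a ≤ᵇ b → b ≤ᵇ c → a ≤ᵇ c
≤ᵇ-trans f≤t b≤b = f≤t
≤ᵇ-trans b≤b q   = q

≼-trans : ∀ {u v w} → u ≼ v → v ≼ w → u ≼ w
≼-trans []       []       = []
≼-trans (p ∷ ps) (q ∷ qs) = ≤ᵇ-trans p q ∷ ≼-trans ps qs

trues-mono : ∀ {u v} → u ≼ v → trues u ≤ trues v
trues-mono []                     = z≤n
trues-mono (f≤t ∷ ps)             = m≤n⇒m≤1+n (trues-mono ps)
trues-mono (b≤b {false} ∷ ps)     = trues-mono ps
trues-mono (b≤b {true}  ∷ ps)     = s≤s (trues-mono ps)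

-- An equation (b , r) asks for r · x = b.
Equation : Set
Equation = Bool × List Bool

residual : List Bool → Equation → Bool
residual x (b , r) = dot r x xor b

record LinInstance : Set where
  field
    n         : ℕ
    equations : List Equation
    lengths   : All (λ e → length (proj₂ e) ≡ n) equations

-- In contrast to Nearest Codeword a solution only names equations, not the vector x.
MinLin : MinProblem
MinLin = record
  { Instance       = LinInstance
  ; Solution       = λ I → Subset (length (equations I))
  ; Feasible       = λ I W → ∃[ x ] map (residual x) (equations I) ≼ toList W
  ; cost           = λ _ W → ∣ W ∣
  ; instanceTy     = ty (nat ⊠ seq (bool ⊠ seq bool))
  ; solutionTy     = list bitTy
  ; encodeInstance = λ I → enc (nat ⊠ seq (bool ⊠ seq bool)) (n I , equations I)
  ; encodeSolution = λ _ → encodeBits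
  }
  where open LinInstance

-- Exhaustive search, splitting on the first bit; only existence matters, so the exponential time is
-- harmless.
nearest-optimum : HasOptima NearestCodeword
nearest-optimum I _ = let c , (x , x≡c) , c≤ = minimum _ (cost NearestCodeword I) in
  c , (x , tt , x≡c) , λ y _ → c≤ y
  where
  minimum : ∀ n (f : Vec Bool n → ℕ) → ∃[ c ] (∃[ x ] f x ≡ c) × (∀ y → c ≤ f y)
  minimum zero    f = f [] , ([] , refl) , λ { [] → ≤-refl }
  minimum (suc n) f
    with minimum n (λ x → f (false ∷ x)) | minimum n (λ x → f (true ∷ x))
  ... | c , (x , x≡c) , c≤ | d , (y , y≡d) , d≤ with ≤-total c d
  ...   | inj₁ c≤d = c , (false ∷ x , x≡c) , λ { (false ∷ z) → c≤ z ; (true ∷ z) → ≤-trans c≤d (d≤ z) }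
  ...   | inj₂ d≤c = d , (true ∷ y , y≡d) , λ { (false ∷ z) → ≤-trans d≤c (c≤ z) ; (true ∷ z) → d≤ z }

dot-· : ∀ {n} (u v : Vec Bool n) → dot (toList u) (toList v) ≡ u · v
dot-· []      []      = refl
dot-· (a ∷ u) (b ∷ v) = cong ((a ∧ b) xor_) (dot-· u v)

hamming-trues : ∀ {m n} (A : Matrix m n) (x : Vec Bool n) (b : Vec Bool m) →
  hamming (A *ᵥ x) b ≡ trues (map (residual (toList x)) (List.zip (toList b) (toRows A)))
hamming-trues []      x []      = refl
hamming-trues (u ∷ A) x (b ∷ v) with dot (toList u) (toList x) | dot-· u x
... | .(u · x) | refl with u · x | b
...   | false | false = hamming-trues A x v
...   | false | true  = cong suc (hamming-trues A x v)
...   | true  | false = cong suc (hamming-trues A x v)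
...   | true  | true  = hamming-trues A x v

fit : ∀ n → List Bool → Vec Bool n
fit zero    _       = []
fit (suc n) []      = false ∷ fit n []
fit (suc n) (b ∷ u) = b ∷ fit n u

toList-fit : ∀ n u → length u ≡ n → toList (fit n u) ≡ u
toList-fit zero    []      eq = refl
toList-fit (suc n) (b ∷ u) eq = cong (b ∷_) (toList-fit n u (suc-injective eq))

dot-[]ʳ : ∀ r → dot r [] ≡ false
dot-[]ʳ []      = refl
dot-[]ʳ (_ ∷ _) = refl

-- `dot` stops at the end of the shorter list, so missing entries count as `false`, which is what
-- `fit` pads with. Thus a witness of feasibility in `MinLin`, which may have any length, can be
-- brought to length n.
dot-fit : ∀ n r x → length r ≡ n → dot r (toList (fit n x)) ≡ dot r x
dot-fit zero    []      x       eq = refl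
dot-fit (suc n) (a ∷ r) (b ∷ x) eq = cong ((a ∧ b) xor_) (dot-fit n r x (suc-injective eq))
dot-fit (suc n) (a ∷ r) []      eq with a | dot-fit n r [] (suc-injective eq)
... | false | p = trans p (dot-[]ʳ r)
... | true  | p = trans p (dot-[]ʳ r)

residuals-fit : ∀ n x es → All (λ e → length (proj₂ e) ≡ n) es →
  map (residual (toList (fit n x))) es ≡ map (residual x) es
residuals-fit n x []             []       = refl
residuals-fit n x ((b , r) ∷ es) (l ∷ ls) = cong₂ _∷_ (cong (_xor b) (dot-fit n r x l)) (residuals-fit n x es ls)

-- Affine constraints

odd : ℕ → Bool
odd zero    = false
odd (suc n) = not (odd n)

even⇒2∣ : ∀ n → odd n ≡ false → 2 ∣ n
even⇒2∣ zero          _  = 2 ∣0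
even⇒2∣ (suc (suc n)) eq = ∣m∣n⇒∣m+n ∣-refl (even⇒2∣ n (trans (sym (not-involutive _)) eq))

2∣⇒even : ∀ {n} → 2 ∣ n → odd n ≡ false
2∣⇒even (divides q refl) = even q
  where
  even : ∀ q → odd (q * 2) ≡ false
  even zero    = refl
  even (suc q) = trans (not-involutive _) (even q)

odd⇒2∤ : ∀ {n} → odd n ≡ true → 2 ∤ n
odd⇒2∤ o 2∣n with trans (sym o) (2∣⇒even 2∣n)
... | ()

2∤⇒odd : ∀ n → 2 ∤ n → odd n ≡ true
2∤⇒odd n 2∤n with odd n in eq
... | true  = refl
... | false = ⊥-elim (2∤n (even⇒2∣ n eq))

odd-trues : ∀ u → odd (trues u) ≡ xorAll u
odd-trues []          = refl
odd-trues (false ∷ u) = odd-trues u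
odd-trues (true  ∷ u) = cong not (odd-trues u)

sum-bit : ∀ {n} (a : Vec Bool n) → Vec.sum (Vec.map bit a) ≡ trues (toList a)
sum-bit []          = refl
sum-bit (false ∷ a) = sum-bit a
sum-bit (true  ∷ a) = cong suc (sum-bit a)

xor≡false⇒≡ : ∀ {a b} → a xor b ≡ false → a ≡ b
xor≡false⇒≡ {false} {false} _ = refl
xor≡false⇒≡ {true}  {true}  _ = refl

≡⇒xor≡false : ∀ {a b} → a ≡ b → a xor b ≡ false
≡⇒xor≡false {a} refl = xor-same a

-- In B₂ and in B₃ every relation is an affine hyperplane, with nonzero constant
-- term exactly for the relation at position 1.
rhs : ℕ → Bool
rhs R = R ≡ᵇ 1

Affine : List BoolRel → Set
Affine Γ = ∀ R a → (holds (lookup Γ R) a → xorAll (toList a) ≡ rhs (toℕ R))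
                 × (xorAll (toList a) ≡ rhs (toℕ R) → holds (lookup Γ R) a)

EVEN⁴-affine : (a : Vec Bool 4) → (2 ∣ Vec.sum (Vec.map bit a) → xorAll (toList a) ≡ false)
                   × (xorAll (toList a) ≡ false → 2 ∣ Vec.sum (Vec.map bit a))
EVEN⁴-affine a = (λ e → trans (sym odd-sum) (2∣⇒even e)) , (λ e → even⇒2∣ _ (trans odd-sum e))
  where odd-sum = trans (cong odd (sum-bit a)) (odd-trues (toList a))

B₂-affine : Affine B₂
B₂-affine zero             a            = EVEN⁴-affine a
B₂-affine (suc zero)       (true ∷ [])  = (λ _ → refl) , λ _ → refl
B₂-affine (suc zero)       (false ∷ []) = (λ ()) , λ ()
B₂-affine (suc (suc zero)) (true ∷ [])  = (λ ()) , λ ()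
B₂-affine (suc (suc zero)) (false ∷ []) = (λ _ → refl) , λ _ → refl

B₃-affine : Affine B₃
B₃-affine zero       a                    = EVEN⁴-affine a
B₃-affine (suc zero) (false ∷ false ∷ []) = (λ { (inj₁ ()) ; (inj₂ ()) }) , λ ()
B₃-affine (suc zero) (false ∷ true ∷ [])  = (λ _ → refl) , λ _ → inj₁ refl
B₃-affine (suc zero) (true ∷ false ∷ [])  = (λ _ → refl) , λ _ → inj₂ refl
B₃-affine (suc zero) (true ∷ true ∷ [])   = (λ { (inj₁ ()) ; (inj₂ ()) }) , λ ()

module _ {Γ : List BoolRel} where

  violation : ∀ {n} → (Fin n → Bool) → Constraint Γ n → Bool
  violation σ (constraint R s) = xorAll (toList (Vec.map σ s)) xor rhs (toℕ R)

  violation-cong : ∀ {n} {σ τ : Fin n → Bool} → (∀ i → σ i ≡ τ i) → ∀ c → violation σ c ≡ violation τ c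
  violation-cong σ≗τ (constraint R s) = cong (λ a → xorAll (toList a) xor rhs (toℕ R)) (vmap-cong σ≗τ s)

  module _ (affine : Affine Γ) {n : ℕ} (σ : Fin n → Bool) where

    satisfied⇒≼ : ∀ 𝒞 (W : Subset (length 𝒞)) → (∀ i → i ∉ W → Satisfies σ (lookup 𝒞 i)) →
      map (violation σ) 𝒞 ≼ toList W
    satisfied⇒≼ []      []          sat = []
    satisfied⇒≼ (c ∷ 𝒞) (false ∷ W) sat =
      subst (_≤ᵇ false) (sym (≡⇒xor≡false (proj₁ (affine _ _) (sat zero λ ())))) b≤b
      ∷ satisfied⇒≼ 𝒞 W (λ i i∉W → sat (suc i) (i∉W ∘ drop-there))
    satisfied⇒≼ (c ∷ 𝒞) (true ∷ W) sat = ≤ᵇ-true _ ∷ satisfied⇒≼ 𝒞 W (λ i i∉W → sat (suc i) (i∉W ∘ drop-there))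
    ≼⇒satisfied : ∀ 𝒞 (W : Subset (length 𝒞)) → map (violation σ) 𝒞 ≼ toList W →
      ∀ i → i ∉ W → Satisfies σ (lookup 𝒞 i)
    ≼⇒satisfied (c ∷ 𝒞) (true  ∷ W) (p ∷ ps) zero    i∉W = ⊥-elim (i∉W here)
    ≼⇒satisfied (c ∷ 𝒞) (false ∷ W) (p ∷ ps) zero    i∉W =
      proj₂ (affine _ _) (xor≡false⇒≡ (≤ᵇ-false p))
    ≼⇒satisfied (c ∷ 𝒞) (w ∷ W)     (p ∷ ps) (suc i) i∉W = ≼⇒satisfied 𝒞 W ps i (i∉W ∘ there)

-- From constraints to linear equations

cspCode : Code
cspCode = nat ⊠ seq (nat ⊠ seq nat)

rawConstraint : ∀ {Γ n} → Constraint Γ n → ℕ × List ℕ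
rawConstraint (constraint R s) = toℕ R , toList (Vec.map toℕ s)

enc-constraint : ∀ {Γ n} (c : Constraint Γ n) → enc (nat ⊠ seq nat) (rawConstraint c) ≡ encodeConstraint c
enc-constraint (constraint R s) = cong (encodeFin R ,_)
  (trans (sym (toList-map encodeℕ (Vec.map toℕ s))) (cong toList (sym (vmap-∘ encodeℕ toℕ s))))

rawCSP : ∀ {Γ} → CSPInstance Γ → ℕ × List (ℕ × List ℕ)
rawCSP I = CSPInstance.n I , map rawConstraint (CSPInstance.𝒞 I)

enc-csp : ∀ {Γ} (I : CSPInstance Γ) → enc cspCode (rawCSP I) ≡ encodeInstance (MinCSP Γ) I
enc-csp I = cong (encodeℕ (CSPInstance.n I) ,_)
  (trans (sym (map-∘ (CSPInstance.𝒞 I))) (map-cong enc-constraint (CSPInstance.𝒞 I)))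

encodeBits-cast : ∀ {m n} .(eq : m ≡ n) (W : Vec Bool m) → encodeBits (Vec.cast eq W) ≡ encodeBits W
encodeBits-cast eq W = trans (sym (enc-bits (Vec.cast eq W))) (trans (cong (enc (seq bool)) (toList-cast eq W)) (enc-bits W))

∣∣-toList : ∀ {m n} (V : Subset m) (W : Subset n) → toList V ≡ toList W → ∣ V ∣ ≡ ∣ W ∣
∣∣-toList V W eq = trans (∣∣-trues V) (trans (cong trues eq) (sym (∣∣-trues W)))

nth : List Bool → ℕ → Bool
nth []      _       = false
nth (a ∷ _) zero    = a
nth (_ ∷ x) (suc i) = nth x i

nth-tabulate : ∀ {n} (σ : Fin n → Bool) i → nth (toList (Vec.tabulate σ)) (toℕ i) ≡ σ i
nth-tabulate σ zero    = refl
nth-tabulate σ (suc i) = nth-tabulate (σ ∘ suc) i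

nth-beyond : ∀ {n} (v : Vec Bool n) → nth (toList v) n ≡ false
nth-beyond []      = refl
nth-beyond (_ ∷ v) = nth-beyond v

-- Occurrences are counted modulo 2, since a variable may occur several times in a constraint and
-- equal summands cancel in pairs.
indicator : ℕ → List ℕ → List Bool
indicator n s = map (λ j → xorAll (map (j ≡ᵇ_) s)) (upTo n)

length-indicator : ∀ n s → length (indicator n s) ≡ n
length-indicator n s = trans (length-map _ (upTo n)) (length-upTo n)

-- Both sides are additive in `s`, which leaves the case of a single variable, `dot-unit`.
dot-indicator : ∀ n s x → All (_< n) s → dot (indicator n s) x ≡ xorAll (map (nth x) s)
dot-indicator n s x s<n = trans (cong (λ u → dot u x) (map-upTo _ n)) (go s s<n)
  where
  dot-zero : ∀ n x → dot (applyUpTo (λ _ → false) n) x ≡ false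
  dot-zero zero    x       = refl
  dot-zero (suc n) []      = refl
  dot-zero (suc n) (_ ∷ x) = dot-zero n x
  dot-xor : ∀ (f g : ℕ → Bool) n x →
    dot (applyUpTo (λ j → f j xor g j) n) x ≡ dot (applyUpTo f n) x xor dot (applyUpTo g n) x
  dot-xor f g zero    x       = refl
  dot-xor f g (suc n) []      = refl
  dot-xor f g (suc n) (a ∷ x) = trans (cong (((f 0 xor g 0) ∧ a) xor_) (dot-xor (f ∘ suc) (g ∘ suc) n x))
    (solve 5 (λ p q a c d → ((p :+ q) :* a) :+ (c :+ d) := ((p :* a) :+ c) :+ ((q :* a) :+ d)) refl
      (f 0) (g 0) a (dot (applyUpTo (f ∘ suc) n) x) (dot (applyUpTo (g ∘ suc) n) x))
    where open xor-∧-Solver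
  dot-unit : ∀ n i x → i < n → dot (applyUpTo (_≡ᵇ i) n) x ≡ nth x i
  dot-unit (suc n) i       []      i<n       = refl
  dot-unit (suc n) zero    (a ∷ x) i<n       = trans (cong (a xor_) (dot-zero n x)) (xor-identityʳ a)
  dot-unit (suc n) (suc i) (a ∷ x) (s≤s i<n) = dot-unit n i x i<n
  go : ∀ s → All (_< n) s → dot (applyUpTo (λ j → xorAll (map (j ≡ᵇ_) s)) n) x ≡ xorAll (map (nth x) s)
  go []      []           = dot-zero n x
  go (i ∷ s) (i<n ∷ s<n) = trans (dot-xor (_≡ᵇ i) (λ j → xorAll (map (j ≡ᵇ_) s)) n x)
    (cong₂ _xor_ (dot-unit n i x i<n) (go s s<n))

module _ {a : Code} where

  indicatorF : ∀ {n s} → FP {a} {nat} n → FP {a} {seq nat} s → FP {a} {seq bool} (λ x → indicator (n x) (s x))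
  indicatorF N S = mapF (xorAllF (mapF (eqF (sndF ∘F fstF) sndF) (S ∘F fstF))) (upToF N)

module _ {Γ : List BoolRel} (affine : Affine Γ) where

  open LinInstance

  equation : ℕ → ℕ × List ℕ → Equation
  equation n (R , s) = rhs R , indicator n s

  linearise : CSPInstance Γ → LinInstance
  linearise I = record
    { n = CSPInstance.n I
    ; equations = map (equation (CSPInstance.n I)) (map rawConstraint (CSPInstance.𝒞 I))
    ; lengths = lengths′ (CSPInstance.n I) (map rawConstraint (CSPInstance.𝒞 I)) }
    where
    lengths′ : ∀ n cs → All (λ e → length (proj₂ e) ≡ n) (map (equation n) cs)
    lengths′ n []       = []
    lengths′ n (c ∷ cs) = length-indicator n (proj₂ c) ∷ lengths′ n cs

  residual-violation : ∀ {n} (x : List Bool) (c : Constraint Γ n) →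
    residual x (equation n (rawConstraint c)) ≡ violation (λ i → nth x (toℕ i)) c
  residual-violation {n} x (constraint R s) = cong (_xor rhs (toℕ R))
    (trans (dot-indicator n _ x (bounded s)) (cong xorAll
      (trans (sym (toList-map (nth x) (Vec.map toℕ s))) (cong toList (sym (vmap-∘ (nth x) toℕ s))))))
    where
    bounded : ∀ {k} (s : Vec (Fin n) k) → All (_< n) (toList (Vec.map toℕ s))
    bounded []      = []
    bounded (i ∷ s) = toℕ<n i ∷ bounded s

  residuals-violations : ∀ {n} x (𝒞 : List (Constraint Γ n)) →
    map (residual x) (map (equation n) (map rawConstraint 𝒞)) ≡ map (violation (λ i → nth x (toℕ i))) 𝒞
  residuals-violations x []      = refl
  residuals-violations x (c ∷ 𝒞) = cong₂ _∷_ (residual-violation x c) (residuals-violations x 𝒞)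

  same-length : ∀ I → length (CSPInstance.𝒞 I) ≡ length (equations (linearise I))
  same-length I = sym (trans (length-map _ (map rawConstraint (CSPInstance.𝒞 I))) (length-map _ (CSPInstance.𝒞 I)))

  -- Constraints and equations correspond one to one and in the same order, so a deletion set is
  -- kept as it is; the casts only adjust its length index.
  MinCSP⊑MinLin : Simulation (MinCSP Γ) MinLin
  MinCSP⊑MinLin = record
    { F = linearise
    ; G = λ I W → Vec.cast (sym (same-length I)) W
    ; F-computes = extC enc-csp (λ _ → refl) (reindexC rawCSP (computes
        (⟨ fstF , mapF ⟨ eqF (fstF ∘F sndF) (sucF zeroF) , indicatorF (fstF ∘F fstF) (sndF ∘F sndF) ⟩F sndF ⟩F)))
    ; G-computes = extC (λ _ → refl) (λ (I , W) → sym (encodeBits-cast (sym (same-length I)) W)) (primC snd)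
    ; forth = λ I W (σ , sat) → let W′ = Vec.cast (same-length I) W in
        W′ ,
        (toList (Vec.tabulate σ) ,
         subst₂ _≼_
           (trans (map-cong (violation-cong (λ i → sym (nth-tabulate σ i))) (CSPInstance.𝒞 I))
                  (sym (residuals-violations _ (CSPInstance.𝒞 I))))
           (sym (toList-cast (same-length I) W))
           (satisfied⇒≼ affine σ (CSPInstance.𝒞 I) W sat)) ,
        ≤-reflexive (∣∣-toList W′ W (toList-cast (same-length I) W))
    ; back = λ I _ W (x , ≼W) → let W′ = Vec.cast (sym (same-length I)) W in
        ((λ i → nth x (toℕ i)) ,
         ≼⇒satisfied affine _ (CSPInstance.𝒞 I) W′
           (subst₂ _≼_ (residuals-violations x (CSPInstance.𝒞 I)) (sym (toList-cast (sym (same-length I)) W)) ≼W)) ,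
        ≤-reflexive (∣∣-toList W′ W (toList-cast (sym (same-length I)) W))
    }

-- B₃ is closed under complementation, so it cannot fix values; all values are
-- read relative to the one of a new variable.
reference : ∀ {n} → Constraint B₂ n → Constraint B₃ (suc n)
reference     (constraint zero             s)        = constraint zero (Vec.map inject₁ s)
reference {n} (constraint (suc zero)       (x ∷ [])) = constraint (suc zero) (inject₁ x ∷ fromℕ n ∷ [])
reference {n} (constraint (suc (suc zero)) (x ∷ [])) = constraint zero (inject₁ x ∷ fromℕ n ∷ fromℕ n ∷ fromℕ n ∷ [])

map-inject₁-injective : ∀ {n k} {s t : Vec (Fin n) k} → Vec.map inject₁ s ≡ Vec.map inject₁ t → s ≡ t
map-inject₁-injective {s = []}    {[]}    _  = refl
map-inject₁-injective {s = i ∷ s} {j ∷ t} eq =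
  cong₂ _∷_ (inject₁-injective (proj₁ (∷-injective eq))) (map-inject₁-injective (proj₂ (∷-injective eq)))

-- The new constraints must again be pairwise distinct. The images under EVEN⁴ and under {0} share a
-- relation, but their second variables differ: an old variable in one case, the new one in the
-- other.
reference-injective : ∀ {n} {c d : Constraint B₂ n} → reference c ≡ reference d → c ≡ d
reference-injective {c = constraint zero s} {constraint zero t} eq =
  cong (constraint zero) (map-inject₁-injective (vars eq))
  where
  vars : ∀ {s t} → _≡_ {A = Constraint B₃ _} (constraint zero s) (constraint zero t) → s ≡ t
  vars refl = refl
reference-injective {c = constraint (suc zero) (x ∷ [])} {constraint (suc zero) (y ∷ [])} eq =
  cong (λ x → constraint (suc zero) (x ∷ [])) (inject₁-injective (vars eq))
  where
  vars : ∀ {x y u v} → _≡_ {A = Constraint B₃ _} (constraint (suc zero) (x ∷ u)) (constraint (suc zero) (y ∷ v)) → x ≡ y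
  vars refl = refl
reference-injective {c = constraint (suc (suc zero)) (x ∷ [])} {constraint (suc (suc zero)) (y ∷ [])} eq =
  cong (λ x → constraint (suc (suc zero)) (x ∷ [])) (inject₁-injective (vars eq))
  where
  vars : ∀ {x y u v} → _≡_ {A = Constraint B₃ _} (constraint zero (x ∷ u)) (constraint zero (y ∷ v)) → x ≡ y
  vars refl = refl
reference-injective {c = constraint zero (s ∷ t ∷ _)} {constraint (suc (suc zero)) (x ∷ [])} eq = ⊥-elim (fromℕ≢inject₁ (sym (vars eq)))
  where
  vars : ∀ {x y a b u v} → _≡_ {A = Constraint B₃ _} (constraint zero (a ∷ x ∷ u)) (constraint zero (b ∷ y ∷ v)) → x ≡ y
  vars refl = refl
reference-injective {c = constraint (suc (suc zero)) (x ∷ [])} {constraint zero (s ∷ t ∷ _)} eq = ⊥-elim (fromℕ≢inject₁ (vars eq))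
  where
  vars : ∀ {x y a b u v} → _≡_ {A = Constraint B₃ _} (constraint zero (a ∷ x ∷ u)) (constraint zero (b ∷ y ∷ v)) → x ≡ y
  vars refl = refl
reference-injective {c = constraint zero s} {constraint (suc zero) (x ∷ [])} ()
reference-injective {c = constraint (suc zero) (x ∷ [])} {constraint zero s} ()
reference-injective {c = constraint (suc zero) (x ∷ [])} {constraint (suc (suc zero)) (y ∷ [])} ()
reference-injective {c = constraint (suc (suc zero)) (x ∷ [])} {constraint (suc zero) (y ∷ [])} ()

referenceRaw : ℕ → ℕ × List ℕ → ℕ × List ℕ
referenceRaw n (R , s) =
  if R ≡ᵇ 0 then 0 , s else (if R ≡ᵇ 1 then 1 , s ++ n ∷ [] else 0 , s ++ n ∷ n ∷ n ∷ [])

referenceRaw-reference : ∀ {n} (c : Constraint B₂ n) → referenceRaw n (rawConstraint c) ≡ rawConstraint (reference c)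
referenceRaw-reference (constraint zero s) =
  cong (λ s → 0 , toList s) (trans (vmap-cong (λ i → sym (toℕ-inject₁ i)) s) (vmap-∘ toℕ inject₁ s))
referenceRaw-reference {n} (constraint (suc zero) (x ∷ []))
  rewrite toℕ-inject₁ x | toℕ-fromℕ n = refl
referenceRaw-reference {n} (constraint (suc (suc zero)) (x ∷ []))
  rewrite toℕ-inject₁ x | toℕ-fromℕ n = refl

-- Let z be the value of the new variable. EVEN⁴ is unaffected by adding z to all four places. For x
-- in {0} the constraint x + z = 0 is wanted; writing z three times fills up the arity of EVEN⁴
-- without changing the sum.
violation-reference : ∀ {n} (σ : Fin (suc n) → Bool) (c : Constraint B₂ n) →
  violation (λ i → σ (inject₁ i) xor σ (fromℕ n)) c ≡ violation σ (reference c)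
violation-reference {n} σ (constraint zero (a ∷ b ∷ c ∷ d ∷ [])) =
  solve 5 (λ a b c d z → ((a :+ z) :+ ((b :+ z) :+ ((c :+ z) :+ ((d :+ z) :+ con false)))) :+ con false
                      := (a :+ (b :+ (c :+ (d :+ con false)))) :+ con false) refl
    (σ (inject₁ a)) (σ (inject₁ b)) (σ (inject₁ c)) (σ (inject₁ d)) (σ (fromℕ n))
  where open xor-∧-Solver
violation-reference {n} σ (constraint (suc zero) (x ∷ [])) =
  solve 2 (λ x z → ((x :+ z) :+ con false) :+ con true := (x :+ (z :+ con false)) :+ con true) refl
    (σ (inject₁ x)) (σ (fromℕ n))
  where open xor-∧-Solver
violation-reference {n} σ (constraint (suc (suc zero)) (x ∷ [])) =
  solve 2 (λ x z → ((x :+ z) :+ con false) :+ con false := (x :+ (z :+ (z :+ (z :+ con false)))) :+ con false) refl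
    (σ (inject₁ x)) (σ (fromℕ n))
  where open xor-∧-Solver

MinCSP-B₂⊑B₃ : Simulation (MinCSP B₂) (MinCSP B₃)
MinCSP-B₂⊑B₃ = record
  { F = F
  ; G = λ I W → Vec.cast (len I) W
  ; F-computes = extC enc-csp enc-F (reindexC rawCSP (computes
      (⟨ sucF fstF , mapF {f = λ (y , c) → referenceRaw (proj₁ y) c} referenceRawF sndF ⟩F)))
  ; G-computes = extC (λ _ → refl) (λ (I , W) → sym (encodeBits-cast (len I) W)) (primC snd)
  ; forth = λ I W (σ , sat) →
      let W′ = Vec.cast (sym (len I)) W
          -- `nth` answers `false` beyond the end of the list, so the new variable gets the value
          -- `false`.
          σ′ = λ i → nth (toList (Vec.tabulate σ)) (toℕ i)
          agree : ∀ i → σ i ≡ σ′ (inject₁ i) xor σ′ (fromℕ (n I))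
          agree i = sym (trans (cong₂ _xor_
            (trans (cong (nth (toList (Vec.tabulate σ))) (toℕ-inject₁ i)) (nth-tabulate σ i))
            (trans (cong (nth (toList (Vec.tabulate σ))) (toℕ-fromℕ (n I))) (nth-beyond (Vec.tabulate σ))))
            (xor-identityʳ _))
      in W′ ,
        (σ′ , ≼⇒satisfied B₃-affine σ′ (map reference (𝒞 I)) W′
          (subst₂ _≼_
            (trans (map-cong (λ c → trans (violation-cong agree c) (violation-reference σ′ c)) (𝒞 I)) (map-∘ (𝒞 I)))
            (sym (toList-cast (sym (len I)) W))
            (satisfied⇒≼ B₂-affine σ (𝒞 I) W sat))) ,
        ≤-reflexive (∣∣-toList W′ W (toList-cast (sym (len I)) W))
  ; back = λ I _ W (σ , sat) → let W′ = Vec.cast (len I) W in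
      ((λ i → σ (inject₁ i) xor σ (fromℕ (n I))) ,
       ≼⇒satisfied B₂-affine _ (𝒞 I) W′
         (subst₂ _≼_
           (sym (trans (map-cong (violation-reference σ) (𝒞 I)) (map-∘ (𝒞 I))))
           (sym (toList-cast (len I) W))
           (satisfied⇒≼ B₃-affine σ (map reference (𝒞 I)) W sat))) ,
      ≤-reflexive (∣∣-toList W′ W (toList-cast (len I) W))
  }
  where
  open CSPInstance
  F : CSPInstance B₂ → CSPInstance B₃
  F I = record { n = suc (n I) ; 𝒞 = map reference (𝒞 I) ; unique = Unique.map⁺ reference-injective (unique I) }
  len : ∀ I → length (map reference (𝒞 I)) ≡ length (𝒞 I)
  len I = length-map reference (𝒞 I)
  enc-F : ∀ I → enc cspCode (suc (n I) , map (referenceRaw (n I)) (map rawConstraint (𝒞 I))) ≡ encodeInstance (MinCSP B₃) (F I)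
  enc-F I = trans (cong (λ cs → enc cspCode (suc (n I) , cs))
    (trans (sym (map-∘ (𝒞 I))) (trans (map-cong referenceRaw-reference (𝒞 I)) (map-∘ (𝒞 I))))) (enc-csp (F I))
  referenceRawF : FP {cspCode ⊠ (nat ⊠ seq nat)} {nat ⊠ seq nat} (λ (y , c) → referenceRaw (proj₁ y) c)
  referenceRawF = ifF {b = nat ⊠ seq nat} (eqF R zeroF) ⟨ zeroF , s ⟩F
    (ifF {b = nat ⊠ seq nat} (eqF R (sucF zeroF)) ⟨ sucF zeroF , ++F {b = nat} s (v ∷F []F) ⟩F
      ⟨ zeroF , ++F {b = nat} s (v ∷F v ∷F v ∷F []F) ⟩F)
    where
    R : FP {cspCode ⊠ (nat ⊠ seq nat)} {nat} (λ (y , c) → proj₁ c)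
    R = fstF ∘F sndF
    s : FP {cspCode ⊠ (nat ⊠ seq nat)} {seq nat} (λ (y , c) → proj₂ c)
    s = sndF ∘F sndF
    v : FP {cspCode ⊠ (nat ⊠ seq nat)} {nat} (λ (y , c) → proj₁ y)
    v = fstF ∘F fstF

-- From linear equations to chains of constraints of B₂

enumFrom : {A : Set} → ℕ → List A → List (ℕ × A)
enumFrom k []       = []
enumFrom k (x ∷ xs) = (k , x) ∷ enumFrom (suc k) xs

-- `indexed` is the form that a program computes, `enumFrom` the one that inductions need, with an
-- arbitrary first index.
indexed-enumFrom : ∀ {A : Set} (xs : List A) → indexed xs ≡ enumFrom 0 xs
indexed-enumFrom xs = go 0 id xs λ _ → refl
  where
  go : ∀ {A : Set} k f (xs : List A) → (∀ i → f i ≡ k + i) → zip (applyUpTo f (length xs)) xs ≡ enumFrom k xs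
  go k f []       f≗ = refl
  go k f (x ∷ xs) f≗ = cong₂ _∷_ (cong (_, x) (trans (f≗ 0) (+-identityʳ k)))
    (go (suc k) (f ∘ suc) xs (λ i → trans (f≗ (suc i)) (+-suc k i)))

length-enumFrom : ∀ {A : Set} k (xs : List A) → length (enumFrom k xs) ≡ length xs
length-enumFrom k []       = refl
length-enumFrom k (x ∷ xs) = cong suc (length-enumFrom (suc k) xs)

-- An equation r · x = b over x₀, …, xₙ₋₁ becomes constraints on n + 2 new variables:
-- z with value 0, followed by the partial sums of r · x, which are linked by EVEN⁴.
link : ℕ → ℕ × Bool → ℕ × List ℕ
link z (j , a) = 0 , suc (suc j + z) ∷ suc (j + z) ∷ (if a then j else z) ∷ z ∷ []

total : ℕ → Bool → ℕ × List ℕ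
total v b = (if b then 1 else 2) , v ∷ []

chain : ℕ → Equation → List (ℕ × List ℕ)
-- The first partial sum is set to 0 by EVEN⁴ rather than by a second {0}: if `r` is empty, `total`
-- speaks of the same variable, and with b = 0 a constraint would occur twice. A coefficient 0 keeps
-- its link, with z in place of the variable, so that all chains are equally long.
chain z (b , r) = (2 , z ∷ []) ∷ (0 , suc z ∷ z ∷ z ∷ z ∷ []) ∷
  (map (link z) (indexed r) ++ total (suc (length r + z)) b ∷ [])

-- The variables of the equations come first, then n + 2 private variables for each equation.
offset : ℕ → ℕ → ℕ
offset n i = n + i * suc (suc n)

chains : ℕ → List Equation → List (ℕ × List ℕ)
chains n es = concat (map (λ (i , e) → chain (offset n i) e) (indexed es))

offset-suc : ∀ n i → offset n (suc i) ≡ suc (suc n) + offset n i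
offset-suc n i = trans (sym (+-assoc n k (i * k))) (trans (cong (_+ i * k) (+-comm n k)) (+-assoc k n (i * k)))
  where k = suc (suc n)

violationRaw : (ℕ → Bool) → ℕ × List ℕ → Bool
violationRaw f (R , s) = xorAll (map f s) xor rhs R

violation-raw : ∀ {Γ N} (f : ℕ → Bool) (σ : Fin N → Bool) → (∀ i → f (toℕ i) ≡ σ i) →
  (c : Constraint Γ N) → violationRaw f (rawConstraint c) ≡ violation σ c
violation-raw f σ f≗σ (constraint R s) = cong (λ a → xorAll a xor rhs (toℕ R))
  (trans (sym (toList-map f (Vec.map toℕ s))) (cong toList (trans (sym (vmap-∘ f toℕ s)) (vmap-cong f≗σ s))))

-- The constraints arise as plain numbers, since a program has to write them; this evidence on
-- arities and ranges allows `typed` to turn them into constraints proper.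
data WellFormed (N : ℕ) : ℕ × List ℕ → Set where
  even : ∀ {a b c d} → a < N → b < N → c < N → d < N → WellFormed N (0 , a ∷ b ∷ c ∷ d ∷ [])
  one  : ∀ {a} → a < N → WellFormed N (1 , a ∷ [])
  zero : ∀ {a} → a < N → WellFormed N (2 , a ∷ [])

typed : ∀ {N c} → WellFormed N c → Constraint B₂ N
typed (even a b c d) = constraint zero (fromℕ< a ∷ fromℕ< b ∷ fromℕ< c ∷ fromℕ< d ∷ [])
typed (one a)        = constraint (suc zero) (fromℕ< a ∷ [])
typed (zero a)       = constraint (suc (suc zero)) (fromℕ< a ∷ [])

raw-typed : ∀ {N c} (w : WellFormed N c) → rawConstraint (typed w) ≡ c
raw-typed (even a b c d)
  rewrite toℕ-fromℕ< a | toℕ-fromℕ< b | toℕ-fromℕ< c | toℕ-fromℕ< d = refl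
raw-typed (one a)  rewrite toℕ-fromℕ< a = refl
raw-typed (zero a) rewrite toℕ-fromℕ< a = refl

raw-typed-all : ∀ {N cs} (ws : All (WellFormed N) cs) → map rawConstraint (All.reduce typed ws) ≡ cs
raw-typed-all []       = refl
raw-typed-all (w ∷ ws) = cong₂ _∷_ (raw-typed w) (raw-typed-all ws)

module _ {N n z : ℕ} (z≤ : suc (suc n) + z ≤ N) (n≤N : n ≤ N) where

  private
    z<N : z < N
    z<N = ≤-trans (≤-trans (s≤s (m≤n+m z n)) (n≤1+n _)) z≤

  links-wellFormed : ∀ k r → k + length r ≡ n → All (WellFormed N) (map (link z) (enumFrom k r))
  links-wellFormed k []      eq = []
  links-wellFormed k (a ∷ r) eq =
    even (≤-trans (s≤s (s≤s (+-monoˡ-≤ z k<n))) z≤)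
         (≤-trans (s≤s (≤-trans (+-monoˡ-≤ z k<n) (n≤1+n _))) z≤)
         (pick a) z<N
    ∷ links-wellFormed (suc k) r (trans (sym (+-suc k (length r))) eq)
    where
    k<n : k < n
    k<n = ≤-trans (m≤m+n (suc k) (length r)) (≤-reflexive (trans (sym (+-suc k (length r))) eq))
    pick : ∀ a → (if a then k else z) < N
    pick true  = ≤-trans k<n n≤N
    pick false = z<N

  chain-wellFormed : ∀ b r → length r ≡ n → All (WellFormed N) (chain z (b , r))
  chain-wellFormed b r eq = zero z<N ∷ even (≤-trans (s≤s (s≤s (m≤n+m z n))) z≤) z<N z<N z<N ∷
    All.++⁺ (subst (λ l → All (WellFormed N) (map (link z) l)) (sym (indexed-enumFrom r)) (links-wellFormed 0 r eq))
            (end b ∷ [])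
    where
    end : ∀ b → WellFormed N (total (suc (length r + z)) b)
    end true  = one  (≤-trans (s≤s (s≤s (+-monoˡ-≤ z (≤-reflexive eq)))) z≤)
    end false = zero (≤-trans (s≤s (s≤s (+-monoˡ-≤ z (≤-reflexive eq)))) z≤)

chains-wellFormed : ∀ n es → All (λ e → length (proj₂ e) ≡ n) es →
  All (WellFormed (offset n (length es))) (chains n es)
chains-wellFormed n es ls = subst (λ l → All (WellFormed N) (concat (map (λ (i , e) → chain (offset n i) e) l)))
  (sym (indexed-enumFrom es)) (All.concat⁺ (go 0 es ls refl))
  where
  N = offset n (length es)
  go : ∀ k es → All (λ e → length (proj₂ e) ≡ n) es → offset n (k + length es) ≡ N →
    All (All (WellFormed N)) (map (λ (i , e) → chain (offset n i) e) (enumFrom k es))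
  go k []             []       eq = []
  go k ((b , r) ∷ es) (l ∷ ls) eq =
    chain-wellFormed
      (subst₂ _≤_ (offset-suc n k) eq (+-monoʳ-≤ n (*-monoˡ-≤ (suc (suc n))
        (subst (suc k ≤_) (sym (+-suc k (length es))) (m≤m+n (suc k) (length es))))))
      (m≤m+n n _) b r l
    ∷ go (suc k) es ls (trans (cong (offset n) (sym (+-suc k (length es)))) eq)

-- Doubling leaves room for `total`, whose variable also comes first in the last link.
key : ℕ × List ℕ → ℕ
key (R , [])    = 0
key (R , v ∷ _) = (if R ≡ᵇ 0 then 0 else 1) + v * 2

data Increasing (lo hi : ℕ) : List (ℕ × List ℕ) → Set where
  []  : lo ≤ hi → Increasing lo hi []
  _∷_ : ∀ {c cs} → lo ≤ key c → Increasing (suc (key c)) hi cs → Increasing lo hi (c ∷ cs)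

increasing-++ : ∀ {lo mid hi cs ds} → Increasing lo mid cs → Increasing mid hi ds → Increasing lo hi (cs ++ ds)
increasing-++ ([] p)   q = weaken p q
  where
  weaken : ∀ {lo lo′ hi ds} → lo ≤ lo′ → Increasing lo′ hi ds → Increasing lo hi ds
  weaken p ([] q)  = [] (≤-trans p q)
  weaken p (q ∷ r) = ≤-trans p q ∷ r
increasing-++ (p ∷ ps) q = p ∷ increasing-++ ps q

-- Sorting by a key replaces the comparison of all pairs of constraints, within a chain and across
-- chains.
increasing-unique : ∀ {lo hi cs} → Increasing lo hi cs → Unique cs
increasing-unique ([] _)   = []
increasing-unique {cs = c ∷ _} (_ ∷ ps) = All.map (λ { k<d refl → <-irrefl refl k<d }) (above ps) ∷ increasing-unique ps
  where
  above : ∀ {lo hi cs} → Increasing lo hi cs → All (λ d → lo ≤ key d) cs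
  above ([] _)   = []
  above (p ∷ ps) = p ∷ All.map (λ q → ≤-trans p (≤-trans (n≤1+n _) q)) (above ps)

links-increasing : ∀ z k r b ℓ → ℓ ≡ length r + k →
  Increasing (suc (suc (k + z) * 2)) (suc (suc (ℓ + z)) * 2) (map (link z) (enumFrom k r) ++ total (suc (ℓ + z)) b ∷ [])
links-increasing z k []      true  .k refl = ≤-refl ∷ [] ≤-refl
links-increasing z k []      false .k refl = ≤-refl ∷ [] ≤-refl
links-increasing z k (a ∷ r) b     ℓ  eq   = n≤1+n _ ∷ links-increasing z (suc k) r b ℓ (trans eq (sym (+-suc (length r) k)))

chain-increasing : ∀ z b r → Increasing (z * 2) (suc (suc (length r + z)) * 2) (chain z (b , r))
chain-increasing z b r = n≤1+n _ ∷ ≤-refl ∷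
  subst (λ l → Increasing (suc (suc z * 2)) (suc (suc (length r + z)) * 2) (map (link z) l ++ total (suc (length r + z)) b ∷ []))
    (sym (indexed-enumFrom r))
    (links-increasing z 0 r b (length r) (sym (+-identityʳ _)))

chains-unique : ∀ n es → All (λ e → length (proj₂ e) ≡ n) es → Unique (chains n es)
chains-unique n es ls = subst (λ l → Unique (concat (map (λ (i , e) → chain (offset n i) e) l)))
  (sym (indexed-enumFrom es)) (increasing-unique (proj₂ (go 0 es ls)))
  where
  go : ∀ k es → All (λ e → length (proj₂ e) ≡ n) es →
    ∃[ hi ] Increasing (offset n k * 2) hi (concat (map (λ (i , e) → chain (offset n i) e) (enumFrom k es)))
  go k []             []         = _ , [] ≤-refl
  go k ((b , r) ∷ es) (l ∷ ls) = let hi , inc = go (suc k) es ls in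
    hi , increasing-++ (subst (λ m → Increasing (offset n k * 2) (m * 2) (chain (offset n k) (b , r)))
                          (trans (cong (λ m → suc (suc (m + offset n k))) l) (sym (offset-suc n k)))
                          (chain-increasing (offset n k) b r)) inc

≤ᵇ-intro : ∀ {a} b → (b ≡ false → a ≡ false) → a ≤ᵇ b
≤ᵇ-intro true  h = ≤ᵇ-true _
≤ᵇ-intro false h with refl ← h refl = b≤b

or-mono : ∀ {u v} → u ≼ v → or u ≤ᵇ or v
or-mono []               = b≤b
or-mono (f≤t ∷ ps)       = ≤ᵇ-true _
or-mono (b≤b {true} ∷ ps)  = b≤b
or-mono (b≤b {false} ∷ ps) = or-mono ps

or-false : ∀ u → or u ≡ false → All (_≡ false) u
or-false []          _  = []
or-false (false ∷ u) eq = refl ∷ or-false u eq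

or≤trues : ∀ u → trues (or u ∷ []) ≤ trues u
or≤trues []          = z≤n
or≤trues (false ∷ u) = or≤trues u
or≤trues (true  ∷ u) = s≤s z≤n

trues-∷ : ∀ a u → trues (a ∷ u) ≡ trues (a ∷ []) + trues u
trues-∷ false u = refl
trues-∷ true  u = refl

trues-++ : ∀ u v → trues (u ++ v) ≡ trues u + trues v
trues-++ []          v = refl
trues-++ (false ∷ u) v = trues-++ u v
trues-++ (true  ∷ u) v = cong suc (trues-++ u v)

≼-++⁻ : ∀ u {v w} → u ++ v ≼ w → u ≼ take (length u) w × v ≼ List.drop (length u) w
≼-++⁻ []      p        = [] , p
≼-++⁻ (a ∷ u) (p ∷ ps) = let q , r = ≼-++⁻ u ps in p ∷ q , r

dotFrom : (ℕ → Bool) → ℕ → List Bool → Bool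
dotFrom f k []      = false
dotFrom f k (a ∷ r) = (a ∧ f k) xor dotFrom f (suc k) r

dot-dotFrom : ∀ f r → dot r (applyUpTo f (length r)) ≡ dotFrom f 0 r
dot-dotFrom f r = go f 0 r (λ _ → refl)
  where
  go : ∀ g k r → (∀ i → g i ≡ f (k + i)) → dot r (applyUpTo g (length r)) ≡ dotFrom f k r
  go g k []      g≗ = refl
  go g k (a ∷ r) g≗ = cong₂ _xor_ (cong (a ∧_) (trans (g≗ 0) (cong f (+-identityʳ k))))
    (go (g ∘ suc) (suc k) r (λ i → trans (g≗ (suc i)) (cong f (+-suc k i))))

rhs-total : ∀ b → rhs (if b then 1 else 2) ≡ b
rhs-total true  = refl
rhs-total false = refl

module _ (f : ℕ → Bool) (z : ℕ) (fz : f z ≡ false) where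

  violation-link : ∀ j a → violationRaw f (link z (j , a)) ≡
    f (suc (suc j + z)) xor (f (suc (j + z)) xor (a ∧ f j))
  violation-link j true rewrite fz =
    solve 3 (λ s t x → (s :+ (t :+ (x :+ (con false :+ con false)))) :+ con false := s :+ (t :+ x)) refl
      (f (suc (suc j + z))) (f (suc (j + z))) (f j)
    where open xor-∧-Solver
  violation-link j false rewrite fz =
    solve 2 (λ s t → (s :+ (t :+ (con false :+ (con false :+ con false)))) :+ con false := s :+ (t :+ con false)) refl
      (f (suc (suc j + z))) (f (suc (j + z)))
    where open xor-∧-Solver

  links-sum : ∀ k r ℓ → ℓ ≡ length r + k → All (λ c → violationRaw f c ≡ false) (map (link z) (enumFrom k r)) →
    f (suc (ℓ + z)) ≡ f (suc (k + z)) xor dotFrom f k r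
  links-sum k []      .k refl []       = sym (xor-identityʳ _)
  links-sum k (a ∷ r) ℓ  eq   (v ∷ vs) =
    trans (links-sum (suc k) r ℓ (trans eq (sym (+-suc (length r) k))) vs)
      (trans (cong (_xor dotFrom f (suc k) r) (xor≡false⇒≡ {f (suc (suc k + z))} (trans (sym (violation-link k a)) v)))
        (xor-assoc (f (suc (k + z))) (a ∧ f k) (dotFrom f (suc k) r)))

-- The first two constraints make z and the initial sum 0, the links then force the true partial
-- sums, and `total` compares the last one with `b`. It is applied contrapositively: a violated
-- equation has a violated constraint in its chain.
chain-sound : ∀ f z b r → or (map (violationRaw f) (chain z (b , r))) ≡ false →
  residual (applyUpTo f (length r)) (b , r) ≡ false
chain-sound f z b r eq with All.map⁻ {xs = chain z (b , r)} (or-false (map (violationRaw f) (chain z (b , r))) eq)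
... | v₀ ∷ v₁ ∷ vs with subst (λ l → All _ (map (link z) l)) (indexed-enumFrom r) (All.++⁻ˡ (map (link z) (indexed r)) vs)
                      | All.++⁻ʳ (map (link z) (indexed r)) vs
...   | ls | v₂ ∷ [] = ≡⇒xor≡false (begin
  dot r (applyUpTo f (length r))         ≡⟨ dot-dotFrom f r ⟩
  dotFrom f 0 r                          ≡⟨ cong (_xor dotFrom f 0 r) fs ⟨
  f (suc z) xor dotFrom f 0 r            ≡⟨ links-sum f z fz 0 r (length r) (sym (+-identityʳ _)) ls ⟨
  f (suc (length r + z))                 ≡⟨ trans (sym (xor-identityʳ _)) (xor≡false⇒≡ v₂) ⟩
  rhs (if b then 1 else 2)               ≡⟨ rhs-total b ⟩
  b                                      ∎)
  where
  open ≡-Reasoning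
  open xor-∧-Solver
  fz : f z ≡ false
  fz = trans (solve 1 (λ z → z := (z :+ con false) :+ con false) refl (f z)) v₀
  fs : f (suc z) ≡ false
  fs = trans (solve 2 (λ s z → s := ((s :+ (z :+ (z :+ (z :+ con false)))) :+ con false) :+ z) refl (f (suc z)) (f z))
    (cong₂ _xor_ v₁ fz)

length-chain : ∀ z b r → length (chain z (b , r)) ≡ suc (suc (suc (length r)))
length-chain z b r = cong (2 +_) (trans (length-++ (map (link z) (indexed r)) {total (suc (length r + z)) b ∷ []})
  (trans (+-comm _ 1) (cong (1 +_) (trans (length-map _ (indexed r)) (trans (cong length (indexed-enumFrom r)) (length-enumFrom 0 r))))))

-- An equation is deleted once any constraint of its chain is. Each chain has n + 3 constraints: two
-- at the start, n links and `total`.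
blockOrs : ℕ → List (ℕ × Equation) → List Bool → List Bool
blockOrs n es W = map (λ (i , _) → or (take (3 + n) (List.drop (i * (3 + n)) W))) es

drop-block : ∀ {A : Set} K k (W : List A) → List.drop K (List.drop (k * K) W) ≡ List.drop (suc k * K) W
drop-block K k W = trans (drop-drop (k * K) K W) (cong (λ m → List.drop m W) (+-comm (k * K) K))

chains-sound : ∀ n f es W → All (λ e → length (proj₂ e) ≡ n) es →
  map (violationRaw f) (chains n es) ≼ W →
  map (residual (applyUpTo f n)) es ≼ blockOrs n (indexed es) W
chains-sound n f es W ls p = subst (λ l → map (residual (applyUpTo f n)) es ≼ blockOrs n l W) (sym (indexed-enumFrom es))
  (go 0 es ls (subst (λ l → map (violationRaw f) (concat (map (λ (i , e) → chain (offset n i) e) l)) ≼ W) (indexed-enumFrom es) p))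
  where
  go : ∀ k es → All (λ e → length (proj₂ e) ≡ n) es →
    map (violationRaw f) (concat (map (λ (i , e) → chain (offset n i) e) (enumFrom k es))) ≼ List.drop (k * (3 + n)) W →
    map (residual (applyUpTo f n)) es ≼ blockOrs n (enumFrom k es) W
  go k []             []         p = []
  go k ((b , r) ∷ es) (refl ∷ ls) p
    with first , rest ← ≼-++⁻ (map (violationRaw f) (chain (offset n k) (b , r)))
           (subst (_≼ List.drop (k * (3 + n)) W) (map-++ (violationRaw f) (chain (offset n k) (b , r)) _) p)
    rewrite length-map (violationRaw f) (chain (offset n k) (b , r)) | length-chain (offset n k) b r =
      ≤ᵇ-trans (≤ᵇ-intro _ (chain-sound f (offset n k) b r)) (or-mono first)
      ∷ go (suc k) es ls (subst (_ ≼_) (drop-block (3 + n) k W) rest)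

-- The blocks are disjoint, so every deleted equation is paid for by a deleted constraint of its
-- own.
blockOrs-trues : ∀ n (es : List Equation) W → trues (blockOrs n (indexed es) W) ≤ trues W
blockOrs-trues n es W = subst (λ l → trues (blockOrs n l W) ≤ trues W) (sym (indexed-enumFrom es)) (go 0 es)
  where
  open ≤-Reasoning
  go : ∀ k (es : List Equation) → trues (blockOrs n (enumFrom k es) W) ≤ trues (List.drop (k * (3 + n)) W)
  go k []       = z≤n
  go k (e ∷ es) = let V = List.drop (k * (3 + n)) W in begin
    trues (or (take (3 + n) V) ∷ blockOrs n (enumFrom (suc k) es) W)
      ≡⟨ trues-∷ (or (take (3 + n) V)) _ ⟩
    trues (or (take (3 + n) V) ∷ []) + trues (blockOrs n (enumFrom (suc k) es) W)
      ≤⟨ +-mono-≤ (or≤trues (take (3 + n) V)) (go (suc k) es) ⟩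
    trues (take (3 + n) V) + trues (List.drop (suc k * (3 + n)) W)
      ≡⟨ cong (λ U → trues (take (3 + n) V) + trues U) (drop-block (3 + n) k W) ⟨
    trues (take (3 + n) V) + trues (List.drop (3 + n) V)
      ≡⟨ trues-++ (take (3 + n) V) (List.drop (3 + n) V) ⟨
    trues (take (3 + n) V ++ List.drop (3 + n) V)
      ≡⟨ cong trues (take++drop≡id (3 + n) V) ⟩
    trues V ∎

partials : Bool → List Bool → List Bool → List Bool
partials s []      _       = s ∷ []
partials s (a ∷ r) []      = s ∷ partials s r []
partials s (a ∷ r) (v ∷ x) = s ∷ partials (s xor (a ∧ v)) r x

block : List Bool → Equation → List Bool
block x (b , r) = false ∷ partials false r x

drop-∷ : ∀ k L {v t} → List.drop k L ≡ v ∷ t → nth L k ≡ v × List.drop (suc k) L ≡ t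
drop-∷ zero    (v ∷ L) refl = refl , refl
drop-∷ (suc k) (_ ∷ L) eq   = drop-∷ k L eq

module _ (L : List Bool) where

  -- The assignment is the list `L`. The hypotheses on `drop` follow two positions in it, that of
  -- the current partial sum and that of the current variable, which advance together.
  links-exact : ∀ z k s r x {post post′} ℓ → ℓ ≡ length r + k → length x ≡ length r → nth L z ≡ false →
    List.drop (suc (k + z)) L ≡ partials s r x ++ post → List.drop k L ≡ x ++ post′ →
    All (λ c → violationRaw (nth L) c ≡ false) (map (link z) (enumFrom k r))
    × nth L (suc (ℓ + z)) ≡ s xor dot r x × List.drop (suc (suc (ℓ + z))) L ≡ post
  links-exact z k s []      []      .k refl _  fz at _ =
    let v , t = drop-∷ (suc (k + z)) L at in [] , trans v (sym (xor-identityʳ s)) , t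
  links-exact z k s (a ∷ r) (v ∷ x) ℓ  eq   lx fz at atx =
    let s≡ , t  = drop-∷ (suc (k + z)) L at
        v≡ , tx = drop-∷ k L atx
        vs , sum , rest = links-exact z (suc k) (s xor (a ∧ v)) r x ℓ (trans eq (sym (+-suc (length r) k)))
                            (suc-injective lx) fz t tx
        s′≡ , _ = drop-∷ (suc (suc k + z)) L (trans t (cong (_++ _) (uncons-partials (s xor (a ∧ v)) r x)))
    in trans (violation-link (nth L) z fz k a)
         (≡⇒xor≡false (trans s′≡ (sym (cong₂ _xor_ s≡ (cong (a ∧_) v≡))))) ∷ vs ,
       trans sum (xor-assoc s (a ∧ v) (dot r x)) , rest
    where
    uncons-partials : ∀ s r x → partials s r x ≡ s ∷ List.drop 1 (partials s r x)
    uncons-partials s []      x       = refl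
    uncons-partials s (a ∷ r) []      = refl
    uncons-partials s (a ∷ r) (v ∷ x) = refl

  trues-false : ∀ cs → All (λ c → violationRaw (nth L) c ≡ false) cs → trues (map (violationRaw (nth L)) cs) ≡ 0
  trues-false []       []       = refl
  trues-false (c ∷ cs) (v ∷ vs) rewrite v = trues-false cs vs

  -- With the true partial sums only `total` can fail, and it does so exactly if the equation fails.
  -- A violated equation therefore costs a single constraint.
  chain-exact : ∀ z x b r {post post′} → length x ≡ length r →
    List.drop z L ≡ block x (b , r) ++ post → L ≡ x ++ post′ →
    trues (map (violationRaw (nth L)) (chain z (b , r))) ≡ trues (residual x (b , r) ∷ [])
    × List.drop (suc (suc (length r + z))) L ≡ post
  chain-exact z x b r lx at atx with drop-∷ z L at
  ... | fz , t with drop-∷ (suc z) L (trans t (cong (_++ _) (first r x))) | links-exact z 0 false r x (length r) (sym (+-identityʳ _)) lx fz t atx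
    where
    first : ∀ r x → partials false r x ≡ false ∷ List.drop 1 (partials false r x)
    first []      x       = refl
    first (a ∷ r) []      = refl
    first (a ∷ r) (v ∷ x) = refl
  ...   | fs , _ | vs , sum , rest = trues≡ , rest
    where
    f = violationRaw (nth L)
    ls = map (link z) (indexed r)
    e = total (suc (length r + z)) b
    trues≡ : trues (map f (chain z (b , r))) ≡ trues (residual x (b , r) ∷ [])
    trues≡ rewrite fz | fs | map-++ f ls (e ∷ []) | trues-++ (map f ls) (f e ∷ [])
      | trues-false ls (subst (λ l → All _ (map (link z) l)) (sym (indexed-enumFrom r)) vs)
      | sum | rhs-total b | xor-identityʳ (dot r x) = refl

  chains-exact : ∀ n x es {post} → length x ≡ n → All (λ e → length (proj₂ e) ≡ n) es →
    L ≡ x ++ post → post ≡ concat (map (block x) es) →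
    trues (map (violationRaw (nth L)) (chains n es)) ≡ trues (map (residual x) es)
  chains-exact n x es lx ls L≡ refl = trans
    (cong (λ l → trues (map (violationRaw (nth L)) (concat (map (λ (i , e) → chain (offset n i) e) l)))) (indexed-enumFrom es))
    (go 0 es ls (start lx L≡))
    where
    start : ∀ {n post} {x L : List Bool} → length x ≡ n → L ≡ x ++ post → List.drop (offset n 0) L ≡ post
    start {n} {post} {x} refl refl = trans (cong (λ m → List.drop m (x ++ post)) (+-identityʳ (length x))) (skip-prefix x)
      where
      skip-prefix : ∀ (x : List Bool) → List.drop (length x) (x ++ post) ≡ post
      skip-prefix []      = refl
      skip-prefix (_ ∷ x) = skip-prefix x
    go : ∀ k es → All (λ e → length (proj₂ e) ≡ n) es → List.drop (offset n k) L ≡ concat (map (block x) es) →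
      trues (map (violationRaw (nth L)) (concat (map (λ (i , e) → chain (offset n i) e) (enumFrom k es)))) ≡ trues (map (residual x) es)
    go k []             []         at = refl
    go k ((b , r) ∷ es) (lr ∷ ls) at =
      let first , rest = chain-exact (offset n k) x b r (trans lx (sym lr)) at L≡
          more = go (suc k) es ls (trans (cong (λ m → List.drop m L)
            (trans (offset-suc n k) (cong (λ l → suc (suc (l + offset n k))) (sym lr)))) rest)
      in trans (cong trues (map-++ (violationRaw (nth L)) (chain (offset n k) (b , r)) _))
         (trans (trues-++ (map (violationRaw (nth L)) (chain (offset n k) (b , r))) _)
         (trans (cong₂ _+_ first more) (sym (trues-∷ (residual x (b , r)) (map (residual x) es)))))

linCode : Code
linCode = nat ⊠ seq (bool ⊠ seq bool)

module _ {a : Code} where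

  offsetF : ∀ {n i} → FP {a} {nat} n → FP {a} {nat} i → FP {a} {nat} (λ x → offset (n x) (i x))
  offsetF N I = addF N (mulF I (sucF (sucF N)))

  chainF : ∀ {z e} → FP {a} {nat} z → FP {a} {bool ⊠ seq bool} e → FP {a} {seq (nat ⊠ seq nat)} (λ x → chain (z x) (e x))
  chainF {z} {e} Z E =
    ⟨ sucF (sucF zeroF) , Z ∷F []F ⟩F ∷F
    ⟨ zeroF , sucF Z ∷F Z ∷F Z ∷F Z ∷F []F ⟩F ∷F
    ++F {b = nat ⊠ seq nat} (mapF {b = nat ⊠ bool} {f = λ (x , j) → link (z x) j} linkF (indexedF {b = bool} (sndF ∘F E)))
        (⟨ ifF {b = nat} (fstF ∘F E) (sucF zeroF) (sucF (sucF zeroF)) , sucF (addF (lengthF {b = bool} (sndF ∘F E)) Z) ∷F []F ⟩F ∷F []F)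
    where
    linkF : FP {a ⊠ nat ⊠ bool} {nat ⊠ seq nat} (λ (x , j) → link (z x) j)
    linkF = ⟨ zeroF , sucF (addF (sucF j) Z′) ∷F sucF (addF j Z′) ∷F ifF {b = nat} (sndF ∘F sndF) j Z′ ∷F Z′ ∷F []F ⟩F
      where
      j : FP {a ⊠ nat ⊠ bool} {nat} (λ (x , j) → proj₁ j)
      j = fstF ∘F sndF
      Z′ : FP {a ⊠ nat ⊠ bool} {nat} (λ (x , j) → z x)
      Z′ = Z ∘F fstF

MinLin⊑MinCSP-B₂ : Simulation MinLin (MinCSP B₂)
MinLin⊑MinCSP-B₂ = record
  { F = F
  ; G = λ I W → fit (length (equations I)) (G I (toList W))
  ; F-computes = extC (λ _ → refl) enc-F (reindexC (λ I → n I , equations I) (computes chainsF))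
  ; G-computes = extC {i = λ (I , W) → enc (linCode ⊠ seq bool) ((n I , equations I) , toList W)}
      (λ (I , W) → cong (enc linCode (n I , equations I) ,_) (enc-bits W))
      (λ (I , W) → trans (cong (enc (seq bool)) (sym (toList-fit _ _ (length-G I (toList W)))))
        (enc-bits (fit (length (equations I)) (G I (toList W)))))
      (reindexC (λ (I , W) → (n I , equations I) , toList W) (computes orsF))
  ; forth = λ I W (x , p) →
      let x′ = toList (fit (n I) x)
          L = x′ ++ concat (map (block x′) (equations I))
          σ = λ i → nth L (toℕ i)
          vs = map (violation σ) (𝒞 (F I))
          vs≡ = violations I (nth L) σ (λ _ → refl)
          -- Just the violated constraints are deleted; `W` enters only through the comparison of
          -- costs.
          W′ = fit (length (𝒞 (F I))) vs
          W′≡ = toList-fit _ vs (length-map _ (𝒞 (F I)))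
      in W′ , (σ , ≼⇒satisfied B₂-affine σ (𝒞 (F I)) W′ (≼-reflexive (sym W′≡))) ,
        (begin
          ∣ W′ ∣
            ≡⟨ trans (∣∣-trues W′) (cong trues W′≡) ⟩
          trues vs
            ≡⟨ cong trues vs≡ ⟨
          trues (map (violationRaw (nth L)) (chains (n I) (equations I)))
            ≡⟨ chains-exact L (n I) x′ (equations I) (length-toList (fit (n I) x)) (lengths I) refl refl ⟩
          trues (map (residual x′) (equations I))
            ≡⟨ cong trues (residuals-fit (n I) x (equations I) (lengths I)) ⟩
          trues (map (residual x) (equations I))
            ≤⟨ trues-mono p ⟩
          trues (toList W)
            ≡⟨ ∣∣-trues W ⟨
          ∣ W ∣ ∎)
  ; back = λ I _ W (σ , sat) →
      let f = nth (toList (Vec.tabulate σ))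
          W≡ = toList-fit _ _ (length-G I (toList W))
      in (applyUpTo f (n I) ,
          subst (map (residual (applyUpTo f (n I))) (equations I) ≼_) (sym W≡)
            (chains-sound (n I) f (equations I) (toList W) (lengths I)
              (subst (_≼ toList W) (sym (violations I f σ (nth-tabulate σ))) (satisfied⇒≼ B₂-affine σ (𝒞 (F I)) W sat)))) ,
        (begin
          ∣ fit (length (equations I)) (G I (toList W)) ∣
            ≡⟨ trans (∣∣-trues (fit (length (equations I)) (G I (toList W)))) (cong trues W≡) ⟩
          trues (G I (toList W))
            ≤⟨ blockOrs-trues (n I) (equations I) (toList W) ⟩
          trues (toList W)
            ≡⟨ ∣∣-trues W ⟨
          ∣ W ∣ ∎)
  }
  where
  open ≤-Reasoning
  open LinInstance
  open CSPInstance using (𝒞)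
  wf : ∀ I → All (WellFormed (offset (n I) (length (equations I)))) (chains (n I) (equations I))
  wf I = chains-wellFormed (n I) (equations I) (lengths I)
  F : LinInstance → CSPInstance B₂
  F I = record
    { n = offset (n I) (length (equations I))
    ; 𝒞 = All.reduce typed (wf I)
    ; unique = Unique.map⁻ (subst Unique (sym (raw-typed-all (wf I))) (chains-unique (n I) (equations I) (lengths I))) }
  G : (I : LinInstance) → List Bool → List Bool
  G I W = blockOrs (n I) (indexed (equations I)) W
  length-G : ∀ I W → length (G I W) ≡ length (equations I)
  length-G I W = trans (length-map _ (indexed (equations I)))
    (trans (cong length (indexed-enumFrom (equations I))) (length-enumFrom 0 (equations I)))
  violations : ∀ I f σ → (∀ i → f (toℕ i) ≡ σ i) →
    map (violationRaw f) (chains (n I) (equations I)) ≡ map (violation σ) (𝒞 (F I))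
  violations I f σ f≗σ = trans (cong (map (violationRaw f)) (sym (raw-typed-all (wf I))))
    (trans (sym (map-∘ (𝒞 (F I)))) (map-cong (violation-raw f σ f≗σ) (𝒞 (F I))))
  enc-F : ∀ I → enc cspCode (offset (n I) (length (equations I)) , chains (n I) (equations I)) ≡ encodeInstance (MinCSP B₂) (F I)
  enc-F I = trans (cong (λ cs → enc cspCode (offset (n I) (length (equations I)) , cs)) (sym (raw-typed-all (wf I)))) (enc-csp (F I))
  chainsF : FP {linCode} {cspCode} (λ (n , es) → offset n (length es) , chains n es)
  chainsF = ⟨ offsetF fstF (lengthF {b = bool ⊠ seq bool} sndF) ,
    concatF {b = nat ⊠ seq nat} (mapF {b = nat ⊠ bool ⊠ seq bool} {f = λ ((n , _) , (i , e)) → chain (offset n i) e}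
      (chainF (offsetF (fstF ∘F fstF) (fstF ∘F sndF)) (sndF ∘F sndF)) (indexedF {b = bool ⊠ seq bool} sndF)) ⟩F
  orsF : FP {linCode ⊠ seq bool} {seq bool} (λ ((n , es) , W) → blockOrs n (indexed es) W)
  orsF = mapF {b = nat ⊠ bool ⊠ seq bool} {f = λ (((n , _) , W) , (i , _)) → or (take (3 + n) (List.drop (i * (3 + n)) W))}
    (orF (takeF {b = bool} K (listDropF {b = bool} (mulF (fstF ∘F sndF) K) (sndF ∘F fstF)))) (indexedF {b = bool ⊠ seq bool} (sndF ∘F fstF))
    where
    K : FP {(linCode ⊠ seq bool) ⊠ (nat ⊠ bool ⊠ seq bool)} {nat} (λ (((n , _) , _) , _) → 3 + n)
    K = sucF (sucF (sucF (fstF ∘F fstF ∘F fstF)))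

-- Gaussian elimination

Rows : Set
Rows = List (List Bool)

-- Systems are homogeneous, with an unknown of value 1 for the constants.  The pivot, a list of
-- length at most one, is the rest p of a row true ∷ p: the leading unknown is p · z.
splitStep : Rows × Rows → List Bool → Rows × Rows
splitStep (pivot , others) row = caseList row (pivot , others) λ h t →
  if h then caseList pivot (t ∷ [] , others) (λ p _ → pivot , zipWith _xor_ t p ∷ others)
       else (pivot , t ∷ others)

split : Rows → Rows × Rows
split = foldl splitStep ([] , [])

-- The pivot of the unknown eliminated last ends on top of the stack, so back substitution is a left
-- fold over it.
elimStep : Rows × List Rows → Rows × List Rows
elimStep (rows , stack) = proj₂ (split rows) , proj₁ (split rows) ∷ stack

elimLoop : ℕ → Rows × List Rows → Rows × List Rows
elimLoop n s = foldl (λ s _ → elimStep s) s (replicate n tt)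

eliminate : ℕ → Rows → Rows × List Rows
eliminate n rows = elimLoop n (rows , [])

sz-zipXor : ∀ t p → sz (seq bool) (zipWith _xor_ t p) ≤ sz (seq bool) t
sz-zipXor []      p       = ≤-refl
sz-zipXor (a ∷ t) []      = s≤s z≤n
sz-zipXor (a ∷ t) (b ∷ p) =
  s≤s (+-mono-≤ (≤-reflexive (trans (sz-bool (a xor b)) (sym (sz-bool a)))) (sz-zipXor t p))

sz-bools : ∀ u → sz (seq bool) u ≡ 1 + length u * 3
sz-bools []      = refl
sz-bools (a ∷ u) rewrite sz-bool a = cong (3 +_) (sz-bools u)

rowsCode : Code
rowsCode = seq (seq bool)

sz-splitStep : ∀ s row → sz (rowsCode ⊠ rowsCode) (splitStep s row) ≤ sz (rowsCode ⊠ rowsCode) s + sz (seq bool) row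
sz-splitStep (pv , o)       []          = m≤m+n _ _
sz-splitStep (pv , o)       (false ∷ t) = ≤-by 2 (arith (sz rowsCode pv) (sz rowsCode o) (sz (seq bool) t))
  where
  arith : ∀ p o t → suc (p + suc (t + o)) + 2 ≡ suc (p + o) + suc (2 + t)
  arith = solve-∀
sz-splitStep ([] , o)       (true ∷ t)  = ≤-by 2 (arith (sz rowsCode o) (sz (seq bool) t))
  where
  arith : ∀ o t → suc (suc (t + 1) + o) + 2 ≡ suc (1 + o) + suc (2 + t)
  arith = solve-∀
sz-splitStep (p ∷ ps , o)   (true ∷ t)  = ≤-trans
  (s≤s (+-monoʳ-≤ (sz rowsCode (p ∷ ps)) (s≤s (+-monoˡ-≤ (sz rowsCode o) (sz-zipXor t p)))))
  (≤-by 2 (arith (sz rowsCode (p ∷ ps)) (sz rowsCode o) (sz (seq bool) t)))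
  where
  arith : ∀ p o t → suc (p + suc (t + o)) + 2 ≡ suc (p + o) + suc (2 + t)
  arith = solve-∀

sz-split : ∀ rows → sz (rowsCode ⊠ rowsCode) (split rows) ≤ 3 + sz rowsCode rows
sz-split = go ([] , [])
  where
  go : ∀ s rows → sz (rowsCode ⊠ rowsCode) (foldl splitStep s rows) ≤ sz (rowsCode ⊠ rowsCode) s + sz rowsCode rows
  go s []           = m≤m+n _ _
  go s (row ∷ rows) = ≤-trans (go (splitStep s row) rows) (≤-trans (+-monoˡ-≤ (sz rowsCode rows) (sz-splitStep s row))
    (≤-by 1 (arith (sz (rowsCode ⊠ rowsCode) s) (sz (seq bool) row) (sz rowsCode rows))))
    where
    arith : ∀ s r rs → s + r + rs + 1 ≡ s + suc (r + rs)
    arith = solve-∀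

-- Rows are moved, not copied: each one loses its leading entry and goes either to the stack or to
-- the rest, and adding the pivot does not lengthen it. Hence system and stack together grow by a
-- constant.
sz-elimStep : ∀ s → sz (rowsCode ⊠ seq rowsCode) (elimStep s) ≤ sz (rowsCode ⊠ seq rowsCode) s + 3
sz-elimStep (rows , st) = begin
  suc (o + suc (pv + stack))        ≡⟨ arith₁ o pv stack ⟩
  suc (pv + o) + suc stack          ≤⟨ +-monoˡ-≤ (suc stack) (sz-split rows) ⟩
  3 + sz rowsCode rows + suc stack  ≡⟨ arith₂ (sz rowsCode rows) stack ⟩
  suc (sz rowsCode rows + stack) + 3 ∎
  where
  open ≤-Reasoning
  o = sz rowsCode (proj₂ (split rows)) ; pv = sz rowsCode (proj₁ (split rows)) ; stack = sz (seq rowsCode) st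
  arith₁ : ∀ o p s → suc (o + suc (p + s)) ≡ suc (p + o) + suc s
  arith₁ = solve-∀
  arith₂ : ∀ r s → 3 + r + suc s ≡ suc (r + s) + 3
  arith₂ = solve-∀

module _ {a : Code} where

  splitF : ∀ {f} → FP {a} {rowsCode} f → FP {a} {rowsCode ⊠ rowsCode} (λ x → split (f x))
  splitF P = foldF {d = rowsCode ⊠ rowsCode} {step = λ ((x , s) , row) → splitStep s row} stepF ⟨ []F , []F ⟩F P var
    λ x s row → ≤-trans (sz-splitStep s row) (+-monoʳ-≤ (sz (rowsCode ⊠ rowsCode) s) (m≤n+m _ (sz a x)))
    where
    stepF : FP {(a ⊠ rowsCode ⊠ rowsCode) ⊠ seq bool} {rowsCode ⊠ rowsCode} (λ ((x , s) , row) → splitStep s row)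
    stepF = caseF {b = bool} {d = rowsCode ⊠ rowsCode} sndF (sndF ∘F fstF)
      (ifF {b = rowsCode ⊠ rowsCode} (fstF ∘F sndF)
        (caseF {b = seq bool} {d = rowsCode ⊠ rowsCode} pv ⟨ t ∷F []F , o ⟩F
          ⟨ pv ∘F fstF , zipXorF (t ∘F fstF) (fstF ∘F sndF) ∷F o ∘F fstF ⟩F)
        ⟨ pv , t ∷F o ⟩F)
      where
      E = ((a ⊠ rowsCode ⊠ rowsCode) ⊠ seq bool) ⊠ bool ⊠ seq bool
      pv : FP {E} {rowsCode} (λ (((x , s) , row) , h , t) → proj₁ s)
      pv = fstF ∘F sndF ∘F fstF ∘F fstF
      o : FP {E} {rowsCode} (λ (((x , s) , row) , h , t) → proj₂ s)
      o = sndF ∘F sndF ∘F fstF ∘F fstF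
      t : FP {E} {seq bool} (λ (((x , s) , row) , h , t) → t)
      t = sndF ∘F sndF

module _ {a : Code} where

  eliminateF : ∀ {n f} → FP {a} {nat} n → FP {a} {rowsCode} f →
    FP {a} {rowsCode ⊠ seq rowsCode} (λ x → eliminate (n x) (f x))
  eliminateF N P = foldF {d = rowsCode ⊠ seq rowsCode} {step = λ ((x , s) , _) → elimStep s}
    ⟨ sndF ∘F splitF rows , (fstF ∘F splitF rows) ∷F sndF ∘F sndF ∘F fstF ⟩F ⟨ P , []F ⟩F (ticksF N) (con 3)
    λ x s _ → sz-elimStep s
    where
    rows : FP {(a ⊠ rowsCode ⊠ seq rowsCode) ⊠ unit} {rowsCode} (λ ((x , s) , _) → proj₁ s)
    rows = fstF ∘F sndF ∘F fstF

-- Solutions are parametrised affinely: an unknown is a form (c ∷ u) with value c + u · p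
-- at the parameters p, that is dot (c ∷ u) (true ∷ p).
unitForm : ℕ → ℕ → List Bool
unitForm N i = indicator N (i ∷ [])

combine : ℕ → List Bool → Rows → List Bool
combine N p Φ = foldl (λ s (c , φ) → if c then zipWith _xor_ s φ else s) (replicate N false) (zip p Φ)

-- Back substitution on forms: `Φ` holds the forms of the later unknowns and, at its end, of the
-- constant. A free unknown becomes the parameter with its own position as index. Determined
-- unknowns leave their parameter idle, which saves counting the free ones.
formStep : ℕ → Rows → Rows → Rows
formStep N Φ pivot = caseList pivot (unitForm N (length Φ)) (λ p _ → combine N p Φ) ∷ Φ

forms : ℕ → List Rows → Rows
forms N stack = foldl (formStep N) (unitForm N 0 ∷ []) stack

solutionForms : ℕ → Rows → Rows
-- The form cut off at the end is that of the constant 1.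
solutionForms n rows = take n (forms (suc n) (proj₂ (eliminate n rows)))

length-combine : ∀ N p Φ → All (λ φ → length φ ≡ N) Φ → length (combine N p Φ) ≡ N
length-combine N p Φ ls = go p Φ (replicate N false) ls (length-replicate N)
  where
  go : ∀ p Φ s → All (λ φ → length φ ≡ N) Φ → length s ≡ N →
    length (foldl (λ s (c , φ) → if c then zipWith _xor_ s φ else s) s (zip p Φ)) ≡ N
  go []          Φ       s ls       l = l
  go (_ ∷ p)     []      s ls       l = l
  go (false ∷ p) (φ ∷ Φ) s (_ ∷ ls) l = go p Φ s ls l
  go (true ∷ p)  (φ ∷ Φ) s (k ∷ ls) l =
    go p Φ (zipWith _xor_ s φ) ls (trans (length-zipWith _xor_ s φ) (trans (cong₂ _⊓_ l k) (⊓-idem N)))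

sz-combine : ∀ N p Φ → sz (seq bool) (combine N p Φ) ≤ 1 + N * 3
sz-combine N p Φ = go p Φ (replicate N false)
  (≤-reflexive (trans (sz-bools (replicate N false)) (cong (λ l → 1 + l * 3) (length-replicate N))))
  where
  go : ∀ p Φ s → sz (seq bool) s ≤ 1 + N * 3 →
    sz (seq bool) (foldl (λ s (c , φ) → if c then zipWith _xor_ s φ else s) s (zip p Φ)) ≤ 1 + N * 3
  go []          Φ       s l = l
  go (_ ∷ p)     []      s l = l
  go (false ∷ p) (φ ∷ Φ) s l = go p Φ s l
  go (true ∷ p)  (φ ∷ Φ) s l = go p Φ (zipWith _xor_ s φ) (≤-trans (sz-zipXor s φ) l)

sz-formStep : ∀ N Φ pv → sz rowsCode (formStep N Φ pv) ≤ sz rowsCode Φ + (2 + N * 3)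
sz-formStep N Φ pv = ≤-trans (s≤s (+-monoˡ-≤ (sz rowsCode Φ) (new pv))) (≤-reflexive (+-comm (2 + N * 3) _))
  where
  new : ∀ pv → sz (seq bool) (caseList pv (unitForm N (length Φ)) (λ p _ → combine N p Φ)) ≤ 1 + N * 3
  new []      = ≤-reflexive (trans (sz-bools (unitForm N (length Φ))) (cong (λ l → 1 + l * 3) (length-indicator N (length Φ ∷ []))))
  new (p ∷ _) = sz-combine N p Φ

module _ {a : Code} where

  combineF : ∀ {N p Φ} → FP {a} {nat} N → FP {a} {seq bool} p → FP {a} {rowsCode} Φ →
    FP {a} {seq bool} (λ x → combine (N x) (p x) (Φ x))
  combineF N P Φ = foldF {d = seq bool} {step = λ ((x , s) , (c , φ)) → if c then zipWith _xor_ s φ else s}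
    (ifF {b = seq bool} (fstF ∘F sndF) (zipXorF (sndF ∘F fstF) (sndF ∘F sndF)) (sndF ∘F fstF))
    (replicateF {b = bool} N falseF) (zipF {b = bool} {d = seq bool} P Φ) (con 0) (λ x s y → grow s y)
    where
    grow : ∀ s (y : Bool × List Bool) → sz (seq bool) (if proj₁ y then zipWith _xor_ s (proj₂ y) else s) ≤ sz (seq bool) s + 0
    grow s (false , φ) = m≤m+n _ 0
    grow s (true  , φ) = ≤-trans (sz-zipXor s φ) (m≤m+n _ 0)

module _ {a : Code} where

  formsF : ∀ {N st} → FP {a} {nat} N → FP {a} {seq rowsCode} st → FP {a} {rowsCode} (λ x → forms (N x) (st x))
  formsF {N} {st} P S = foldF {d = rowsCode} {step = λ ((x , Φ) , pv) → formStep (N x) Φ pv} stepF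
    (indicatorF P (zeroF ∷F []F) ∷F []F) S (con 2 +ₚ size-bound P *ₚ con 3)
    λ x Φ pv → ≤-trans (sz-formStep (N x) Φ pv) (+-monoʳ-≤ (sz rowsCode Φ) (+-monoʳ-≤ 2 (*-monoˡ-≤ 3
      (≤-trans (N≤ (N x)) (≤-trans (output-bounded P x) (eval-mono (size-bound P) (m≤m+n (sz a x) _)))))))
    where
    N≤ : ∀ n → n ≤ sz nat n
    N≤ n = subst (n ≤_) (sym (sz-nat n)) (≤-trans (m≤m*n n 2) (n≤1+n _))
    stepF : FP {(a ⊠ rowsCode) ⊠ rowsCode} {rowsCode} (λ ((x , Φ) , pv) → formStep (N x) Φ pv)
    stepF = caseF {b = seq bool} {d = seq bool} sndF
        (indicatorF (P ∘F fstF ∘F fstF) (lengthF {b = seq bool} (sndF ∘F fstF) ∷F []F))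
        (combineF (P ∘F fstF ∘F fstF ∘F fstF) (fstF ∘F sndF) (sndF ∘F fstF ∘F fstF))
      ∷F sndF ∘F fstF

  solutionFormsF : ∀ {n f} → FP {a} {nat} n → FP {a} {rowsCode} f → FP {a} {rowsCode} (λ x → solutionForms (n x) (f x))
  solutionFormsF N P = takeF {b = seq bool} N (formsF (sucF N) (sndF ∘F eliminateF N P))

-- Correctness of elimination and of the parametrisation

Satisfied : List Bool → Rows → Set
Satisfied z = All (λ r → dot r z ≡ false)

HasLength : ℕ → Rows → Set
HasLength k = All (λ r → length r ≡ k)

dot-zipXor : ∀ t p z → length t ≡ length p → dot (zipWith _xor_ t p) z ≡ dot t z xor dot p z
dot-zipXor []      []      z       eq = refl
dot-zipXor (a ∷ t) (b ∷ p) []      eq = refl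
dot-zipXor (a ∷ t) (b ∷ p) (c ∷ z) eq = trans (cong (((a xor b) ∧ c) xor_) (dot-zipXor t p z (suc-injective eq)))
  (solve 5 (λ a b c d e → ((a :+ b) :* c) :+ (d :+ e) := ((a :* c) :+ d) :+ ((b :* c) :+ e)) refl a b c (dot t z) (dot p z))
  where open xor-∧-Solver

SplitSatisfied : Bool → List Bool → Rows × Rows → Set
SplitSatisfied v z (pivot , others) = All (λ p → dot p z ≡ v) pivot × Satisfied z others

SplitHasLength : ℕ → Rows × Rows → Set
SplitHasLength k (pivot , others) = HasLength k pivot × HasLength k others

splitStep-length : ∀ {k} s row → SplitHasLength k s → length row ≡ suc k → SplitHasLength k (splitStep s row)
splitStep-length (pv , o)     (false ∷ t) (lp , lo)     l = lp , suc-injective l ∷ lo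
splitStep-length ([] , o)     (true ∷ t)  (lp , lo)     l = suc-injective l ∷ [] , lo
splitStep-length (p ∷ _ , o)  (true ∷ t)  (l′ ∷ ls , lo) l =
  l′ ∷ ls , trans (length-zipWith _xor_ t p) (trans (cong₂ _⊓_ (suc-injective l) l′) (⊓-idem _)) ∷ lo

splitStep-satisfied⁺ : ∀ {k v z} s row → SplitHasLength k s → length row ≡ suc k →
  SplitSatisfied v z s → dot row (v ∷ z) ≡ false → SplitSatisfied v z (splitStep s row)
splitStep-satisfied⁺ (pv , o)    (false ∷ t) lens l (ps , os) eq = ps , eq ∷ os
splitStep-satisfied⁺ ([] , o)    (true ∷ t)  lens l (ps , os) eq = sym (xor≡false⇒≡ eq) ∷ [] , os
splitStep-satisfied⁺ {z = z} (p ∷ _ , o) (true ∷ t) (l′ ∷ _ , _) l (p≡ ∷ ps , os) eq =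
  p≡ ∷ ps , trans (dot-zipXor t p z (trans (suc-injective l) (sym l′)))
    (≡⇒xor≡false (trans (sym (xor≡false⇒≡ eq)) (sym p≡))) ∷ os

-- Adding the pivot is reversible, so a row can be recovered from what the step made of it.
splitStep-satisfied⁻ : ∀ {k v z} s row → SplitHasLength k s → length row ≡ suc k →
  SplitSatisfied v z (splitStep s row) → SplitSatisfied v z s × dot row (v ∷ z) ≡ false
splitStep-satisfied⁻ (pv , o)    (false ∷ t) lens l (ps , eq ∷ os) = (ps , os) , eq
splitStep-satisfied⁻ ([] , o)    (true ∷ t)  lens l (eq ∷ [] , os) = ([] , os) , ≡⇒xor≡false (sym eq)
splitStep-satisfied⁻ {z = z} (p ∷ _ , o) (true ∷ t) (l′ ∷ _ , _) l (p≡ ∷ ps , eq ∷ os) =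
  (p≡ ∷ ps , os) , ≡⇒xor≡false (trans (sym p≡) 
    (sym (xor≡false⇒≡ (trans (sym (dot-zipXor t p z (trans (suc-injective l) (sym l′)))) eq))))

split-length : ∀ {k} rows → HasLength (suc k) rows → SplitHasLength k (split rows)
split-length rows = go _ rows ([] , [])
  where
  go : ∀ {k} s rows → SplitHasLength k s → HasLength (suc k) rows → SplitHasLength k (foldl splitStep s rows)
  go s []           ls []       = ls
  go s (row ∷ rows) ls (l ∷ lr) = go _ rows (splitStep-length s row ls l) lr

split-satisfied⁺ : ∀ {k v z} rows → HasLength (suc k) rows → Satisfied (v ∷ z) rows → SplitSatisfied v z (split rows)
split-satisfied⁺ rows = go _ rows ([] , []) ([] , [])
  where
  go : ∀ {k v z} s rows → SplitHasLength k s → SplitSatisfied v z s → HasLength (suc k) rows → Satisfied (v ∷ z) rows →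
    SplitSatisfied v z (foldl splitStep s rows)
  go s []           ls sat []       []       = sat
  go s (row ∷ rows) ls sat (l ∷ lr) (e ∷ es) =
    go _ rows (splitStep-length s row ls l) (splitStep-satisfied⁺ s row ls l sat e) lr es

split-satisfied⁻ : ∀ {k v z} rows → HasLength (suc k) rows → SplitSatisfied v z (split rows) → Satisfied (v ∷ z) rows
split-satisfied⁻ rows lr sat = proj₂ (go _ rows ([] , []) lr sat)
  where
  go : ∀ {k v z} s rows → SplitHasLength k s → HasLength (suc k) rows → SplitSatisfied v z (foldl splitStep s rows) →
    SplitSatisfied v z s × Satisfied (v ∷ z) rows
  go s []           ls []       sat = sat , []
  go s (row ∷ rows) ls (l ∷ lr) sat =
    let sat′ , es = go _ rows (splitStep-length s row ls l) lr sat
        sat″ , e = splitStep-satisfied⁻ s row ls l sat′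
    in sat″ , e ∷ es

-- Free unknowns are read off P, indexed from the last unknown on.
backStep : List Bool → List Bool → Rows → List Bool
backStep P z pivot = caseList pivot (nth P (length z)) (λ p _ → dot p z) ∷ z

data AtMostOne : Rows → Set where
  none : AtMostOne []
  one  : ∀ {p} → AtMostOne (p ∷ [])

split-atMostOne : ∀ rows → AtMostOne (proj₁ (split rows))
split-atMostOne rows = go ([] , []) rows none
  where
  step : ∀ s row → AtMostOne (proj₁ s) → AtMostOne (proj₁ (splitStep s row))
  step s           []          h = h
  step s           (false ∷ t) h = h
  step ([] , o)    (true ∷ t)  h = one
  step (p ∷ _ , o) (true ∷ t)  h = h
  go : ∀ s rows → AtMostOne (proj₁ s) → AtMostOne (proj₁ (foldl splitStep s rows))
  go s []           h = h
  go s (row ∷ rows) h = go _ rows (step s row h)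

-- With a pivot the new value is the one it forces; without one no row contains the leading unknown,
-- and whatever `P` says is correct.
backStep-satisfied : ∀ {k} P z rows → HasLength (suc k) rows → Satisfied z (proj₂ (split rows)) →
  Satisfied (backStep P z (proj₁ (split rows))) rows
backStep-satisfied P z rows ls sat = split-satisfied⁻ rows ls (pivots (split-atMostOne rows) , sat)
  where
  pivots : ∀ {pv} → AtMostOne pv → All (λ p → dot p z ≡ caseList pv (nth P (length z)) (λ p _ → dot p z)) pv
  pivots none = []
  pivots one  = refl ∷ []

eliminated-length : ∀ k {m} rows st → HasLength (k + m) rows → HasLength m (proj₁ (elimLoop k (rows , st)))
eliminated-length zero    rows st ls = ls
eliminated-length (suc k) rows st ls = eliminated-length k _ _ (proj₂ (split-length rows ls))

-- Holds for every choice `P` of the free unknowns. The last component compares two folds, over the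
-- final and over the initial stack, so that the induction can pass pivots pushed earlier.
elimination-sound : ∀ k {m} P z rows st → HasLength (k + m) rows → Satisfied z (proj₁ (elimLoop k (rows , st))) →
  ∃[ x ] length x ≡ k × Satisfied (x ++ z) rows
       × foldl (backStep P) z (proj₂ (elimLoop k (rows , st))) ≡ foldl (backStep P) (x ++ z) st
elimination-sound zero    P z rows st ls sat = [] , refl , sat , refl
elimination-sound (suc k) P z rows st ls sat =
  let x , lx , sat′ , eq = elimination-sound k P z (proj₂ (split rows)) (proj₁ (split rows) ∷ st) (proj₂ (split-length rows ls)) sat
  in _ ∷ x , cong suc lx , backStep-satisfied P (x ++ z) rows ls sat′ , eq

-- The rows that remain are sums of the given ones and do not involve the eliminated unknowns.
elimination-complete : ∀ k {m} z x rows st → HasLength (k + m) rows → length x ≡ k → Satisfied (x ++ z) rows →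
  Satisfied z (proj₁ (elimLoop k (rows , st)))
elimination-complete zero    z []      rows st ls lx sat = sat
elimination-complete (suc k) z (v ∷ x) rows st ls lx sat =
  elimination-complete k z x _ _ (proj₂ (split-length rows ls)) (suc-injective lx) (proj₂ (split-satisfied⁺ rows ls sat))

nth-++ : ∀ u v w → nth (u ++ v ∷ w) (length u) ≡ v
nth-++ []      v w = refl
nth-++ (_ ∷ u) v w = nth-++ u v w

-- Back substitution reproduces a solution if the free unknowns are read off that solution, reversed
-- because `P` is indexed from the end. Pivots force the other values. The suffix `y` collects the
-- entries already passed, so that `P` remains the same list during the induction.
back-substitution-complete : ∀ k {m} z x y rows st → HasLength (k + m) rows → length x ≡ k → Satisfied (x ++ z) rows →
  foldl (backStep (reverse (x ++ z) ++ y)) z (proj₂ (elimLoop k (rows , st)))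
    ≡ foldl (backStep (reverse (x ++ z) ++ y)) (x ++ z) st
back-substitution-complete zero    z []      y rows st ls lx sat = refl
back-substitution-complete (suc k) z (v ∷ x) y rows st ls lx sat =
  let ps , os = split-satisfied⁺ rows ls sat in
  subst (λ P → foldl (backStep P) z (proj₂ (elimLoop k (elimStep (rows , st)))) ≡ foldl (backStep P) (v ∷ x ++ z) st) (sym P≡)
    (trans (back-substitution-complete k z x (v ∷ y) (proj₂ (split rows)) (proj₁ (split rows) ∷ st)
        (proj₂ (split-length rows ls)) (suc-injective lx) os)
      (cong (λ b → foldl (backStep (reverse (x ++ z) ++ v ∷ y)) (b ∷ x ++ z) st) (leading (proj₁ (split rows)) ps)))
  where
  P≡ : reverse (v ∷ x ++ z) ++ y ≡ reverse (x ++ z) ++ v ∷ y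
  P≡ = trans (cong (_++ y) (unfold-reverse v (x ++ z))) (++-assoc (reverse (x ++ z)) (v ∷ []) y)
  leading : ∀ pv → All (λ p → dot p (x ++ z) ≡ v) pv →
    caseList pv (nth (reverse (x ++ z) ++ v ∷ y) (length (x ++ z))) (λ p _ → dot p (x ++ z)) ≡ v
  leading []      []      = trans (cong (nth (reverse (x ++ z) ++ v ∷ y)) (sym (length-reverse (x ++ z)))) (nth-++ (reverse (x ++ z)) v y)
  leading (p ∷ _) (e ∷ _) = e

evaluate : List Bool → Rows → List Bool
evaluate P = map (λ φ → dot φ P)

dot-combine : ∀ N P p Φ → HasLength N Φ → dot (combine N p Φ) P ≡ dot p (evaluate P Φ)
dot-combine N P p Φ ls = trans (go p Φ (replicate N false) ls (length-replicate N)) (cong (_xor dot p (evaluate P Φ)) (dot-zeros N P))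
  where
  dot-zeros : ∀ N P → dot (replicate N false) P ≡ false
  dot-zeros zero    P       = refl
  dot-zeros (suc N) []      = refl
  dot-zeros (suc N) (_ ∷ P) = dot-zeros N P
  go : ∀ p Φ s → HasLength N Φ → length s ≡ N →
    dot (foldl (λ s (c , φ) → if c then zipWith _xor_ s φ else s) s (zip p Φ)) P ≡ dot s P xor dot p (evaluate P Φ)
  go []          Φ       s ls       l = sym (xor-identityʳ _)
  go (_ ∷ p)     []      s ls       l = sym (xor-identityʳ _)
  go (false ∷ p) (φ ∷ Φ) s (_ ∷ ls) l = go p Φ s ls l
  go (true ∷ p)  (φ ∷ Φ) s (k ∷ ls) l = trans
    (go p Φ (zipWith _xor_ s φ) ls (trans (length-zipWith _xor_ s φ) (trans (cong₂ _⊓_ l k) (⊓-idem N))))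
    (trans (cong (_xor dot p (evaluate P Φ)) (dot-zipXor s φ P (trans l (sym k)))) (xor-assoc (dot s P) (dot φ P) _))

dot-unitForm : ∀ N i P → i < N → dot (unitForm N i) P ≡ nth P i
dot-unitForm N i P i<N = trans (dot-indicator N (i ∷ []) P (i<N ∷ [])) (xor-identityʳ _)

formStep-length : ∀ N Φ pv → HasLength N Φ → HasLength N (formStep N Φ pv)
formStep-length N Φ []      ls = length-indicator N (length Φ ∷ []) ∷ ls
formStep-length N Φ (p ∷ _) ls = length-combine N p Φ ls ∷ ls

forms-from-length : ∀ N Φ st → HasLength N Φ → HasLength N (foldl (formStep N) Φ st)
forms-from-length N Φ []        ls = ls
forms-from-length N Φ (pv ∷ st) ls = forms-from-length N _ st (formStep-length N Φ pv ls)

-- Evaluation commutes with each step of back substitution. The bound on the lengths keeps the index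
-- of every new parameter below `N`.
evaluate-forms : ∀ N P Φ st → HasLength N Φ → length st + length Φ ≤ N →
  evaluate P (foldl (formStep N) Φ st) ≡ foldl (backStep P) (evaluate P Φ) st
evaluate-forms N P Φ []        ls le = refl
evaluate-forms N P Φ (pv ∷ st) ls le =
  trans (evaluate-forms N P (formStep N Φ pv) st (formStep-length N Φ pv ls) (≤-trans (≤-reflexive (+-suc (length st) (length Φ))) le))
    (cong (λ b → foldl (backStep P) (b ∷ evaluate P Φ) st) (leading pv))
  where
  leading : ∀ pv → dot (caseList pv (unitForm N (length Φ)) (λ p _ → combine N p Φ)) P
    ≡ caseList pv (nth P (length (evaluate P Φ))) (λ p _ → dot p (evaluate P Φ))
  leading []      = trans (dot-unitForm N (length Φ) P (≤-trans (s≤s (m≤n+m _ (length st))) le)) (cong (nth P) (sym (length-map _ Φ)))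
  leading (p ∷ _) = dot-combine N P p Φ ls

stack-length : ∀ n s → length (proj₂ (elimLoop n s)) ≡ n + length (proj₂ s)
stack-length zero    s = refl
stack-length (suc n) s = trans (stack-length n (elimStep s)) (+-suc n (length (proj₂ s)))

forms-length : ∀ N Φ st → length (foldl (formStep N) Φ st) ≡ length st + length Φ
forms-length N Φ []        = refl
forms-length N Φ (pv ∷ st) = trans (forms-length N (formStep N Φ pv) st) (+-suc (length st) (length Φ))

length-solutionForms : ∀ n rows → length (solutionForms n rows) ≡ n
length-solutionForms n rows = trans (length-take n Φ) (trans (cong (n ⊓_) lΦ) (m≤n⇒m⊓n≡m (n≤1+n n)))
  where
  Φ = forms (suc n) (proj₂ (eliminate n rows))
  lΦ : length Φ ≡ suc n
  lΦ = trans (forms-length (suc n) _ (proj₂ (eliminate n rows)))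
    (trans (cong (_+ 1) (trans (stack-length n (rows , [])) (+-identityʳ n))) (+-comm n 1))

solutionForms-length : ∀ n rows → HasLength (suc n) (solutionForms n rows)
solutionForms-length n rows = All.take⁺ n
  (forms-from-length (suc n) _ (proj₂ (eliminate n rows)) (length-indicator (suc n) (0 ∷ []) ∷ []))

take-++ : ∀ {A : Set} n (x y : List A) → length x ≡ n → take n (x ++ y) ≡ x
take-++ zero    []      y eq = refl
take-++ (suc n) (a ∷ x) y eq = cong (a ∷_) (take-++ n x y (suc-injective eq))

evaluate-solutionForms : ∀ n p rows →
  evaluate (true ∷ p) (solutionForms n rows)
    ≡ take n (foldl (backStep (true ∷ p)) (true ∷ []) (proj₂ (eliminate n rows)))
evaluate-solutionForms n p rows = trans (sym (take-map n Φ)) (cong (take n)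
  (trans (evaluate-forms (suc n) (true ∷ p) _ stack (length-indicator (suc n) (0 ∷ []) ∷ [])
           (≤-reflexive (trans (+-comm _ 1) (cong suc (trans (stack-length n (rows , [])) (+-identityʳ n))))))
    (cong (λ b → foldl (backStep (true ∷ p)) (b ∷ []) stack) (dot-unitForm (suc n) 0 (true ∷ p) (s≤s z≤n)))))
  where
  stack = proj₂ (eliminate n rows)
  Φ = forms (suc n) stack

module _ (n : ℕ) (rows : Rows) (ls : HasLength (n + 1) rows) {x : List Bool} (lx : length x ≡ n) (sat : Satisfied (x ++ true ∷ []) rows) where

  -- Once all unknowns are eliminated, only conditions on the constants remain. They do not mention
  -- the parameters, so the one known solution `x` verifies them for every `p`.
  solutionForms-sound : ∀ p → Satisfied (evaluate (true ∷ p) (solutionForms n rows) ++ true ∷ []) rows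
  solutionForms-sound p =
    let y , ly , saty , eq = elimination-sound n (true ∷ p) (true ∷ []) rows [] ls
                               (elimination-complete n (true ∷ []) x rows [] ls lx sat)
    in subst (λ u → Satisfied (u ++ true ∷ []) rows)
         (sym (trans (evaluate-solutionForms n p rows) (trans (cong (take n) eq) (take-++ n y (true ∷ []) ly)))) saty

  -- Every unknown has a parameter of its own, so the entries of `x` themselves can serve as
  -- parameters.
  solutionForms-complete : evaluate (true ∷ reverse x) (solutionForms n rows) ≡ x
  solutionForms-complete = trans (evaluate-solutionForms n (reverse x) rows)
    (trans (cong (take n) (subst (λ P → foldl (backStep P) (true ∷ []) (proj₂ (eliminate n rows)) ≡ x ++ true ∷ []) P≡
      (back-substitution-complete n (true ∷ []) x [] rows [] ls lx sat))) (take-++ n x (true ∷ []) lx))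
    where
    P≡ : reverse (x ++ true ∷ []) ++ [] ≡ true ∷ reverse x
    P≡ = trans (++-identityʳ _) (reverse-++ x (true ∷ []))

-- Nearest Codeword and Odd Set

dot-++ : ∀ r s x y → length r ≡ length x → dot (r ++ s) (x ++ y) ≡ dot r x xor dot s y
dot-++ []      s []      y eq = refl
dot-++ (a ∷ r) s (v ∷ x) y eq =
  trans (cong ((a ∧ v) xor_) (dot-++ r s x y (suc-injective eq))) (sym (xor-assoc (a ∧ v) (dot r x) (dot s y)))

dot-equation : ∀ r b x → length r ≡ length x → dot (r ++ b ∷ []) (x ++ true ∷ []) ≡ residual x (b , r)
dot-equation r b x eq = trans (dot-++ r (b ∷ []) x (true ∷ []) eq)
  (cong (dot r x xor_) (trans (xor-identityʳ _) (∧-identityʳ b)))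

-- The right-hand side becomes the coefficient of the last unknown, which has the value 1.
keep : Equation × Bool → Rows
keep ((b , r) , deleted) = if deleted then [] else (r ++ b ∷ []) ∷ []

kept : List Equation → List Bool → Rows
kept es W = concat (map keep (zip es W))

kept-length : ∀ n es W → All (λ e → length (proj₂ e) ≡ n) es → HasLength (n + 1) (kept es W)
kept-length n []             W           ls       = []
kept-length n (e ∷ es)       []          ls       = []
kept-length n (e ∷ es)       (true ∷ W)  (l ∷ ls) = kept-length n es W ls
kept-length n ((b , r) ∷ es) (false ∷ W) (l ∷ ls) = trans (length-++ r) (cong (_+ 1) l) ∷ kept-length n es W ls

kept-satisfied : ∀ n x es W → length x ≡ n → All (λ e → length (proj₂ e) ≡ n) es →
  map (residual x) es ≼ W → Satisfied (x ++ true ∷ []) (kept es W)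
kept-satisfied n x []             []          lx ls       []       = []
kept-satisfied n x (e ∷ es)       (true ∷ W)  lx (l ∷ ls) (p ∷ ps) = kept-satisfied n x es W lx ls ps
kept-satisfied n x ((b , r) ∷ es) (false ∷ W) lx (l ∷ ls) (p ∷ ps) =
  trans (dot-equation r b x (trans l (sym lx))) (≤ᵇ-false p) ∷ kept-satisfied n x es W lx ls ps

satisfied-kept : ∀ n x es W → length x ≡ n → All (λ e → length (proj₂ e) ≡ n) es → length W ≡ length es →
  Satisfied (x ++ true ∷ []) (kept es W) → map (residual x) es ≼ W
satisfied-kept n x []             []          lx ls       eq sat = []
satisfied-kept n x (e ∷ es)       (true ∷ W)  lx (l ∷ ls) eq sat =
  ≤ᵇ-true _ ∷ satisfied-kept n x es W lx ls (suc-injective eq) sat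
satisfied-kept n x ((b , r) ∷ es) (false ∷ W) lx (l ∷ ls) eq (s ∷ sat)
  rewrite trans (sym (dot-equation r b x (trans l (sym lx)))) s = b≤b ∷ satisfied-kept n x es W lx ls (suc-injective eq) sat

NearestCodeword⊑MinLin : Simulation NearestCodeword MinLin
NearestCodeword⊑MinLin = record
  { F = F
  ; G = λ I W → fit (n I) (G I (toList W))
  ; F-computes = extC enc-nc (λ _ → refl) (reindexC rawNC (computes
      ⟨ fstF , zipF {b = bool} {d = seq bool} (sndF ∘F sndF) (fstF ∘F sndF) ⟩F))
  ; G-computes = extC {i = λ (I , W) → enc (ncCode ⊠ seq bool) (rawNC I , toList W)}
      (λ (I , W) → cong₂ _,_ (enc-nc I) (enc-bits W))
      (λ (I , W) → trans (cong (enc (seq bool)) (sym (toList-fit (n I) _ (length-G I (toList W))))) (enc-bits (fit (n I) (G I (toList W)))))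
      (reindexC (λ (I , W) → rawNC I , toList W) (computes solveF))
  ; forth = λ I x _ →
      let es = equations I
          vs = map (residual (toList x)) es
          W = fit (length es) vs
          W≡ = toList-fit _ vs (length-map _ es)
      in W , (toList x , ≼-reflexive (sym W≡)) ,
        ≤-reflexive (trans (∣∣-trues W) (trans (cong trues W≡) (sym (hamming-trues (A I) x (b I)))))
  ; back = λ I _ W (x , p) →
      let es = equations I
          x₀ = toList (fit (n I) x)
          sat = kept-satisfied (n I) x₀ es (toList W) (length-toList (fit (n I) x)) (lens I)
                  (subst (_≼ toList W) (sym (residuals-fit (n I) x es (lens I))) p)
          y = G I (toList W)
          q : map (residual y) es ≼ toList W
          q = satisfied-kept (n I) y es (toList W) (length-G I (toList W)) (lens I) (length-toList W)
                (solutionForms-sound (n I) (kept es (toList W)) (kept-length (n I) es (toList W) (lens I))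
                  (length-toList (fit (n I) x)) sat (replicate (n I) false))
      in tt , (begin
          hamming (A I *ᵥ fit (n I) y) (b I)
            ≡⟨ hamming-trues (A I) (fit (n I) y) (b I) ⟩
          trues (map (residual (toList (fit (n I) y))) es)
            ≡⟨ cong (λ u → trues (map (residual u) es)) (toList-fit (n I) y (length-G I (toList W))) ⟩
          trues (map (residual y) es)
            ≤⟨ trues-mono q ⟩
          trues (toList W)
            ≡⟨ ∣∣-trues W ⟨
          ∣ W ∣ ∎)
  }
  where
  open ≤-Reasoning
  open NCInstance
  ncCode : Code
  ncCode = nat ⊠ seq (seq bool) ⊠ seq bool
  rawNC : NCInstance → El ncCode
  rawNC I = n I , toRows (A I) , toList (b I)
  enc-nc : ∀ I → enc ncCode (rawNC I) ≡ encodeInstance NearestCodeword I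
  enc-nc I = cong (encodeℕ (n I) ,_) (cong₂ _,_ (enc-rows (A I)) (enc-bits (b I)))
  equations : NCInstance → List Equation
  equations I = zip (toList (b I)) (toRows (A I))
  lens : ∀ I → All (λ e → length (proj₂ e) ≡ n I) (equations I)
  lens I = go (b I) (A I)
    where
    go : ∀ {m n} (b : Vec Bool m) (A : Matrix m n) → All (λ e → length (proj₂ e) ≡ n) (zip (toList b) (toRows A))
    go []      []      = []
    go (b ∷ v) (u ∷ A) = length-toList u ∷ go v A
  F : NCInstance → LinInstance
  F I = record { n = n I ; equations = equations I ; lengths = lens I }
  solve : El (ncCode ⊠ seq bool) → List Bool
  -- Any solution of the kept equations will do; this is the one with all parameters `false`.
  solve ((n , As , bs) , W) = evaluate (true ∷ replicate n false) (solutionForms n (kept (zip bs As) W))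
  G : (I : NCInstance) → List Bool → List Bool
  G I W = solve (rawNC I , W)
  length-G : ∀ I W → length (G I W) ≡ n I
  length-G I W = trans (length-map _ (solutionForms (n I) (kept (equations I) W))) (length-solutionForms (n I) _)
  solveF : FP {ncCode ⊠ seq bool} {seq bool} solve
  solveF = mapF {b = seq bool} {d = bool} {f = λ (((n , _) , _) , φ) → dot φ (true ∷ replicate n false)}
    (dotF sndF (trueF ∷F replicateF {b = bool} (fstF ∘F fstF ∘F fstF) falseF))
    (solutionFormsF (fstF ∘F fstF) (concatF {b = seq bool} (mapF {b = (bool ⊠ seq bool) ⊠ bool} {d = seq (seq bool)} {f = λ (_ , e) → keep e}
      (ifF {b = rowsCode} (sndF ∘F sndF) []F (++F {b = bool} (sndF ∘F fstF ∘F sndF) ((fstF ∘F fstF ∘F sndF) ∷F []F) ∷F []F))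
      (zipF {b = bool ⊠ seq bool} {d = bool} (zipF {b = bool} {d = seq bool} (sndF ∘F sndF ∘F fstF) (fstF ∘F sndF ∘F fstF)) sndF))))

dot-∩ : ∀ {n} (u T : Subset n) → xorAll (toList (u ∩ T)) ≡ dot (toList u) (toList T)
dot-∩ []      []      = refl
dot-∩ (a ∷ u) (b ∷ T) = cong ((a ∧ b) xor_) (dot-∩ u T)

odd-∩ : ∀ {n} (u T : Subset n) → odd ∣ u ∩ T ∣ ≡ dot (toList u) (toList T)
odd-∩ u T = trans (cong odd (∣∣-trues (u ∩ T))) (trans (odd-trues (toList (u ∩ T))) (dot-∩ u T))

Hits : List Bool → Rows → Set
Hits T = All (λ s → dot s T ≡ true)

feasible⇒hits : ∀ {m n} (S : Vec (Subset n) m) T → (∀ i → 2 ∤ ∣ Vec.lookup S i ∩ T ∣) → Hits (toList T) (toRows S)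
feasible⇒hits []      T h = []
feasible⇒hits (u ∷ S) T h = trans (sym (odd-∩ u T)) (2∤⇒odd _ (h zero)) ∷ feasible⇒hits S T (λ i → h (suc i))

hits⇒feasible : ∀ {m n} (S : Vec (Subset n) m) T → Hits (toList T) (toRows S) → ∀ i → 2 ∤ ∣ Vec.lookup S i ∩ T ∣
hits⇒feasible (u ∷ S) T (h ∷ hs) zero    = odd⇒2∤ (trans (odd-∩ u T) h)
hits⇒feasible (u ∷ S) T (h ∷ hs) (suc i) = hits⇒feasible S T hs i

toRows-length : ∀ {m n} (S : Vec (Vec Bool n) m) → HasLength n (toRows S)
toRows-length []      = []
toRows-length (u ∷ S) = length-toList u ∷ toRows-length S

fitRows : ∀ n (rs : Rows) → Vec (Vec Bool n) (length rs)
fitRows n rs = Vec.map (fit n) (fromList rs)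

toRows-fitRows : ∀ n rs → HasLength n rs → toRows (fitRows n rs) ≡ rs
toRows-fitRows n []       []       = refl
toRows-fitRows n (r ∷ rs) (l ∷ ls) = cong₂ _∷_ (toList-fit n r l) (toRows-fitRows n rs ls)

oddSetCode : Code
oddSetCode = nat ⊠ seq (seq bool)

rawOddSet : OddSetInstance → El oddSetCode
rawOddSet I = OddSetInstance.n I , toRows (OddSetInstance.S I)

enc-oddSet : ∀ I → enc oddSetCode (rawOddSet I) ≡ encodeInstance OddSet I
enc-oddSet I = cong (encodeℕ (OddSetInstance.n I) ,_) (enc-rows (OddSetInstance.S I))

head : List Bool → Bool
head φ = caseList φ false (λ c _ → c)

-- The head of a form is an entry of `b` and its tail a row of `A`, so the mismatches at `x` are the
-- members of the set with parameters `x`. Feasibility is essential in `back`: for an unsolvable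
-- system the forms do not describe solutions.
OddSet⊑NearestCodeword : Simulation OddSet NearestCodeword
OddSet⊑NearestCodeword = record
  { F = F
  ; G = λ I x → fit (n I) (values I (toList x))
  ; F-computes = extC enc-oddSet enc-F (reindexC rawOddSet (computes systemF))
  ; G-computes = extC {i = λ (I , x) → enc (oddSetCode ⊠ seq bool) (rawOddSet I , toList x)}
      (λ (I , x) → cong₂ _,_ (enc-oddSet I) (enc-bits x))
      (λ (I , x) → trans (cong (enc (seq bool)) (sym (toList-fit (n I) _ (length-values I (toList x)))))
        (enc-bits (fit (n I) (values I (toList x)))))
      (reindexC (λ (I , x) → rawOddSet I , toList x) (computes valuesF))
  ; forth = λ I T h →
      -- `T` supplies its own parameters, which are numbered from the last element on.
      let x = reverse (toList T)
          v = fit (n I) x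
          v≡ = toList-fit (n I) x (trans (length-reverse (toList T)) (length-toList T))
      in v , tt , ≤-reflexive (trans (cost-values I v) (trans (cong trues (trans (cong (values I) v≡)
           (solutionForms-complete (n I) (system I) (system-length I) (length-toList T) (hits⇒satisfied I T h))))
           (sym (∣∣-trues T))))
  ; back = λ I (T , h) x _ →
      let y = values I (toList x)
          y≡ = toList-fit (n I) y (length-values I (toList x))
      in hits⇒feasible (S I) (fit (n I) y) (subst (λ u → Hits u (toRows (S I))) (sym y≡)
           (satisfied⇒hits (toRows (S I)) y (length-values I (toList x)) (toRows-length (S I))
             (solutionForms-sound (n I) (system I) (system-length I) (length-toList T) (hits⇒satisfied I T h) (toList x)))) ,
         ≤-reflexive (trans (∣∣-trues (fit (n I) y)) (trans (cong trues y≡) (sym (cost-values I x))))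
  }
  where
  open OddSetInstance
  systemRaw : Rows → Rows
  systemRaw = map (λ s → s ++ true ∷ [])
  system : OddSetInstance → Rows
  system I = systemRaw (toRows (S I))
  formsOf : El oddSetCode → Rows
  formsOf (n , ss) = solutionForms n (systemRaw ss)
  values : OddSetInstance → List Bool → List Bool
  values I x = evaluate (true ∷ x) (formsOf (rawOddSet I))
  length-values : ∀ I x → length (values I x) ≡ n I
  length-values I x = trans (length-map _ (formsOf (rawOddSet I))) (length-solutionForms (n I) (system I))
  system-length : ∀ I → HasLength (n I + 1) (system I)
  system-length I = go (toRows (S I)) (toRows-length (S I))
    where
    go : ∀ ss → HasLength (n I) ss → HasLength (n I + 1) (systemRaw ss)
    go []       []       = []
    go (s ∷ ss) (l ∷ ls) = trans (length-++ s) (cong (_+ 1) l) ∷ go ss ls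
  hits⇒satisfied : ∀ I T → (∀ i → 2 ∤ ∣ Vec.lookup (S I) i ∩ T ∣) → Satisfied (toList T ++ true ∷ []) (system I)
  hits⇒satisfied I T h = go (toRows (S I)) (toRows-length (S I)) (feasible⇒hits (S I) T h)
    where
    go : ∀ ss → HasLength (n I) ss → Hits (toList T) ss → Satisfied (toList T ++ true ∷ []) (systemRaw ss)
    go []       []       []       = []
    go (s ∷ ss) (l ∷ ls) (h ∷ hs) =
      trans (dot-equation s true (toList T) (trans l (sym (length-toList T)))) (cong (_xor true) h) ∷ go ss ls hs
  satisfied⇒hits : ∀ {n} ss y → length y ≡ n → HasLength n ss → Satisfied (y ++ true ∷ []) (systemRaw ss) → Hits y ss
  satisfied⇒hits []       y ly []       []       = []
  satisfied⇒hits (s ∷ ss) y ly (l ∷ ls) (e ∷ es) =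
    xor≡false⇒≡ (trans (sym (dot-equation s true y (trans l (sym ly)))) e) ∷ satisfied⇒hits ss y ly ls es
  tails-length : ∀ n Φ → HasLength (suc n) Φ → HasLength n (map tail Φ)
  tails-length n []            []       = []
  tails-length n ((_ ∷ φ) ∷ Φ) (l ∷ ls) = suc-injective l ∷ tails-length n Φ ls
  linear : OddSetInstance → Rows
  linear I = map tail (formsOf (rawOddSet I))
  F : OddSetInstance → NCInstance
  F I = record
    { m = length (linear I) ; n = n I
    ; A = fitRows (n I) (linear I)
    ; b = fit (length (linear I)) (map head (formsOf (rawOddSet I))) }
  toRows-A : ∀ I → toRows (NCInstance.A (F I)) ≡ linear I
  toRows-A I = toRows-fitRows (n I) (linear I) (tails-length (n I) _ (solutionForms-length (n I) (system I)))
  toList-b : ∀ I → toList (NCInstance.b (F I)) ≡ map head (formsOf (rawOddSet I))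
  toList-b I = toList-fit _ _ (trans (length-map head (formsOf (rawOddSet I))) (sym (length-map tail (formsOf (rawOddSet I)))))
  cost-values : ∀ I x → hamming (NCInstance.A (F I) *ᵥ x) (NCInstance.b (F I)) ≡ trues (values I (toList x))
  cost-values I x = trans (hamming-trues (NCInstance.A (F I)) x (NCInstance.b (F I))) (cong trues
    (trans (cong₂ (λ bs As → map (residual (toList x)) (zip bs As)) (toList-b I) (toRows-A I))
      (go (formsOf (rawOddSet I)) (solutionForms-length (n I) (system I)))))
    where
    go : ∀ {k} Φ → HasLength (suc k) Φ → map (residual (toList x)) (zip (map head Φ) (map tail Φ)) ≡ evaluate (true ∷ toList x) Φ
    go []            []       = refl
    go ((c ∷ φ) ∷ Φ) (l ∷ ls) = cong₂ _∷_
      (trans (xor-comm (dot φ (toList x)) c) (cong (_xor dot φ (toList x)) (sym (∧-identityʳ c)))) (go Φ ls)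
  formsOfF : FP {oddSetCode} {rowsCode} formsOf
  formsOfF = solutionFormsF fstF (mapF {b = seq bool} {d = seq bool} {f = λ (_ , s) → s ++ true ∷ []}
    (++F {b = bool} sndF (trueF ∷F []F)) sndF)
  systemF : FP {oddSetCode} {nat ⊠ rowsCode ⊠ seq bool} (λ I → proj₁ I , map tail (formsOf I) , map head (formsOf I))
  systemF = ⟨ fstF , ⟨ mapF {b = seq bool} {d = seq bool} {f = λ (_ , φ) → tail φ} (tailF {b = bool} sndF) formsOfF ,
    mapF {b = seq bool} {d = bool} {f = λ (_ , φ) → head φ} (caseF {b = bool} {d = bool} sndF falseF (fstF ∘F sndF)) formsOfF ⟩F ⟩F
  enc-F : ∀ I → enc (nat ⊠ rowsCode ⊠ seq bool) (n I , linear I , map head (formsOf (rawOddSet I))) ≡ encodeInstance NearestCodeword (F I)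
  enc-F I = cong (encodeℕ (n I) ,_) (cong₂ _,_
    (trans (cong (enc rowsCode) (sym (toRows-A I))) (enc-rows (NCInstance.A (F I))))
    (trans (cong (enc (seq bool)) (sym (toList-b I))) (enc-bits (NCInstance.b (F I)))))
  valuesF : FP {oddSetCode ⊠ seq bool} {seq bool} (λ (I , x) → evaluate (true ∷ x) (formsOf I))
  valuesF = mapF {b = seq bool} {d = bool} {f = λ ((_ , x) , φ) → dot φ (true ∷ x)}
    (dotF sndF (trueF ∷F sndF ∘F fstF)) (formsOfF ∘F fstF)

-- The equations r · x + b + yᵢ = 0 in the unknowns x and y, where y marks the violated equations.
slackRow : ℕ → ℕ × Equation → List Bool
slackRow m (i , b , r) = r ++ b ∷ unitForm m i

-- The constant column stands between x and y. Thus it leads once x is eliminated, and one more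
-- `split` separates the equations by their constants.
slackRows : List Equation → Rows
slackRows es = map (slackRow (length es)) (indexed es)

-- From equations (c ∷ h), meaning h · y = c, to sets to be hit oddly.
oddSets : Rows → Rows
oddSets rows = caseList (proj₁ (split rows)) [] (λ p _ → p ∷ map (zipWith _xor_ p) (proj₂ (split rows)))

module _ (n : ℕ) (es : List Equation) (ls : All (λ e → length (proj₂ e) ≡ n) es) where

  private
    m : ℕ
    m = length es

  slackRows-length : HasLength (n + suc m) (slackRows es)
  slackRows-length = subst (λ l → HasLength (n + suc m) (map (slackRow m) l)) (sym (indexed-enumFrom es)) (go 0 es ls)
    where
    go : ∀ k es → All (λ e → length (proj₂ e) ≡ n) es → HasLength (n + suc m) (map (slackRow m) (enumFrom k es))
    go k []             []       = []
    go k ((b , r) ∷ es) (l ∷ ls) = trans (length-++ r) (cong₂ (λ i j → i + suc j) l (length-indicator m (k ∷ []))) ∷ go (suc k) es ls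

  module _ (x : List Bool) (lx : length x ≡ n) (y : List Bool) where

    dot-slackRow : ∀ k b r {v t} → k < m → length r ≡ n → List.drop k y ≡ v ∷ t →
      dot (slackRow m (k , b , r)) (x ++ true ∷ y) ≡ residual x (b , r) xor v
    dot-slackRow k b r {v} k<m l at = begin
      dot (r ++ b ∷ unitForm m k) (x ++ true ∷ y)
        ≡⟨ dot-++ r (b ∷ unitForm m k) x (true ∷ y) (trans l (sym lx)) ⟩
      dot r x xor ((b ∧ true) xor dot (unitForm m k) y)
        ≡⟨ cong₂ (λ c d → dot r x xor (c xor d)) (∧-identityʳ b) (trans (dot-unitForm m k y k<m) (proj₁ (drop-∷ k y at))) ⟩
      dot r x xor (b xor v)
        ≡⟨ xor-assoc (dot r x) b v ⟨
      residual x (b , r) xor v ∎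
      where open ≡-Reasoning

    slack-satisfied⁺ : map (residual x) es ≡ y → Satisfied (x ++ true ∷ y) (slackRows es)
    slack-satisfied⁺ eq = subst (λ l → Satisfied (x ++ true ∷ y) (map (slackRow m) l)) (sym (indexed-enumFrom es)) (go 0 es ls refl (sym eq))
      where
      go : ∀ k es → All (λ e → length (proj₂ e) ≡ n) es → k + length es ≡ m → List.drop k y ≡ map (residual x) es →
        Satisfied (x ++ true ∷ y) (map (slackRow m) (enumFrom k es))
      go k []             []       eq at = []
      go k ((b , r) ∷ es) (l ∷ ls) eq at =
        trans (dot-slackRow k b r (≤-trans (s≤s (m≤m+n k (length es))) (≤-reflexive (trans (sym (+-suc k (length es))) eq))) l at)
          (xor-same (residual x (b , r)))
        ∷ go (suc k) es ls (trans (sym (+-suc k (length es))) eq) (proj₂ (drop-∷ k y at))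

    slack-satisfied⁻ : length y ≡ m → Satisfied (x ++ true ∷ y) (slackRows es) → map (residual x) es ≡ y
    slack-satisfied⁻ ly sat = go 0 es y ls refl refl (sym ly)
      (subst (λ l → Satisfied (x ++ true ∷ y) (map (slackRow m) l)) (indexed-enumFrom es) sat)
      where
      go : ∀ k es u → All (λ e → length (proj₂ e) ≡ n) es → k + length es ≡ m → List.drop k y ≡ u → length es ≡ length u →
        Satisfied (x ++ true ∷ y) (map (slackRow m) (enumFrom k es)) → map (residual x) es ≡ u
      go k []             []      ls       eq at lu []       = refl
      go k ((b , r) ∷ es) (v ∷ u) (l ∷ ls) eq at lu (s ∷ sat) = cong₂ _∷_
        (xor≡false⇒≡ (trans (sym (dot-slackRow k b r
          (≤-trans (s≤s (m≤m+n k (length es))) (≤-reflexive (trans (sym (+-suc k (length es))) eq))) l at)) s))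
        (go (suc k) es u ls (trans (sym (+-suc k (length es))) eq) (proj₂ (drop-∷ k y at)) (suc-injective lu) sat)

oddSets-length : ∀ {k} rows → HasLength (suc k) rows → HasLength k (oddSets rows)
oddSets-length rows ls with split rows | split-length rows ls
... | []    , o | _            = []
... | p ∷ _ , o | lp ∷ _ , los = lp ∷ go o los
  where
  go : ∀ o → HasLength _ o → HasLength _ (map (zipWith _xor_ p) o)
  go []      []       = []
  go (q ∷ o) (lq ∷ lo) = trans (length-zipWith _xor_ p q) (trans (cong₂ _⊓_ lp lq) (⊓-idem _)) ∷ go o lo

oddSets-hits⁺ : ∀ {k} y rows → HasLength (suc k) rows → Satisfied (true ∷ y) rows → Hits y (oddSets rows)
oddSets-hits⁺ y rows ls sat with split rows | split-length rows ls | split-satisfied⁺ rows ls sat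
... | []    , o | _            | _            = []
... | p ∷ _ , o | lp ∷ _ , los | p≡ ∷ _ , os = p≡ ∷ go o los os
  where
  go : ∀ o → HasLength _ o → Satisfied y o → Hits y (map (zipWith _xor_ p) o)
  go []      []        []       = []
  go (q ∷ o) (lq ∷ lo) (e ∷ es) = trans (dot-zipXor p q y (trans lp (sym lq))) (cong₂ _xor_ p≡ e) ∷ go o lo es

-- Without odd equation there are no sets, but then the empty set solves the equations.
oddSets-hits⁻ : ∀ {k} y rows → length y ≡ k → HasLength (suc k) rows → Hits y (oddSets rows) →
  ∃[ u ] length u ≡ k × u ≼ y × Satisfied (true ∷ u) rows
oddSets-hits⁻ {k} y rows ly ls hits with split rows in eq | split-length rows ls | split-atMostOne rows
... | [] , o | _ | none = replicate k false , length-replicate k , subst (λ k → replicate k false ≼ y) ly (zeros≼ y) ,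
  split-satisfied⁻ rows ls (subst (SplitSatisfied true (replicate k false)) (sym eq) ([] , All.universal (λ r → dot-zeros r k) o))
  where
  zeros≼ : ∀ y → replicate (length y) false ≼ y
  zeros≼ []          = []
  zeros≼ (false ∷ y) = b≤b ∷ zeros≼ y
  zeros≼ (true  ∷ y) = f≤t ∷ zeros≼ y
  dot-zeros : ∀ r k → dot r (replicate k false) ≡ false
  dot-zeros []          k       = refl
  dot-zeros (_ ∷ r)     zero    = refl
  dot-zeros (false ∷ r) (suc k) = dot-zeros r k
  dot-zeros (true  ∷ r) (suc k) = dot-zeros r k
oddSets-hits⁻ y rows ly ls (p≡ ∷ hits) | p ∷ [] , o | lp ∷ _ , los | one = y , ly , ≼-refl ,
  split-satisfied⁻ rows ls (subst (SplitSatisfied true y) (sym eq) (p≡ ∷ [] , go o los hits))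
  where
  go : ∀ o → HasLength _ o → Hits y (map (zipWith _xor_ p) o) → Satisfied y o
  go []      []        []       = []
  go (q ∷ o) (lq ∷ lo) (h ∷ hs) =
    cancel p≡ (trans (sym (dot-zipXor p q y (trans lp (sym lq)))) h) ∷ go o lo hs
    where
    cancel : ∀ {a c} → a ≡ true → a xor c ≡ true → c ≡ false
    cancel {c = false} refl _ = refl

MinLin⊑OddSet : Simulation MinLin OddSet
MinLin⊑OddSet = record
  { F = F
  ; G = λ I T → T
  ; F-computes = extC (λ _ → refl) enc-F (reindexC (λ I → n I , equations I) (computes setsF))
  ; G-computes = primC snd
  ; forth = λ I W (x , p) →
      let x′ = toList (fit (n I) x)
          lx = length-toList (fit (n I) x)
          y  = map (residual x′) (equations I)
          T  = fit (length (equations I)) y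
          T≡ = toList-fit _ y (length-map _ (equations I))
      in T ,
        hits⇒feasible (OddSetInstance.S (F I)) T (subst₂ Hits (sym T≡) (sym (toRows-S I))
          (oddSets-hits⁺ y (remaining I) (remaining-length I)
            (elimination-complete (n I) (true ∷ y) x′ (slackRows (equations I)) [] (slackRows-length (n I) (equations I) (lengths I)) lx
              (slack-satisfied⁺ (n I) (equations I) (lengths I) x′ lx y refl)))) ,
        (begin
          ∣ T ∣                                   ≡⟨ trans (∣∣-trues T) (cong trues T≡) ⟩
          trues y                                 ≡⟨ cong trues (residuals-fit (n I) x (equations I) (lengths I)) ⟩
          trues (map (residual x) (equations I))  ≤⟨ trues-mono p ⟩
          trues (toList W)                        ≡⟨ ∣∣-trues W ⟨
          ∣ W ∣                                   ∎)
  ; back = λ I _ T h →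
      let u , lu , u≼T , sat = oddSets-hits⁻ (toList T) (remaining I) (length-toList T) (remaining-length I)
            (subst (Hits (toList T)) (toRows-S I) (feasible⇒hits (OddSetInstance.S (F I)) T h))
          -- A vector x is needed only as a witness, not as output; the empty list makes all its
          -- free unknowns `false`.
          x , lx , sat′ , _ = elimination-sound (n I) [] (true ∷ u) (slackRows (equations I)) []
            (slackRows-length (n I) (equations I) (lengths I)) sat
      in (x , ≼-trans (≼-reflexive (slack-satisfied⁻ (n I) (equations I) (lengths I) x lx u lu sat′)) u≼T) , ≤-refl
  }
  where
  open ≤-Reasoning
  open LinInstance
  remaining : LinInstance → Rows
  remaining I = proj₁ (eliminate (n I) (slackRows (equations I)))
  remaining-length : ∀ I → HasLength (suc (length (equations I))) (remaining I)
  remaining-length I = eliminated-length (n I) (slackRows (equations I)) [] (slackRows-length (n I) (equations I) (lengths I))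
  F : LinInstance → OddSetInstance
  F I = record
    { n = length (equations I) ; m = length (oddSets (remaining I))
    ; S = fitRows (length (equations I)) (oddSets (remaining I)) }
  toRows-S : ∀ I → toRows (OddSetInstance.S (F I)) ≡ oddSets (remaining I)
  toRows-S I = toRows-fitRows _ (oddSets (remaining I)) (oddSets-length (remaining I) (remaining-length I))
  enc-F : ∀ I → enc oddSetCode (length (equations I) , oddSets (remaining I)) ≡ encodeInstance OddSet (F I)
  enc-F I = trans (cong (λ ss → enc oddSetCode (length (equations I) , ss)) (sym (toRows-S I))) (enc-oddSet (F I))
  oddSetsF : FP {rowsCode} {rowsCode} oddSets
  oddSetsF = caseF {b = seq bool} {d = rowsCode} (fstF ∘F splitF idF) []F
    ((fstF ∘F sndF) ∷F mapF {b = seq bool} {d = seq bool} {f = λ ((_ , p , _) , q) → zipWith _xor_ p q}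
      (zipXorF (fstF ∘F sndF ∘F fstF) sndF) (sndF ∘F splitF fstF))
  setsF : FP {linCode} {oddSetCode} (λ (n , es) → length es , oddSets (proj₁ (eliminate n (slackRows es))))
  setsF = ⟨ lengthF {b = bool ⊠ seq bool} sndF , oddSetsF ∘F fstF ∘F eliminateF fstF
    (mapF {b = nat ⊠ bool ⊠ seq bool} {d = seq bool} {f = λ ((_ , es) , e) → slackRow (length es) e}
      (++F {b = bool} (sndF ∘F sndF ∘F sndF)
        ((fstF ∘F sndF ∘F sndF) ∷F indicatorF (lengthF {b = bool ⊠ seq bool} (sndF ∘F fstF)) ((fstF ∘F sndF) ∷F []F)))
      (indexedF {b = bool ⊠ seq bool} sndF)) ⟩F

-- The pairwise equivalences

theorem9 : AllPairs _≈ᶜᵖ_ (NearestCodeword ∷ OddSet ∷ MinCSP B₂ ∷ MinCSP B₃ ∷ [])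
theorem9 =
  ((NC≤OS , OS≤NC) ∷ (NC≤B₂ , B₂≤NC) ∷ (NC≤B₃ , B₃≤NC) ∷ []) ∷
  ((OS≤NC ∙ NC≤B₂ , B₂≤NC ∙ NC≤OS) ∷ (OS≤NC ∙ NC≤B₃ , B₃≤NC ∙ NC≤OS) ∷ []) ∷
  ((B₂≤B₃ , B₃≤NC ∙ NC≤B₂) ∷ []) ∷ [] ∷ []
  where
  open Simulation
  _∙_ = ≤ᶜᵖ-trans
  -- `reduction` needs optima of its target. They are pulled back along simulations, so they spread
  -- from Nearest Codeword against the direction of the arrows before any reduction is formed.
  optima-OS = hasOptima OddSet⊑NearestCodeword nearest-optimum
  optima-ML = hasOptima MinLin⊑OddSet optima-OS
  optima-B₃ = hasOptima (MinCSP⊑MinLin B₃-affine) optima-ML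
  optima-B₂ = hasOptima MinCSP-B₂⊑B₃ optima-B₃
  NC≤ML = reduction NearestCodeword⊑MinLin optima-ML
  ML≤OS = reduction MinLin⊑OddSet optima-OS
  OS≤NC = reduction OddSet⊑NearestCodeword nearest-optimum
  ML≤B₂ = reduction MinLin⊑MinCSP-B₂ optima-B₂
  B₂≤B₃ = reduction MinCSP-B₂⊑B₃ optima-B₃
  B₃≤ML = reduction (MinCSP⊑MinLin B₃-affine) optima-ML
  NC≤OS = NC≤ML ∙ ML≤OS
  NC≤B₂ = NC≤ML ∙ ML≤B₂
  NC≤B₃ = NC≤B₂ ∙ B₂≤B₃
  B₃≤NC = (B₃≤ML ∙ ML≤OS) ∙ OS≤NC
  B₂≤NC = B₂≤B₃ ∙ B₃≤NC
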